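{- For all integers $t\ge s\ge 2$ there exists a constant $c=c(s,t)>0$ such that the following holds for every $d>0$. Every $K_{s,t}$-free graph $G$ with average degree $d$ contains a subdivision of a clique with at least $c\,d^{\frac{1}{2}\frac{s}{s-1}}$ vertices.
   Context: A subdivision of a graph $H$ is a graph obtained from $H$ by replacing each edge by a path, these paths being internally vertex-disjoint; $G$ contains a subdivision of $K_m$ if some subgraph of $G$ is such a subdivision. A graph is $K_{s,t}$-free if it has no (not necessarily induced) subgraph isomorphic to the complete bipartite graph $K_{s,t}$. -}

module Defs where

open import Data.Nat using (ℕ; zero; suc; _+_; _*_; _∸_; _^_; _≤_; _<_)
open import Data.Fin using (Fin)
import Data.Fin as F
open import Data.Bool using (Bool; true; false; if_then_else_)
open import Data.List using (List; []; _∷_; _++_; [_]; map; allFin)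
open import Data.Nat.ListAction using (sum)
open import Data.List.Membership.Propositional using (_∈_)
open import Data.List.Relation.Unary.Unique.Propositional using (Unique)
open import Data.Product using (Σ; _×_; _,_)
open import Data.Empty using (⊥)
open import Data.Unit using (⊤)
open import Relation.Binary.PropositionalEquality using (_≡_; _≢_)
open import Relation.Nullary using (¬_)
open import Function.Definitions using (Injective)

record Graph : Set where
  field
    n     : ℕ
    adj   : Fin n → Fin n → Bool
    sym   : ∀ u v → adj u v ≡ adj v u
    irrefl : ∀ v → adj v v ≡ false

open Graph public

V : Graph → Set
V G = Fin (n G)

Edge : (G : Graph) → V G → V G → Set
Edge G u v = adj G u v ≡ true

deg : (G : Graph) → V G → ℕ
deg G v = sum (map (λ u → if adj G v u then 1 else 0) (allFin (n G)))

-- sum of degrees (= 2|E|); average degree is degSum G / n G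
degSum : Graph → ℕ
degSum G = sum (map (deg G) (allFin (n G)))

ContainsKst : ℕ → ℕ → Graph → Set
ContainsKst s t G =
  Σ (Fin s → V G) λ f → Σ (Fin t → V G) λ g →
    Injective _≡_ _≡_ f × Injective _≡_ _≡_ g ×
    (∀ i j → f i ≢ g j) × (∀ i j → Edge G (f i) (g j))

KstFree : ℕ → ℕ → Graph → Set
KstFree s t G = ¬ ContainsKst s t G

AdjWalk : (G : Graph) → List (V G) → Set
AdjWalk G []             = ⊤
AdjWalk G (x ∷ [])       = ⊤
AdjWalk G (x ∷ y ∷ xs)   = Edge G x y × AdjWalk G (y ∷ xs)

record TopClique (G : Graph) (m : ℕ) : Set where
  field
    branch     : Fin m → V G
    branch-inj : Injective _≡_ _≡_ branch
    inner      : Fin m → Fin m → List (V G)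
    isPath     : ∀ i j → i F.< j →
                   AdjWalk G (branch i ∷ inner i j ++ [ branch j ]) ×
                   Unique (branch i ∷ inner i j ++ [ branch j ])
    avoidBranch : ∀ i j → i F.< j → ∀ x → x ∈ inner i j → ∀ k → x ≢ branch k
    disjoint   : ∀ i j i' j' → i F.< j → i' F.< j' → ¬ ((i ≡ i') × (j ≡ j')) →
                   ∀ x → x ∈ inner i j → x ∈ inner i' j' → ⊥

{-# OPTIONS --safe #-}
module Submission where

-- Passing to a Komlós–Szemerédi subgraph, we may assume that G has minimum degree ≥ 4q of the order of d, that sets X
-- with k ≤ |X| ≤ n/2 expand by a factor 1/log²(|X|/k), and that n ≈ k 2^Λ, where k is a small multiple of d^{s/(s-1)},
-- the least possible size of a second neighbourhood in a K_{s,t}-free graph; the aim is m = ⌊√k⌋ branch vertices.  Pairs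
-- of branch vertices are linked one after another by short paths, so about m² poly(Λ) vertices are ever in use.
-- * If m vertices have degree ≥ k Λ^13, their neighbourhoods outgrow all used vertices and can be linked greedily.
-- * Otherwise, if m < Λ^{30s}, the remaining graph has such small degrees that m branch vertices can be chosen far apart.
--   The balls around them are reserved, and since every linking path is a geodesic it meets each sphere around its
--   ends only once, so that the balls still grow after many paths have been removed.
-- * Otherwise each branch vertex is the core of a unit: 2m disjoint arms lead to hub centres, whose neighbours
--   (the layer) have m private leaves each.  Arms are never crossed; a layer is reserved only once a quarter of it has
--   been hit, which keeps the forbidden set of size m² poly(Λ), while the free leaves of a unit always outnumber it.
--   Cores exist because a vertex whose balls stay small can be carved out, and a union of carved pieces does not expand.

open import Defs hiding (sym)
open import Data.Nat
open import Data.Nat.Properties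
open import Data.Nat.DivMod using (_/_; _%_; m≡m%n+[m/n]*n; m%n<n)
open import Data.Nat.ListAction using (sum)
open import Data.Nat.Tactic.RingSolver using (solve-∀)
import Data.Fin as F
open import Data.Fin using (Fin; zero; suc; toℕ; fromℕ<)
open import Data.Fin.Properties using (any?; toℕ<n; toℕ-fromℕ<) renaming (_≟_ to _≟F_; _<?_ to _<F?_; <-cmp to <F-cmp)
open import Data.Fin.Subset.Properties using (anySubset?)
open import Data.Bool using (Bool; true; false; if_then_else_)
import Data.Bool.Properties as Bool
open import Data.Vec using (lookup) renaming (tabulate to tabulateV)
open import Data.Vec.Properties using (lookup∘tabulate)
open import Data.List using (List; []; _∷_; _++_; [_]; map; allFin; length; reverse; cartesianProduct)
open import Data.List.Properties using (map-tabulate; map-++; length-++; length-reverse; ++-assoc; unfold-reverse; reverse-++)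
open import Data.List.Membership.Propositional using () renaming (_∈_ to _∈ᴸ_)
open import Data.List.Membership.Propositional.Properties using (∈-map⁻; ∈-++⁻; ∈-++⁺ˡ; ∈-++⁺ʳ; ∈-cartesianProduct⁺; ∈-allFin)
open import Data.List.Relation.Unary.Any using (here; there)
import Data.List.Relation.Unary.Any as Any
open import Data.List.Relation.Unary.Any.Properties using (reverse⁻)
import Data.List.Relation.Unary.All as All
open import Data.List.Relation.Unary.AllPairs using ([]; _∷_)
open import Data.List.Relation.Unary.Unique.Propositional using (Unique)
import Data.List.Relation.Unary.Unique.Propositional.Properties as Uniqueₚ
open import Data.Product using (Σ; _×_; _,_; proj₁; proj₂)
open import Data.Sum using (_⊎_; inj₁; inj₂; [_,_]′)
open import Data.Empty using (⊥; ⊥-elim)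
open import Data.Unit using (tt)
open import Relation.Nullary using (¬_; Dec; yes; no; does; ¬?; _×-dec_; _⊎-dec_)
open import Relation.Nullary.Decidable using (dec-true; map′)
open import Relation.Binary.Definitions using (tri<; tri≈; tri>)
open import Relation.Binary.PropositionalEquality using (_≡_; _≢_; refl; sym; trans; cong; cong₂; subst; subst₂)
open import Function using (_∘_; id)
open import Function.Definitions using (Injective)

-- The obstacle is that no logarithm may be lost. Since m² has the order of k, the linking paths,
-- about m² of them with poly(Λ) vertices each, may occupy far more than k vertices, while
-- K_{s,t}-freeness promises only about k vertices within distance two of a core. A ball must
-- therefore grow from k to k poly(Λ) before it can outgrow the used set, and the three cases are
-- three ways to secure this phase: a neighbourhood that is large from the start, a region that no
-- foreign path may enter, or a supply of m² poly(Λ) private leaves prepared in advance. The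
-- threshold Λ^{30s} separates two kinds of error terms. Above it, m Λ^c is at most m² for every
-- exponent c that occurs. Below it, k and Δ are powers of Λ, and the radii up to which protection
-- is needed are powers of log Λ, so that balls of such radii remain tiny compared with n. In that
-- regime a factor Λ is too expensive at the early scales, which is why expansion is used there with
-- the rate of the current scale. All estimates are made in integers: logarithms appear as exponents
-- of 2, and the power s/(s-1) as a comparison of s-th with (s-1)-th powers.

private variable
  ν μ : ℕ

-- Finite sums, decidable subsets and their cardinalities

opaque
  ∑ : (Fin ν → ℕ) → ℕ
  ∑ {ν} f = sum (map f (allFin ν))

  ∑-def : (f : Fin ν → ℕ) → sum (map f (allFin ν)) ≡ ∑ f
  ∑-def f = refl

  ∑-nil : (f : Fin 0 → ℕ) → ∑ f ≡ 0
  ∑-nil f = refl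

  ∑-suc : (f : Fin (suc ν) → ℕ) → ∑ f ≡ f zero + ∑ (f ∘ suc)
  ∑-suc f = cong (λ xs → f zero + sum xs)
    (trans (map-tabulate suc f) (sym (map-tabulate id (f ∘ suc))))

∑-mono : {f g : Fin ν → ℕ} → (∀ u → f u ≤ g u) → ∑ f ≤ ∑ g
∑-mono {zero} {f} f≤g = ≤-trans (≤-reflexive (∑-nil f)) z≤n
∑-mono {suc ν} {f} {g} f≤g rewrite ∑-suc f | ∑-suc g = +-mono-≤ (f≤g zero) (∑-mono (f≤g ∘ suc))

∑-cong : {f g : Fin ν → ℕ} → (∀ u → f u ≡ g u) → ∑ f ≡ ∑ g
∑-cong f≡g = ≤-antisym (∑-mono (≤-reflexive ∘ f≡g)) (∑-mono (≤-reflexive ∘ sym ∘ f≡g))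

∑-zero : ∑ {ν} (λ _ → 0) ≡ 0
∑-zero {zero} = ∑-nil _
∑-zero {suc ν} = trans (∑-suc {ν} (λ _ → 0)) (∑-zero {ν})

+-interchange : ∀ a b c d → (a + b) + (c + d) ≡ (a + c) + (b + d)
+-interchange = solve-∀

∑-+ : (f g : Fin ν → ℕ) → ∑ (λ u → f u + g u) ≡ ∑ f + ∑ g
∑-+ {zero} f g rewrite ∑-nil f | ∑-nil g = ∑-nil _
∑-+ {suc ν} f g rewrite ∑-suc f | ∑-suc g | ∑-suc (λ u → f u + g u) | ∑-+ (f ∘ suc) (g ∘ suc) =
  +-interchange (f zero) (g zero) _ _

∑-* : (c : ℕ) (f : Fin ν → ℕ) → ∑ (λ u → c * f u) ≡ c * ∑ f
∑-* {zero} c f rewrite ∑-nil f | ∑-nil (λ u → c * f u) = sym (*-zeroʳ c)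
∑-* {suc ν} c f rewrite ∑-suc f | ∑-suc (λ u → c * f u) | ∑-* c (f ∘ suc) =
  sym (*-distribˡ-+ c (f zero) _)

∑-const : ∀ ν c → ∑ {ν} (λ _ → c) ≡ ν * c
∑-const zero c = ∑-nil _
∑-const (suc ν) c = trans (∑-suc {ν} (λ _ → c)) (cong (c +_) (∑-const ν c))

∑-swap : (f : Fin ν → Fin μ → ℕ) → ∑ (λ u → ∑ (f u)) ≡ ∑ (λ v → ∑ (λ u → f u v))
∑-swap {zero} {μ} f = trans (∑-nil _) (trans (sym (∑-zero {μ})) (∑-cong λ v → sym (∑-nil _)))
∑-swap {suc ν} f = trans (∑-suc (λ u → ∑ (f u)))
  (trans (cong (∑ (f zero) +_) (∑-swap (f ∘ suc)))
  (trans (sym (∑-+ (f zero) (λ v → ∑ (λ u → f (suc u) v))))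
  (∑-cong (λ v → sym (∑-suc (λ u → f u v))))))

∑-pick : {f g : Fin ν → ℕ} → ∑ f < ∑ g → Σ (Fin ν) λ u → f u < g u
∑-pick {f = f} {g} f<g with any? (λ u → f u <? g u)
... | yes p = p
... | no ¬p = ⊥-elim (<⇒≱ f<g (∑-mono λ u → ≮⇒≥ λ lt → ¬p (u , lt)))

Sub : ℕ → Set
Sub ν = Fin ν → Bool

infix 4 _∈_ _∈?_ _⊆_
infixr 6 _∪_ _∩_ _∖_

-- A record instead of the bare equation, so that `u` and `A` can be recovered from the type of a
-- membership proof.
record _∈_ (u : Fin ν) (A : Sub ν) : Set where
  constructor ⟨_⟩
  field holds : A u ≡ true

_⊆_ : Sub ν → Sub ν → Set
A ⊆ B = ∀ {u} → u ∈ A → u ∈ B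

_∈?_ : (u : Fin ν) (A : Sub ν) → Dec (u ∈ A)
u ∈? A = map′ ⟨_⟩ _∈_.holds (A u Bool.≟ true)

opaque
  set : {P : Fin ν → Set} → (∀ u → Dec (P u)) → Sub ν
  set P? u = does (P? u)

  into : {P : Fin ν → Set} {P? : ∀ u → Dec (P u)} → ∀ {u} → P u → u ∈ set P?
  into {P? = P?} {u} p = ⟨ dec-true (P? u) p ⟩

  outof : {P : Fin ν → Set} {P? : ∀ u → Dec (P u)} → ∀ {u} → u ∈ set P? → P u
  outof {P? = P?} {u} ⟨ e ⟩ with P? u
  ... | yes p = p
  ... | no _ with () ← e

∅ : Sub ν
∅ _ = false

∁ : Sub ν → Sub ν
∁ A = set (λ u → ¬? (u ∈? A))

_∪_ _∩_ _∖_ : Sub ν → Sub ν → Sub ν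
A ∪ B = set (λ u → (u ∈? A) ⊎-dec (u ∈? B))
A ∩ B = set (λ u → (u ∈? A) ×-dec (u ∈? B))
A ∖ B = set (λ u → (u ∈? A) ×-dec ¬? (u ∈? B))

∪ˡ : {A B : Sub ν} → A ⊆ (A ∪ B)
∪ˡ a = into (inj₁ a)

∪ʳ : {A B : Sub ν} → B ⊆ (A ∪ B)
∪ʳ b = into (inj₂ b)

∪-elim : {A B : Sub ν} {C : Set} {x : Fin ν} → (x ∈ A → C) → (x ∈ B → C) → x ∈ (A ∪ B) → C
∪-elim f g p = [ f , g ]′ (outof p)

｛_｝ : Fin ν → Sub ν
｛ v ｝ = set (λ u → u ≟F v)

⋃ : (Fin μ → Sub ν) → Sub ν
⋃ A = set (λ u → any? (λ l → u ∈? A l))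

elems : List (Fin ν) → Sub ν
elems xs = set (λ u → Any.any? (u ≟F_) xs)

ind : Bool → ℕ
ind b = if b then 1 else 0

# : Sub ν → ℕ
# A = ∑ (λ u → ind (A u))

ind-in : {A : Sub ν} {u : Fin ν} → u ∈ A → ind (A u) ≡ 1
ind-in ⟨ e ⟩ = cong ind e

ind-out : {A : Sub ν} {u : Fin ν} → ¬ u ∈ A → ind (A u) ≡ 0
ind-out {A = A} {u} u∉A with A u in eq
... | true = ⊥-elim (u∉A ⟨ eq ⟩)
... | false = refl

ind≤1 : ∀ b → ind b ≤ 1
ind≤1 true = ≤-refl
ind≤1 false = z≤n

ind-≤ : {A : Sub ν} {u : Fin ν} {x : ℕ} → (u ∈ A → 1 ≤ x) → ind (A u) ≤ x
ind-≤ {A = A} {u} p with A u in eq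
... | true = p ⟨ eq ⟩
... | false = z≤n

#-mono : {A B : Sub ν} → A ⊆ B → # A ≤ # B
#-mono A⊆B = ∑-mono λ u → ind-≤ λ u∈A → ≤-reflexive (sym (ind-in (A⊆B u∈A)))

#-cover : {A B C : Sub ν} → (∀ {u} → u ∈ A → u ∈ B ⊎ u ∈ C) → # A ≤ # B + # C
#-cover {A = A} {B} {C} cov = ≤-trans
  (∑-mono λ u → ind-≤ λ u∈A → case (cov u∈A))
  (≤-reflexive (∑-+ (λ u → ind (B u)) (λ u → ind (C u))))
  where
  case : ∀ {u} → u ∈ B ⊎ u ∈ C → 1 ≤ ind (B u) + ind (C u)
  case (inj₁ p) rewrite ind-in p = s≤s z≤n
  case {u} (inj₂ p) rewrite ind-in p = m≤n+m 1 (ind (B u))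

#-pack : {A B C : Sub ν} → A ⊆ C → B ⊆ C → (∀ {u} → u ∈ A → u ∈ B → ⊥) → # A + # B ≤ # C
#-pack {A = A} {B} {C} A⊆C B⊆C dis = ≤-trans
  (≤-reflexive (sym (∑-+ (λ u → ind (A u)) (λ u → ind (B u))))) (∑-mono point)
  where
  point : ∀ u → ind (A u) + ind (B u) ≤ ind (C u)
  point u with u ∈? A | u ∈? B
  ... | yes a | yes b = ⊥-elim (dis a b)
  ... | yes a | no b rewrite ind-in a | ind-out b | ind-in (A⊆C a) = ≤-refl
  ... | no a | yes b rewrite ind-out a | ind-in b | ind-in (B⊆C b) = ≤-refl
  ... | no a | no b rewrite ind-out a | ind-out b = z≤n

#-∖ : (A B : Sub ν) → # A ≤ # (A ∖ B) + # B
#-∖ A B = #-cover λ {u} a → case u a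
  where
  case : ∀ u → u ∈ A → u ∈ (A ∖ B) ⊎ u ∈ B
  case u a with u ∈? B
  ... | yes b = inj₂ b
  ... | no b = inj₁ (into (a , b))

#-∪ : (A B : Sub ν) → # (A ∪ B) ≤ # A + # B
#-∪ A B = #-cover outof

#≤N : (A : Sub ν) → # A ≤ ν
#≤N {ν} A = ≤-trans (∑-mono λ u → ind≤1 (A u)) (≤-reflexive (trans (∑-const ν 1) (*-identityʳ ν)))

#-all : {A : Sub ν} → (∀ u → u ∈ A) → # A ≡ ν
#-all {ν} all = trans (∑-cong λ u → ind-in (all u)) (trans (∑-const ν 1) (*-identityʳ ν))

#-empty : {A : Sub ν} → (∀ {u} → ¬ u ∈ A) → # A ≡ 0
#-empty {ν} ¬A = trans (∑-cong λ u → ind-out ¬A) (∑-zero {ν})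

#-pick∖ : {A B : Sub ν} → # B < # A → Σ (Fin ν) λ u → u ∈ A × ¬ u ∈ B
#-pick∖ {A = A} {B} lt with ∑-pick lt
... | u , b<a with u ∈? A | u ∈? B
...   | yes a | no b = u , a , b
...   | yes a | yes b rewrite ind-in a | ind-in b = ⊥-elim (<-irrefl refl b<a)
...   | no a | _ rewrite ind-out a with () ← b<a

#-pick : {A : Sub ν} → 0 < # A → Σ (Fin ν) λ u → u ∈ A
#-pick {A = A} lt with #-pick∖ {A = A} {B = ∅} (subst (_< # A) (sym (#-empty {A = ∅} λ { ⟨ () ⟩ })) lt)
... | u , a , _ = u , a

#-pos : {A : Sub ν} {u : Fin ν} → u ∈ A → 1 ≤ # A
#-pos {A = A} {u} a with # A in eq
... | suc _ = s≤s z≤n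
... | zero = ⊥-elim (<-irrefl refl (subst (_≤ 0) (ind-in a) (≤-trans (term u (λ v → ind (A v))) (≤-reflexive eq))))
  where
  term : ∀ {ν} (u : Fin ν) (f : Fin ν → ℕ) → f u ≤ ∑ f
  term zero f rewrite ∑-suc f = m≤m+n _ _
  term (suc u) f rewrite ∑-suc f = ≤-trans (term u (f ∘ suc)) (m≤n+m _ (f zero))

#-sup : (A : Fin μ → Sub ν) (C : Sub ν) → (∀ {u} → u ∈ C → Σ (Fin μ) λ l → u ∈ A l) → # C ≤ ∑ (λ l → # (A l))
#-sup {μ} A C sup = ≤-trans (∑-mono point) (≤-reflexive (sym (∑-swap (λ l u → ind (A l u)))))
  where
  point : ∀ u → ind (C u) ≤ ∑ (λ l → ind (A l u))
  point u = ind-≤ λ c → let (l , a) = sup c in #-pos {A = λ l → A l u} {u = l} ⟨ _∈_.holds a ⟩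

#-⋃ : (A : Fin μ → Sub ν) {z : ℕ} → (∀ l → # (A l) ≤ z) → # (⋃ A) ≤ μ * z
#-⋃ {μ} A {z} b = ≤-trans (#-sup A (⋃ A) outof) (≤-trans (∑-mono b) (≤-reflexive (∑-const μ z)))

∑-atmost1 : (A : Sub ν) → (∀ {u v} → u ∈ A → v ∈ A → u ≡ v) → # A ≤ 1
∑-atmost1 {zero} A _ = ≤-trans (≤-reflexive (∑-nil _)) z≤n
∑-atmost1 {suc ν} A uniq rewrite ∑-suc (λ u → ind (A u)) with zero ∈? A
... | no z = ≤-trans (+-monoˡ-≤ _ (≤-reflexive (ind-out z)))
               (∑-atmost1 (A ∘ suc) λ {u} {v} p q → suc-inj (uniq {suc u} {suc v} ⟨ _∈_.holds p ⟩ ⟨ _∈_.holds q ⟩))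
  where
  suc-inj : ∀ {ν} {u v : Fin ν} → suc u ≡ suc v → u ≡ v
  suc-inj refl = refl
... | yes z = ≤-trans (+-mono-≤ (ind≤1 (A zero)) (≤-reflexive (#-empty {A = A ∘ suc} λ {u} p → absurd (uniq {zero} {suc u} z ⟨ _∈_.holds p ⟩)))) ≤-refl
  where
  absurd : ∀ {ν} {u : Fin ν} → _≡_ {A = Fin (suc ν)} zero (suc u) → ⊥
  absurd ()

#-｛｝ : (v : Fin ν) → # ｛ v ｝ ≤ 1
#-｛｝ v = ∑-atmost1 ｛ v ｝ λ p q → trans (outof p) (sym (outof q))

#-disjoint : (A : Fin μ → Sub ν) (C : Sub ν) → (∀ l → A l ⊆ C) →
  (∀ {l l' u} → u ∈ A l → u ∈ A l' → l ≡ l') → ∑ (λ l → # (A l)) ≤ # C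
#-disjoint A C A⊆C dis = ≤-trans (≤-reflexive (∑-swap (λ l u → ind (A l u)))) (∑-mono point)
  where
  point : ∀ u → ∑ (λ l → ind (A l u)) ≤ ind (C u)
  point u with any? (λ l → u ∈? A l)
  ... | yes (l , a) rewrite ind-in (A⊆C l a) =
    ∑-atmost1 (λ l → A l u) (λ {x} {y} p q → dis {x} {y} {u} ⟨ _∈_.holds p ⟩ ⟨ _∈_.holds q ⟩)
  ... | no ¬p = ≤-trans (≤-reflexive (#-empty {A = λ l → A l u} λ {l} p → ¬p (l , ⟨ _∈_.holds p ⟩))) z≤n

#-elems : (xs : List (Fin ν)) → # (elems xs) ≤ length xs
#-elems [] = ≤-reflexive (#-empty λ p → case (outof p))
  where
  case : ∀ {u : Fin ν} → Any.Any (u ≡_) [] → ⊥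
  case ()
#-elems (x ∷ xs) = ≤-trans (#-cover (split ∘ outof)) (+-mono-≤ (#-｛｝ x) (#-elems xs))
  where
  split : ∀ {u} → Any.Any (u ≡_) (x ∷ xs) → u ∈ ｛ x ｝ ⊎ u ∈ elems xs
  split (here p) = inj₁ (into p)
  split (there p) = inj₂ (into p)

#-shrink : (A : Sub ν) (c : ℕ) → c ≤ # A → Σ (Sub ν) λ B → B ⊆ A × # B ≡ c
#-shrink {ν} A zero _ = ∅ , (λ { ⟨ () ⟩ }) , #-empty {A = ∅ {ν}} (λ { ⟨ () ⟩ })
#-shrink A (suc c) le with #-shrink A c (≤-trans (n≤1+n c) le)
... | B , B⊆A , eq with #-pick∖ {A = A} {B} (subst (_< # A) (sym eq) le)
... | u , a , b = B ∪ ｛ u ｝ , sub , ≤-antisym up down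
  where
  sub : (B ∪ ｛ u ｝) ⊆ A
  sub p with outof p
  ... | inj₁ q = B⊆A q
  ... | inj₂ q rewrite outof q = a
  up : # (B ∪ ｛ u ｝) ≤ suc c
  up = ≤-trans (#-∪ B ｛ u ｝) (≤-trans (+-mono-≤ (≤-reflexive eq) (#-｛｝ u)) (≤-reflexive (+-comm c 1)))
  down : suc c ≤ # (B ∪ ｛ u ｝)
  down = ≤-trans (≤-reflexive (trans (+-comm 1 c) (cong (_+ 1) (sym eq))))
    (≤-trans (+-monoʳ-≤ (# B) (#-pos {A = ｛ u ｝} {u = u} (into refl)))
      (#-pack (into ∘ inj₁) (into ∘ inj₂) λ p q → b (subst (_∈ B) (outof q) p)))

#-enum : (A : Sub ν) (c : ℕ) → c ≤ # A → Σ (Fin c → Fin ν) λ f → Injective _≡_ _≡_ f × (∀ i → f i ∈ A)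
#-enum A zero _ = (λ ()) , (λ { {()} }) , λ ()
#-enum {ν} A (suc c) le with #-pick {A = A} (≤-trans (s≤s z≤n) le)
... | v , v∈A with #-enum (A ∖ ｛ v ｝) c (+-cancelʳ-≤ 1 c _ (≤-trans (≤-reflexive (+-comm c 1)) (≤-trans le
                    (≤-trans (#-∖ A ｛ v ｝) (+-monoʳ-≤ _ (#-｛｝ v))))))
... | f , inj , f∈ = g , g-inj , g∈
  where
  g : Fin (suc c) → Fin ν
  g zero = v
  g (suc i) = f i
  g∈ : ∀ i → g i ∈ A
  g∈ zero = v∈A
  g∈ (suc i) = proj₁ (outof (f∈ i))
  g-inj : Injective _≡_ _≡_ g
  g-inj {zero} {zero} _ = refl
  g-inj {zero} {suc j} e = ⊥-elim (proj₂ (outof (f∈ j)) (into (sym e)))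
  g-inj {suc i} {zero} e = ⊥-elim (proj₂ (outof (f∈ i)) (into e))
  g-inj {suc i} {suc j} e = cong suc (inj e)

-- Balls, geodesics and the Kővári–Sós–Turán argument

module Walks (H : Graph) where

  VH : Set
  VH = Fin (n H)

  SubH : Set
  SubH = Sub (n H)

  edge? : (u v : VH) → Dec (Edge H u v)
  edge? u v = adj H u v Bool.≟ true

  edge-sym : ∀ {u v} → Edge H u v → Edge H v u
  edge-sym {u} {v} e = trans (Graph.sym H v u) e

  edge-irrefl : ∀ {u v} → Edge H u v → u ≢ v
  edge-irrefl {u} e refl with () ← trans (sym e) (irrefl H u)

  Nb ∂ : SubH → SubH
  Nb A = set (λ u → any? (λ x → (x ∈? A) ×-dec edge? x u))
  ∂ A = Nb A ∖ A

  Nb-mono : ∀ {A B} → A ⊆ B → Nb A ⊆ Nb B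
  Nb-mono A⊆B p = let (x , a , e) = outof p in into (x , A⊆B a , e)

  Ball : SubH → SubH → ℕ → SubH
  Ball Z S zero = S ∖ Z
  Ball Z S (suc p) = set (λ u → (u ∈? Ball Z S p) ⊎-dec (¬? (u ∈? Z) ×-dec (u ∈? Nb (Ball Z S p))))

  module _ {Z S : SubH} where

    ball-avoid : ∀ p {u} → u ∈ Ball Z S p → ¬ u ∈ Z
    ball-avoid zero q = proj₂ (outof q)
    ball-avoid (suc p) q with outof q
    ... | inj₁ r = ball-avoid p r
    ... | inj₂ (z , _) = z

    ball-suc : ∀ p → Ball Z S p ⊆ Ball Z S (suc p)
    ball-suc p q = into (inj₁ q)

    ball-≤ : ∀ {p q} → p ≤ q → Ball Z S p ⊆ Ball Z S q
    ball-≤ {p} p≤q = go (≤⇒≤′ p≤q)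
      where
      go : ∀ {q} → p ≤′ q → Ball Z S p ⊆ Ball Z S q
      go ≤′-refl r = r
      go (≤′-step {q} l) r = ball-suc q (go l r)

    ball-nb : ∀ p {x u} → x ∈ Ball Z S p → Edge H x u → ¬ u ∈ Z → u ∈ Ball Z S (suc p)
    ball-nb p x∈ e u∉ = into (inj₂ (u∉ , into (_ , x∈ , e)))

    -- Boundary vertices outside Z join the next ball. The loss is only the part of Z on the
    -- boundary, not the whole of Z, and this is what later allows distant obstacles to be ignored.
    ball-grow : ∀ p → # (Ball Z S p) + # (∂ (Ball Z S p)) ≤ # (Ball Z S (suc p)) + # (∂ (Ball Z S p) ∩ Z)
    ball-grow p = begin
      # B + # D                      ≤⟨ +-monoʳ-≤ (# B) (#-cover split) ⟩
      # B + (# (D ∖ Z) + # (D ∩ Z))  ≡⟨ sym (+-assoc (# B) _ _) ⟩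
      (# B + # (D ∖ Z)) + # (D ∩ Z)  ≤⟨ +-monoˡ-≤ _ (#-pack (ball-suc p) out dis) ⟩
      # (Ball Z S (suc p)) + # (D ∩ Z) ∎
      where
      open ≤-Reasoning
      B D : SubH
      B = Ball Z S p
      D = ∂ B
      split : ∀ {u} → u ∈ D → u ∈ (D ∖ Z) ⊎ u ∈ (D ∩ Z)
      split {u} d with u ∈? Z
      ... | yes z = inj₂ (into (d , z))
      ... | no z = inj₁ (into (d , z))
      out : (D ∖ Z) ⊆ Ball Z S (suc p)
      out q = let (d , z) = outof q in into (inj₂ (z , proj₁ (outof d)))
      dis : ∀ {u} → u ∈ B → u ∈ (D ∖ Z) → ⊥
      dis b q = proj₂ (outof (proj₁ (outof q))) b

  -- As a ball avoids Z, the first hypothesis says that the ball itself misses Z'. Nothing is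
  -- required of Z' elsewhere, so obstacles that the ball does not reach may be added freely.
  ball-mono : ∀ {Z Z' S S'} p → (∀ {u} → u ∈ Ball Z S p → u ∈ Z' → u ∈ Z) → S ⊆ S' → Ball Z S p ⊆ Ball Z' S' p
  ball-mono zero Z'⊆Z S⊆S' q = let (s , z) = outof q in into (S⊆S' s , λ z' → z (Z'⊆Z q z'))
  ball-mono (suc p) Z'⊆Z S⊆S' q with outof q
  ... | inj₁ r = into (inj₁ (ball-mono p (Z'⊆Z ∘ ball-suc p) S⊆S' r))
  ... | inj₂ (z , b) = into (inj₂ ((λ z' → z (Z'⊆Z q z')) , Nb-mono (ball-mono p (Z'⊆Z ∘ ball-suc p) S⊆S') b))

  -- The meeting point is moved back towards Y, each step costing one unit of radius around S. Two
  -- overlapping balls thus become a path of bounded length.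
  ball-meet : ∀ {Z S Y} p q {u} → u ∈ Ball Z S p → u ∈ Ball Z Y q → Σ VH λ y → y ∈ Y × y ∈ Ball Z S (p + q)
  ball-meet p zero {u} s t rewrite +-identityʳ p = u , proj₁ (outof t) , s
  ball-meet {Z} {S} p (suc q) s t with outof t
  ... | inj₁ t' = let (y , y∈ , b) = ball-meet p q s t' in y , y∈ , ball-≤ (+-monoʳ-≤ p (n≤1+n q)) b
  ... | inj₂ (_ , b) rewrite +-suc p q = let (x , x∈ , e) = outof b in
    ball-meet (suc p) q (ball-nb p s (edge-sym e) (ball-avoid q x∈)) x∈

  -- The last premise of `step` puts u outside the ball of radius p, so the index is the exact
  -- distance to S in H without Z and the list is a shortest path.
  data Geo (Z S : SubH) : ℕ → VH → List VH → Set where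
    stop : ∀ {u} → u ∈ S → ¬ u ∈ Z → Geo Z S 0 u (u ∷ [])
    step : ∀ {p u x xs} → Geo Z S p x xs → Edge H u x → ¬ u ∈ Z → ¬ u ∈ Ball Z S p → Geo Z S (suc p) u (u ∷ xs)

  module _ {Z S : SubH} where

    geo-ball : ∀ {p u xs} → Geo Z S p u xs → u ∈ Ball Z S p
    geo-ball (stop s z) = into (s , z)
    geo-ball (step {p} g e z _) = ball-nb p (geo-ball g) (edge-sym e) z

    geo-find : ∀ p {u} → u ∈ Ball Z S p → Σ ℕ λ q → q ≤ p × Σ (List VH) (Geo Z S q u)
    geo-find zero b = let (s , z) = outof b in 0 , z≤n , _ , stop s z
    geo-find (suc p) {u} b with u ∈? Ball Z S p
    ... | yes b' = let (q , le , g) = geo-find p b' in q , ≤-trans le (n≤1+n p) , g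
    ... | no ¬b' with outof b
    ...   | inj₁ b' = ⊥-elim (¬b' b')
    ...   | inj₂ (z , nb) with outof nb
    ...     | x , x∈ , e with geo-find p x∈
    ...       | q , le , xs , g with q ≟ p
    ...         | yes refl = suc p , ≤-refl , u ∷ xs , step g (edge-sym e) z ¬b'
    ...         | no q≢p = ⊥-elim (¬b' (ball-≤ (≤∧≢⇒< le q≢p) (ball-nb q (geo-ball g) e z)))

    geo-length : ∀ {p u xs} → Geo Z S p u xs → length xs ≡ suc p
    geo-length (stop _ _) = refl
    geo-length (step g _ _ _) = cong suc (geo-length g)

    geo-in : ∀ {p u xs x} → Geo Z S p u xs → x ∈ᴸ xs → x ∈ Ball Z S p
    geo-in g@(stop _ _) (here refl) = geo-ball g
    geo-in g@(step _ _ _ _) (here refl) = geo-ball g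
    geo-in (step {p} g _ _ _) (there i) = ball-suc p (geo-in g i)

    geo-head : ∀ {p u xs} → Geo Z S p u xs → Σ (List VH) λ ys → xs ≡ u ∷ ys
    geo-head (stop _ _) = _ , refl
    geo-head (step _ _ _ _) = _ , refl

    geo-last : ∀ {p u xs} → Geo Z S p u xs → Σ VH λ y → y ∈ S × Σ (List VH) λ ys → xs ≡ ys ++ [ y ]
    geo-last (stop {u} s _) = u , s , [] , refl
    geo-last (step {u = u} g _ _ _) = let (y , y∈ , ys , eq) = geo-last g in y , y∈ , u ∷ ys , cong (u ∷_) eq

    geo-walk : ∀ {p u xs} → Geo Z S p u xs → AdjWalk H xs
    geo-walk (stop _ _) = tt
    geo-walk (step g e _ _) with geo-head g | geo-walk g
    ... | ys , refl | w = e , w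

    geo-unique : ∀ {p u xs} → Geo Z S p u xs → Unique xs
    geo-unique (stop _ _) = All.[] ∷ []
    geo-unique (step g _ _ ¬b) = All.tabulate (λ i eq → ¬b (subst (_∈ _) (sym eq) (geo-in g i))) ∷ geo-unique g

    -- The distance to S drops by one at every step, so each of the distances 0, ..., b occurs at
    -- most once.
    geo-count : ∀ {p u xs} b → Geo Z S p u xs → # (elems xs ∩ Ball Z S b) ≤ suc b
    geo-count b (stop {u} s z) = ≤-trans (#-mono (proj₁ ∘ outof)) (≤-trans (#-elems (u ∷ [])) (s≤s z≤n))
    geo-count b g'@(step {p} {u} {x} {xs} g e z ¬b) with b ≤? p
    ... | yes b≤p = ≤-trans (#-mono drop-head) (geo-count b g)
      where
      drop-head : (elems (u ∷ xs) ∩ Ball Z S b) ⊆ (elems xs ∩ Ball Z S b)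
      drop-head q with outof q
      ... | el , bl with outof el
      ...   | here refl = ⊥-elim (¬b (ball-≤ b≤p bl))
      ...   | there i = into (into i , bl)
    ... | no b≰p = ≤-trans (#-mono (proj₁ ∘ outof)) (≤-trans (#-elems (u ∷ xs))
            (≤-trans (≤-reflexive (geo-length g')) (s≤s (≰⇒> b≰p))))

    -- A path vertex at distance p' from S and within b of Y forces `c ≤ p' + b` by `ball-meet`. The
    -- vertices counted therefore have distances to S between `c ∸ b` and p, each attained once.
    geo-count-end : ∀ {Y} c → (∀ {y} a → y ∈ Y → y ∈ Ball Z S a → c ≤ a) →
      ∀ {p u xs} b → Geo Z S p u xs → # (elems xs ∩ Ball Z Y b) ≤ suc (p + b) ∸ c
    geo-count-end {Y} c far b g = go g
      where
      hit : ∀ {p u xs} → Geo Z S p u xs → u ∈ Ball Z Y b → c ≤ p + b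
      hit {p} g q = let (y , y∈ , yb) = ball-meet p b (geo-ball g) q in far (p + b) y∈ yb
      cons : ∀ {u xs} → (elems (u ∷ xs) ∩ Ball Z Y b) ⊆ (｛ u ｝ ∪ (elems xs ∩ Ball Z Y b))
      cons q with outof q
      ... | el , bl with outof el
      ...   | here eq = into (inj₁ (into eq))
      ...   | there i = into (inj₂ (into (into i , bl)))
      tail-only : ∀ {u xs} → ¬ u ∈ Ball Z Y b → (elems (u ∷ xs) ∩ Ball Z Y b) ⊆ (elems xs ∩ Ball Z Y b)
      tail-only ¬u q with outof q
      ... | el , bl with outof el
      ...   | here refl = ⊥-elim (¬u bl)
      ...   | there i = into (into i , bl)
      go : ∀ {p u xs} → Geo Z S p u xs → # (elems xs ∩ Ball Z Y b) ≤ suc (p + b) ∸ c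
      go g@(stop {u} s z) with u ∈? Ball Z Y b
      ... | yes q = ≤-trans (#-mono (proj₁ ∘ outof)) (≤-trans (#-elems (u ∷ [])) (m<n⇒0<n∸m (s≤s (hit g q))))
      ... | no ¬q = ≤-trans (≤-reflexive (#-empty λ r → none (outof (proj₁ (outof r))) (proj₂ (outof r)))) z≤n
        where
        none : ∀ {x} → x ∈ᴸ (u ∷ []) → x ∈ Ball Z Y b → ⊥
        none (here refl) r = ¬q r
      go g@(step {p} {u} {x} {xs} g' _ _ _) with u ∈? Ball Z Y b
      ... | yes q = ≤-trans (#-mono (cons {u} {xs})) (≤-trans (#-∪ ｛ u ｝ _) (≤-trans (+-mono-≤ (#-｛｝ u) (go g'))
                      (≤-reflexive (sym (+-∸-assoc 1 (hit g q))))))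
      ... | no ¬q = ≤-trans (#-mono (tail-only {u} {xs} ¬q)) (≤-trans (go g') (∸-monoˡ-≤ c (n≤1+n (suc (p + b)))))

  -- A shortest path outside Z from Y back to S; such a path is sparse near both of its ends.
  record GeoPath (Z S Y : SubH) (T : ℕ) : Set where
    field
      start fin : VH
      path rest init : List VH
      start∈ : start ∈ Y
      fin∈ : fin ∈ S
      from-start : path ≡ start ∷ rest
      to-fin : path ≡ init ++ [ fin ]
      walk : AdjWalk H path
      unique : Unique path
      short : length path ≤ suc T
      avoid : ∀ {x} → x ∈ᴸ path → ¬ x ∈ Z
      near-fin : ∀ b → # (elems path ∩ Ball Z S b) ≤ suc b
      near-start : ∀ b → # (elems path ∩ Ball Z Y b) ≤ suc b

  -- The length is minimised over all starting points in Y, not only for the given u. Then Y is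
  -- nowhere closer to S than the path is long, as the count near Y requires.
  opaque
    geodesic : ∀ {Z S Y} T {u} → u ∈ Ball Z S T → u ∈ Y → GeoPath Z S Y T
    geodesic {Z} {S} {Y} T b y = build (least T b y)
      where
      least : ∀ T {u} → u ∈ Ball Z S T → u ∈ Y →
        Σ ℕ λ c → c ≤ T × Σ VH λ u → u ∈ Ball Z S c × u ∈ Y × (∀ {y} a → y ∈ Y → y ∈ Ball Z S a → c ≤ a)
      least zero b y = 0 , z≤n , _ , b , y , λ _ _ _ → z≤n
      least (suc T) {u} b y with any? (λ u → (u ∈? Ball Z S T) ×-dec (u ∈? Y))
      ... | yes (u' , b' , y') = let (c , le , r) = least T b' y' in c , ≤-trans le (n≤1+n T) , r
      ... | no ¬p = suc T , ≤-refl , u , b , y , λ a y' b' → ≰⇒> λ a≤T → ¬p (_ , ball-≤ a≤T b' , y')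
      build : (Σ ℕ λ c → c ≤ T × Σ VH λ u → u ∈ Ball Z S c × u ∈ Y × (∀ {y} a → y ∈ Y → y ∈ Ball Z S a → c ≤ a)) →
        GeoPath Z S Y T
      build (c , c≤T , u , b , y , far) with geo-find c b
      ... | q , q≤c , xs , g with ≤-antisym q≤c (far q y (geo-ball g))
      ...   | refl = let (w , w∈ , ws , eq) = geo-last g in record
        { start = u ; fin = w ; path = xs ; rest = proj₁ (geo-head g) ; init = ws
        ; start∈ = y ; fin∈ = w∈ ; from-start = proj₂ (geo-head g) ; to-fin = eq
        ; walk = geo-walk g ; unique = geo-unique g
        ; short = ≤-trans (≤-reflexive (geo-length g)) (s≤s c≤T)
        ; avoid = λ i → ball-avoid q (geo-in g i)
        ; near-fin = λ b → geo-count b g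
        ; near-start = λ b → ≤-trans (geo-count-end q far b g)
            (≤-reflexive (trans (cong (_∸ q) (sym (+-suc q b))) (m+n∸m≡n q (suc b)))) }

  double-count : (U X : SubH) → ∑ (λ u → ind (U u) * # (adj H u ∩ X)) ≡ ∑ (λ x → ind (X x) * # (adj H x ∩ U))
  double-count U X = trans (∑-cong λ u → sym (∑-* (ind (U u)) _)) (trans (∑-swap _)
      (∑-cong λ x → trans (∑-cong λ u → point u x) (∑-* (ind (X x)) _)))
    where
    point : ∀ u x → ind (U u) * ind ((adj H u ∩ X) x) ≡ ind (X x) * ind ((adj H x ∩ U) u)
    point u x with u ∈? U | x ∈? X | edge? u x
    ... | yes p | yes q | yes e
      rewrite ind-in p | ind-in q | ind-in {A = adj H u ∩ X} {x} (into (⟨ e ⟩ , q))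
            | ind-in {A = adj H x ∩ U} {u} (into (⟨ edge-sym e ⟩ , p)) = refl
    ... | yes p | yes q | no e
      rewrite ind-out {A = adj H u ∩ X} {x} (λ r → e (_∈_.holds (proj₁ (outof r))))
            | ind-out {A = adj H x ∩ U} {u} (λ r → e (edge-sym (_∈_.holds (proj₁ (outof r)))))
            = trans (*-zeroʳ (ind (U u))) (sym (*-zeroʳ (ind (X x))))
    ... | yes p | no q | _
      rewrite ind-out q | ind-out {A = adj H u ∩ X} {x} (λ r → q (proj₂ (outof r))) = *-zeroʳ (ind (U u))
    ... | no p | _ | _
      rewrite ind-out p | ind-out {A = adj H x ∩ U} {u} (λ r → p (proj₂ (outof r))) = sym (*-zeroʳ (ind (X x)))

  rich-vertex : ∀ a (X U : SubH) → 1 ≤ # U → (∀ {x} → x ∈ X → a ≤ # (adj H x ∩ U)) →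
    Σ VH λ u → u ∈ U × # X * a ≤ # (adj H u ∩ X) * # U
  -- The extra summand `ind (U u)` makes the averaged inequality strict, as `∑-pick` demands, and
  -- the vertex picked must lie in U because outside U both sides vanish.
  rich-vertex a X U U≥1 deg≥ with ∑-pick {f = λ u → ind (U u) * (# X * a)} {g = λ u → ind (U u) * (# (adj H u ∩ X) * # U) + ind (U u)} total
    where
    open ≤-Reasoning
    comm₁ : ∀ x y z → x * (y * z) ≡ z * (x * y)
    comm₁ = solve-∀
    count : # X * a ≤ ∑ (λ u → ind (U u) * # (adj H u ∩ X))
    count = begin
      # X * a ≡⟨ *-comm (# X) a ⟩
      a * # X ≡⟨ sym (∑-* a _) ⟩
      ∑ (λ x → a * ind (X x)) ≤⟨ ∑-mono pt ⟩
      ∑ (λ x → ind (X x) * # (adj H x ∩ U)) ≡⟨ sym (double-count U X) ⟩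
      ∑ (λ u → ind (U u) * # (adj H u ∩ X)) ∎
      where
      pt : ∀ x → a * ind (X x) ≤ ind (X x) * # (adj H x ∩ U)
      pt x with x ∈? X
      ... | yes q rewrite ind-in q = ≤-trans (≤-reflexive (*-identityʳ a)) (≤-trans (deg≥ q) (≤-reflexive (sym (+-identityʳ _))))
      ... | no q rewrite ind-out q = ≤-reflexive (*-zeroʳ a)
    total : ∑ (λ u → ind (U u) * (# X * a)) < ∑ (λ u → ind (U u) * (# (adj H u ∩ X) * # U) + ind (U u))
    total = begin-strict
      ∑ (λ u → ind (U u) * (# X * a)) ≡⟨ ∑-cong (λ u → *-comm (ind (U u)) _) ⟩
      ∑ (λ u → (# X * a) * ind (U u)) ≡⟨ ∑-* (# X * a) _ ⟩
      (# X * a) * # U ≤⟨ *-monoˡ-≤ (# U) count ⟩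
      ∑ (λ u → ind (U u) * # (adj H u ∩ X)) * # U ≡⟨ *-comm _ (# U) ⟩
      # U * ∑ (λ u → ind (U u) * # (adj H u ∩ X)) ≡⟨ sym (∑-* (# U) _) ⟩
      ∑ (λ u → # U * (ind (U u) * # (adj H u ∩ X))) ≡⟨ ∑-cong (λ u → comm₂ (# U) (ind (U u)) _) ⟩
      ∑ (λ u → ind (U u) * (# (adj H u ∩ X) * # U)) <⟨ m<m+n _ U≥1 ⟩
      ∑ (λ u → ind (U u) * (# (adj H u ∩ X) * # U)) + # U ≡⟨ sym (∑-+ _ _) ⟩
      ∑ (λ u → ind (U u) * (# (adj H u ∩ X) * # U) + ind (U u)) ∎
      where
      comm₂ : ∀ x y z → x * (y * z) ≡ y * (z * x)
      comm₂ = solve-∀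
  ... | u , lt with u ∈? U
  ...   | yes p rewrite ind-in p | +-identityʳ (# X * a) | +-identityʳ (# (adj H u ∩ X) * # U) =
    u , p , +-cancelʳ-≤ 1 _ _ (≤-trans (≤-reflexive (+-comm _ 1)) lt)
  ...   | no p rewrite ind-out p with () ← lt

  -- The r vertices are chosen one at a time: `rich-vertex` gives a u in U adjacent to at least a
  -- fraction a/|U| of X, and the recursion continues in that part of X with u removed from U and a
  -- lowered by one. Over r rounds X shrinks at most by the factor (|U|/(a - r))^r, which leaves t
  -- common neighbours.
  kst : ∀ r t a (X U : SubH) → r < a → 1 ≤ # X → (∀ {x} → x ∈ X → a ≤ # (adj H x ∩ U)) →
    t * # U ^ r ≤ # X * (a ∸ r) ^ r →
    Σ (Fin r → VH) λ f → Σ (Fin t → VH) λ g → Injective _≡_ _≡_ f × Injective _≡_ _≡_ g ×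
      (∀ i → f i ∈ U) × (∀ j → g j ∈ X) × (∀ i j → Edge H (f i) (g j))
  kst zero t a X U r<a X≥1 deg≥ le =
    let (g , inj , g∈) = #-enum X t (≤-trans (≤-reflexive (sym (*-identityʳ t))) (≤-trans le (≤-reflexive (*-identityʳ (# X)))))
    in (λ ()) , g , (λ { {()} }) , (λ {x} {y} → inj {x} {y}) , (λ ()) , g∈ , λ ()
  kst (suc r) t (suc a) X U (s≤s r<a) X≥1 deg≥ le = extend (rich-vertex (suc a) X U U≥1 deg≥)
    where
    U≥1 : 1 ≤ # U
    U≥1 = let (x , x∈) = #-pick {A = X} X≥1 in ≤-trans (s≤s z≤n) (≤-trans (deg≥ x∈) (#-mono {A = adj H x ∩ U} (proj₂ ∘ outof)))
    extend : (Σ VH λ u → u ∈ U × # X * suc a ≤ # (adj H u ∩ X) * # U) → _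
    extend (u , u∈U , rich) =
      let (f , g , f-inj , g-inj , f∈ , g∈ , fg) = kst r t a X' U' r<a X'≥1 deg' le'
      in fun f , g , (λ {x} {y} → fun-inj f f∈ f-inj {x} {y}) , (λ {x} {y} → g-inj {x} {y}) , fun-in f f∈ , (λ j → proj₂ (outof (g∈ j))) , fun-edge f g g∈ fg
      where
      open ≤-Reasoning
      X' U' : SubH
      X' = adj H u ∩ X
      U' = U ∖ ｛ u ｝
      X'≥1 : 1 ≤ # X'
      X'≥1 = pos (# X') rich
        where
        pos : ∀ z → # X * suc a ≤ z * # U → 1 ≤ z
        pos zero q = ⊥-elim (<⇒≱ (*-mono-≤ X≥1 (s≤s (z≤n {a}))) q)
        pos (suc _) _ = s≤s z≤n
      deg' : ∀ {x} → x ∈ X' → a ≤ # (adj H x ∩ U')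
      deg' {x} q = +-cancelʳ-≤ 1 a _ (begin
        a + 1 ≡⟨ +-comm a 1 ⟩
        suc a ≤⟨ deg≥ (proj₂ (outof q)) ⟩
        # (adj H x ∩ U) ≤⟨ #-cover {B = adj H x ∩ U'} {C = ｛ u ｝} split ⟩
        # (adj H x ∩ U') + # ｛ u ｝ ≤⟨ +-monoʳ-≤ _ (#-｛｝ u) ⟩
        # (adj H x ∩ U') + 1 ∎)
        where
        split : ∀ {w} → w ∈ (adj H x ∩ U) → w ∈ (adj H x ∩ U') ⊎ w ∈ ｛ u ｝
        split {w} q with w ≟F u
        ... | yes e = inj₂ (into e)
        ... | no e = let (p₁ , p₂) = outof q in inj₁ (into (p₁ , into (p₂ , λ w∈ → e (outof w∈))))
      swap₁ : ∀ x y z → x * (y * z) ≡ y * (x * z)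
      swap₁ = solve-∀
      le' : t * # U' ^ r ≤ # X' * (a ∸ r) ^ r
      le' = *-cancelˡ-≤ (# U) ⦃ >-nonZero U≥1 ⦄ (begin
        # U * (t * # U' ^ r) ≤⟨ *-monoʳ-≤ (# U) (*-monoʳ-≤ t (^-monoˡ-≤ r (#-mono {A = U'} {B = U} (proj₁ ∘ outof)))) ⟩
        # U * (t * # U ^ r) ≡⟨ swap₁ (# U) t _ ⟩
        t * # U ^ suc r ≤⟨ le ⟩
        # X * ((a ∸ r) * (a ∸ r) ^ r) ≡⟨ sym (*-assoc (# X) _ _) ⟩
        (# X * (a ∸ r)) * (a ∸ r) ^ r ≤⟨ *-monoˡ-≤ ((a ∸ r) ^ r) (*-monoʳ-≤ (# X) (≤-trans (m∸n≤m a r) (n≤1+n a))) ⟩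
        (# X * suc a) * (a ∸ r) ^ r ≤⟨ *-monoˡ-≤ ((a ∸ r) ^ r) rich ⟩
        (# X' * # U) * (a ∸ r) ^ r ≡⟨ cong (_* (a ∸ r) ^ r) (*-comm (# X') (# U)) ⟩
        (# U * # X') * (a ∸ r) ^ r ≡⟨ *-assoc (# U) _ _ ⟩
        # U * (# X' * (a ∸ r) ^ r) ∎)
      fun : (Fin r → VH) → Fin (suc r) → VH
      fun f zero = u
      fun f (suc i) = f i
      fun-in : ∀ f → (∀ i → f i ∈ U') → ∀ i → fun f i ∈ U
      fun-in f f∈ zero = u∈U
      fun-in f f∈ (suc i) = proj₁ (outof (f∈ i))
      fun-inj : ∀ f → (∀ i → f i ∈ U') → Injective _≡_ _≡_ f → ∀ {x y} → fun f x ≡ fun f y → x ≡ y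
      fun-inj f f∈ inj {zero} {zero} _ = refl
      fun-inj f f∈ inj {zero} {suc j} e = ⊥-elim (proj₂ (outof (f∈ j)) (into (sym e)))
      fun-inj f f∈ inj {suc i} {zero} e = ⊥-elim (proj₂ (outof (f∈ i)) (into e))
      fun-inj f f∈ inj {suc i} {suc j} e = cong suc (inj e)
      fun-edge : ∀ f (g : Fin t → VH) → (∀ j → g j ∈ X') → (∀ i j → Edge H (f i) (g j)) → ∀ i j → Edge H (fun f i) (g j)
      fun-edge f g g∈ fg zero j = _∈_.holds (proj₁ (outof (g∈ j)))
      fun-edge f g g∈ fg (suc i) j = fg i j

-- Search over subsets, embeddings and induced subgraphs

anySub? : {P : Sub ν → Set} → (∀ A → Dec (P A)) → (∀ {A B} → (∀ u → A u ≡ B u) → P A → P B) → Dec (Σ (Sub ν) P)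
anySub? {ν} P? resp = map′ (λ (v , p) → lookup v , p)
  (λ (A , p) → tabulateV A , resp (λ u → sym (lookup∘tabulate A u)) p)
  (anySubset? (λ v → P? (lookup v)))

#-cong : {A B : Sub ν} → (∀ u → A u ≡ B u) → # A ≡ # B
#-cong e = ∑-cong λ u → cong ind (e u)

∈-cong : {A B : Sub ν} → (∀ u → A u ≡ B u) → A ⊆ B
∈-cong e {u} ⟨ p ⟩ = ⟨ trans (sym (e u)) p ⟩

deg-# : (G : Graph) (v : V G) → deg G v ≡ # (adj G v)
deg-# G v = ∑-def _

degSum-∑ : (G : Graph) → degSum G ≡ ∑ (λ u → # (adj G u))
degSum-∑ G = trans (∑-def _) (∑-cong (deg-# G))

module _ {f : Fin μ → Fin ν} (inj : Injective _≡_ _≡_ f) where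

  image : Sub ν
  image = set (λ u → any? (λ i → f i ≟F u))

  fibre : Fin ν → Sub μ
  fibre u = set (λ i → f i ≟F u)

  fibre-size : ∀ u → # (fibre u) ≡ ind (image u)
  fibre-size u with u ∈? image
  ... | yes p = let (i , e) = outof p in trans
    (≤-antisym (∑-atmost1 (fibre u) λ p q → inj (trans (outof p) (sym (outof q)))) (#-pos {u = i} (into e))) (sym (ind-in p))
  ... | no ¬p = trans (#-empty λ {i} q → ¬p (into (i , outof q))) (sym (ind-out ¬p))

  ∑-image : (g : Fin ν → ℕ) → ∑ (g ∘ f) ≡ ∑ (λ u → ind (image u) * g u)
  ∑-image g = trans (∑-cong λ i → point i) (trans (∑-swap (λ i u → g u * ind (fibre u i)))
    (∑-cong λ u → trans (∑-* (g u) _) (trans (cong (g u *_) (fibre-size u)) (*-comm (g u) _))))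
    where
    single : ∀ i u → g u * ind (fibre u i) ≡ g (f i) * ind (｛ f i ｝ u)
    single i u with f i ≟F u
    ... | yes refl = cong (g (f i) *_) (trans (ind-in {A = fibre (f i)} (into refl)) (sym (ind-in {A = ｛ f i ｝} (into refl))))
    ... | no ne = trans (cong (g u *_) (ind-out {A = fibre u} {i} λ q → ne (outof q)))
                   (trans (*-zeroʳ (g u)) (sym (trans (cong (g (f i) *_) (ind-out {A = ｛ f i ｝} {u} λ q → ne (sym (outof q)))) (*-zeroʳ (g (f i))))))
    point : ∀ i → g (f i) ≡ ∑ (λ u → g u * ind (fibre u i))
    point i = sym (trans (∑-cong (single i)) (trans (∑-* (g (f i)) _)
      (trans (cong (g (f i) *_) (≤-antisym (#-｛｝ (f i)) (#-pos {A = ｛ f i ｝} {u = f i} (into refl)))) (*-identityʳ _))))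

  #-image : # image ≡ μ
  #-image = trans (∑-cong λ u → sym (*-identityʳ _)) (trans (sym (∑-image (λ _ → 1))) (trans (∑-const μ 1) (*-identityʳ μ)))

⊆-full : {A B : Sub ν} → A ⊆ B → # B ≤ # A → ∀ u → A u ≡ B u
⊆-full {A = A} {B} A⊆B le u with u ∈? A | u ∈? B
... | yes ⟨ a ⟩ | yes ⟨ b ⟩ = trans a (sym b)
... | yes a | no b = ⊥-elim (b (A⊆B a))
... | no a | no b = trans (notin a) (sym (notin b))
  where
  notin : ∀ {A : Sub _} {u} → ¬ u ∈ A → A u ≡ false
  notin {A} {u} p with A u in eq
  ... | true = ⊥-elim (p ⟨ eq ⟩)
  ... | false = refl
... | no a | yes b = ⊥-elim (<⇒≱ (≤-trans (≤-reflexive (+-comm 1 (# A)))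
    (≤-trans (+-monoʳ-≤ (# A) (#-pos {A = ｛ u ｝} {u = u} (into refl)))
      (#-pack {A = A} {B = ｛ u ｝} {C = B} A⊆B (λ p → subst (_∈ B) (sym (outof p)) b) (λ p q → a (subst (_∈ A) (outof q) p))))) le)

record Embedding (H G : Graph) : Set where
  field
    emb : V H → V G
    emb-inj : Injective _≡_ _≡_ emb
    emb-adj : ∀ u v → adj H u v ≡ adj G (emb u) (emb v)

open Embedding

emb-refl : ∀ {G} → Embedding G G
emb-refl = record { emb = id ; emb-inj = id ; emb-adj = λ _ _ → refl }

emb-trans : ∀ {F H G} → Embedding F H → Embedding H G → Embedding F G
emb-trans e e' = record
  { emb = emb e' ∘ emb e ; emb-inj = emb-inj e ∘ emb-inj e'
  ; emb-adj = λ u v → trans (emb-adj e u v) (emb-adj e' _ _) }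

KstFree-emb : ∀ {H G s t} → Embedding H G → KstFree s t G → KstFree s t H
KstFree-emb e free (f , g , fi , gi , fg , ed) = free
  (emb e ∘ f , emb e ∘ g , fi ∘ emb-inj e , gi ∘ emb-inj e , (λ i j p → fg i j (emb-inj e p)) ,
   λ i j → trans (sym (emb-adj e _ _)) (ed i j))

AdjWalk-emb : ∀ {H G} (e : Embedding H G) xs → AdjWalk H xs → AdjWalk G (map (emb e) xs)
AdjWalk-emb e [] w = tt
AdjWalk-emb e (x ∷ []) w = tt
AdjWalk-emb e (x ∷ y ∷ xs) (a , w) = trans (sym (emb-adj e x y)) a , AdjWalk-emb e (y ∷ xs) w

TopClique-emb : ∀ {H G m} → Embedding H G → TopClique H m → TopClique G m
TopClique-emb {H} {G} e K = record
  { branch = emb e ∘ T.branch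
  ; branch-inj = T.branch-inj ∘ emb-inj e
  ; inner = λ i j → map (emb e) (T.inner i j)
  ; isPath = λ i j lt → let (w , u) = T.isPath i j lt in
      subst (AdjWalk G) (shape i j) (AdjWalk-emb e _ w) , subst Unique (shape i j) (Uniqueₚ.map⁺ (emb-inj e) u)
  ; avoidBranch = λ i j lt x x∈ k eq → let (y , y∈ , xy) = ∈-map⁻ (emb e) x∈ in
      T.avoidBranch i j lt y y∈ k (emb-inj e (trans (sym xy) eq))
  ; disjoint = λ i j i' j' lt lt' ne x x∈ x∈' →
      let (y , y∈ , xy) = ∈-map⁻ (emb e) x∈ ; (z , z∈ , xz) = ∈-map⁻ (emb e) x∈' in
      T.disjoint i j i' j' lt lt' ne y y∈ (subst (_∈ᴸ _) (emb-inj e (trans (sym xz) xy)) z∈) }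
  where
  module T = TopClique K
  shape : ∀ i j → map (emb e) (T.branch i ∷ T.inner i j ++ [ T.branch j ]) ≡ emb e (T.branch i) ∷ map (emb e) (T.inner i j) ++ [ emb e (T.branch j) ]
  shape i j = cong (emb e (T.branch i) ∷_) (map-++ (emb e) (T.inner i j) [ T.branch j ])

module _ (G : Graph) where

  -- Ordered pairs are counted, so this is twice the number of edges spanned, in line with `degSum`.
  inside : Sub (n G) → ℕ
  inside A = ∑ (λ u → ind (A u) * ∑ (λ v → ind (A v) * ind (adj G u v)))

  inside-cong : ∀ {A B} → (∀ u → A u ≡ B u) → inside A ≡ inside B
  inside-cong e = ∑-cong λ u → cong₂ _*_ (cong ind (e u)) (∑-cong λ v → cong (λ b → ind b * _) (e v))

  induced : Sub (n G) → Graph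
  induced A = record { n = # A ; adj = λ i j → adj G (f i) (f j) ; sym = λ i j → Graph.sym G _ _ ; irrefl = λ i → irrefl G _ }
    where
    f : Fin (# A) → V G
    f = proj₁ (#-enum A (# A) ≤-refl)

  induced-emb : ∀ A → Embedding (induced A) G
  induced-emb A = let (f , inj , _) = #-enum A (# A) ≤-refl in record { emb = f ; emb-inj = inj ; emb-adj = λ _ _ → refl }

  induced-degSum : ∀ A → degSum (induced A) ≡ inside A
  induced-degSum A = trans (degSum-∑ (induced A)) (trans
    (∑-cong λ i → ∑-image inj (λ v → ind (adj G (f i) v)))
    (trans (∑-image inj (λ u → ∑ (λ v → ind (image inj v) * ind (adj G u v)))) (inside-cong same)))
    where
    f : Fin (# A) → V G
    f = proj₁ (#-enum A (# A) ≤-refl)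
    inj : Injective _≡_ _≡_ f
    inj = proj₁ (proj₂ (#-enum A (# A) ≤-refl))
    same : ∀ u → image inj u ≡ A u
    same = ⊆-full (λ p → let (i , e) = outof p in subst (_∈ A) e (proj₂ (proj₂ (#-enum A (# A) ≤-refl)) i))
      (≤-reflexive (sym (#-image inj)))

-- The Komlós-Szemerédi expander

-- How often c can be doubled without exceeding y; f is fuel.
doublings : ℕ → ℕ → ℕ → ℕ
doublings zero c y = 0
doublings (suc f) c y with 2 * c ≤? y
... | yes _ = suc (doublings f (2 * c) y)
... | no _ = 0

doublings-mono : ∀ {f f'} c {y y'} → f ≤ f' → y ≤ y' → doublings f c y ≤ doublings f' c y'
doublings-mono {zero} c _ _ = z≤n
doublings-mono {suc f} {suc f'} c {y} {y'} (s≤s l) le with 2 * c ≤? y | 2 * c ≤? y'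
... | no _ | _ = z≤n
... | yes p | yes _ = s≤s (doublings-mono (2 * c) l le)
... | yes p | no q = ⊥-elim (q (≤-trans p le))

doublings-step : ∀ f {c y y'} → c ≤ y → 2 * y ≤ y' → suc (doublings f c y) ≤ doublings (suc f) c y'
doublings-step zero {c} {y} {y'} c≤y le with 2 * c ≤? y'
... | yes _ = ≤-refl
... | no q = ⊥-elim (q (≤-trans (*-monoʳ-≤ 2 c≤y) le))
doublings-step (suc f) {c} {y} {y'} c≤y le with 2 * c ≤? y'
... | no q = ⊥-elim (q (≤-trans (*-monoʳ-≤ 2 c≤y) le))
... | yes _ with 2 * c ≤? y
...   | no _ = s≤s z≤n
...   | yes p = s≤s (doublings-step f p le)

doublings-bound : ∀ f {c y} e → y < c * 2 ^ suc e → doublings f c y ≤ e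
doublings-bound zero e _ = z≤n
doublings-bound (suc f) {c} {y} e lt with 2 * c ≤? y
... | no _ = z≤n
doublings-bound (suc f) {c} {y} zero lt | yes p = ⊥-elim (<⇒≱ lt (≤-trans (≤-reflexive (*-comm c 2)) p))
doublings-bound (suc f) {c} {y} (suc e) lt | yes p =
  s≤s (doublings-bound f e (≤-trans lt (≤-reflexive (swap c (2 ^ suc e)))))
  where
  swap : ∀ c x → c * (2 * x) ≡ 2 * c * x
  swap = solve-∀

-- Scales are measured in steps of the factor 2^{1/3} < 4/3.
lev : ℕ → ℕ → ℕ
lev k x = doublings (x ^ 3) (k ^ 3) (x ^ 3)

lev-mono : ∀ k {x y} → x ≤ y → lev k x ≤ lev k y
lev-mono k le = doublings-mono (k ^ 3) (^-monoˡ-≤ 3 le) (^-monoˡ-≤ 3 le)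

cube≥1 : ∀ {x} → 1 ≤ x → 1 ≤ x ^ 3
cube≥1 l = ^-monoˡ-≤ 3 l

-- Since (4/3)³ = 64/27 > 2, a set with at most three quarters of the vertices lies at least one
-- level below the whole graph. The strict increase of ρ between the two levels is what `expansion`
-- exploits.
lev-gap : ∀ k {a n} → 1 ≤ k → k ≤ a → 4 * a ≤ 3 * n → suc (lev k a) ≤ lev k n
lev-gap k {a} {n} k≥1 k≤a le = ≤-trans (doublings-step (a ^ 3) (^-monoˡ-≤ 3 k≤a) twice)
  (doublings-mono {suc (a ^ 3)} {n ^ 3} (k ^ 3) fuel ≤-refl)
  where
  open ≤-Reasoning
  c₁ : ∀ a → 64 * (a * (a * (a * 1))) ≡ (4 * a) * ((4 * a) * ((4 * a) * 1))
  c₁ = solve-∀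
  c₂ : ∀ a → (3 * a) * ((3 * a) * ((3 * a) * 1)) ≡ 27 * (a * (a * (a * 1)))
  c₂ = solve-∀
  c₃ : ∀ a → 32 * (2 * a) ≡ 64 * a
  c₃ = solve-∀
  twice : 2 * a ^ 3 ≤ n ^ 3
  twice = *-cancelˡ-≤ 32 (begin
    32 * (2 * a ^ 3) ≡⟨ c₃ (a ^ 3) ⟩
    64 * a ^ 3 ≡⟨ c₁ a ⟩
    (4 * a) ^ 3 ≤⟨ ^-monoˡ-≤ 3 le ⟩
    (3 * n) ^ 3 ≡⟨ c₂ n ⟩
    27 * n ^ 3 ≤⟨ *-monoˡ-≤ (n ^ 3) (m≤m+n 27 5) ⟩
    32 * n ^ 3 ∎)
  fuel : suc (a ^ 3) ≤ n ^ 3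
  fuel = ≤-trans (≤-trans (+-monoˡ-≤ (a ^ 3) (cube≥1 {a} (≤-trans k≥1 k≤a))) (+-monoʳ-≤ (a ^ 3) (m≤m+n (a ^ 3) 0))) twice

-- Each doubling has three levels, and (3/2)³ = 27/8 < 4, so enlarging a set of size `k * 2 ^ i` by
-- one half costs fewer than two further levels.
lev-upper : ∀ k i {a} → 1 ≤ k → 2 * a ≤ 3 * (k * 2 ^ i) → lev k a ≤ suc (3 * i)
lev-upper k i {a} k≥1 le = doublings-bound (a ^ 3) (suc (3 * i)) (*-cancelˡ-< 8 (a ^ 3) _ (begin-strict
  8 * a ^ 3 ≡⟨ c₁ a ⟩
  (2 * a) ^ 3 ≤⟨ ^-monoˡ-≤ 3 le ⟩
  (3 * (k * 2 ^ i)) ^ 3 ≡⟨ c₂ k (2 ^ i) ⟩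
  27 * (k ^ 3 * (2 ^ i) ^ 3) <⟨ *-monoˡ-< _ ⦃ >-nonZero (*-mono-≤ (cube≥1 k≥1) (cube≥1 (m^n>0 2 i))) ⦄ (m≤m+n 28 4) ⟩
  32 * (k ^ 3 * (2 ^ i) ^ 3) ≡⟨ c₄ (k ^ 3) ((2 ^ i) ^ 3) ⟩
  8 * (k ^ 3 * (2 * (2 * (2 ^ i) ^ 3))) ≡⟨ cong (λ z → 8 * (k ^ 3 * (2 * (2 * z)))) (trans (^-*-assoc 2 i 3) (cong (2 ^_) (*-comm i 3))) ⟩
  8 * (k ^ 3 * 2 ^ suc (suc (3 * i))) ∎))
  where
  open ≤-Reasoning
  c₁ : ∀ a → 8 * (a * (a * (a * 1))) ≡ (2 * a) * ((2 * a) * ((2 * a) * 1))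
  c₁ = solve-∀
  c₂ : ∀ k x → (3 * (k * x)) * ((3 * (k * x)) * ((3 * (k * x)) * 1)) ≡ 27 * ((k * (k * (k * 1))) * (x * (x * (x * 1))))
  c₂ = solve-∀
  c₄ : ∀ k x → 32 * (k * x) ≡ 8 * (k * (2 * (2 * x)))
  c₄ = solve-∀

record Expander (H : Graph) (k : ℕ) : Set where
  open Walks H
  field
    expand : ∀ i (X : SubH) → k ≤ # X → # X ≤ k * 2 ^ i → 2 * # X ≤ n H → # X ≤ 18 * (suc i * suc i) * # (∂ X)

-- Komlós–Szemerédi: among the induced subgraphs H with e(H)/|H| at least a fixed fraction of
-- ρ(lev |H|), where ρ(j) = (2j+1)/(j+1) increases from 1 to 2, a smallest one expands.
module KomlosSzemeredi (k a b : ℕ) (k≥1 : 1 ≤ k) (a≥1 : 1 ≤ a) where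

  DensePair : ℕ → ℕ → Set
  DensePair x e = 1 ≤ x × a * (suc (2 * lev k x) * x) ≤ 2 * b * (suc (lev k x) * e)

  densePair? : ∀ x e → Dec (DensePair x e)
  densePair? x e = (1 ≤? x) ×-dec (_ ≤? _)

  Minimal : Graph → Set
  Minimal H = ∀ A → # A < n H → ¬ DensePair (# A) (inside H A)

  minimal-dense : ∀ f G → n G ≤ f → DensePair (n G) (degSum G) →
    Σ Graph λ H → Embedding H G × DensePair (n H) (degSum H) × Minimal H
  minimal-dense f G le dense with anySub? {P = λ A → # A < n G × DensePair (# A) (inside G A)}
    (λ A → (_ <? _) ×-dec densePair? _ _)
    (λ {A} {B} e (lt , d) → subst (_< n G) (#-cong e) lt , subst (λ z → DensePair z _) (#-cong e) (subst (DensePair _) (inside-cong G e) d))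
  ... | no ¬p = G , emb-refl , dense , λ A lt d → ¬p (A , lt , d)
  minimal-dense zero G le dense | yes (A , lt , d) = ⊥-elim (<⇒≱ lt (≤-trans le z≤n))
  minimal-dense (suc f) G le dense | yes (A , lt , d) =
    let (H , e , dH , min) = minimal-dense f (induced G A) (≤-pred (≤-trans lt le)) (subst (DensePair _) (sym (induced-degSum G A)) d)
    in H , emb-trans e (induced-emb G A) , dH , min

  module _ (H : Graph) (dense : DensePair (n H) (degSum H)) (min : Minimal H) where
    open Walks H

    private
      N j E : ℕ
      N = n H
      j = lev k N
      E = degSum H

    sparse-inside : ∀ A → # A < N → 2 * b * (suc (lev k (# A)) * inside H A) ≤ a * (suc (2 * lev k (# A)) * # A)
    sparse-inside A lt with # A in eq
    ... | suc z = <⇒≤ (≰⇒> λ le → min A (subst (_< N) (sym eq) lt) (subst (λ z → DensePair z (inside H A)) (sym eq) (s≤s z≤n , le)))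
    ... | zero = ≤-trans (≤-reflexive (trans (cong (λ e → 2 * b * (suc (lev k 0) * e)) none) (trans (cong (2 * b *_) (*-zeroʳ (suc (lev k 0)))) (*-zeroʳ (2 * b))))) z≤n
      where
      none : inside H A ≡ 0
      none = trans (∑-cong λ u → cong (_* ∑ (λ v → ind (A v) * ind (adj H u v)))
        (ind-out {A = A} λ p → <⇒≱ (#-pos p) (≤-reflexive eq))) ∑-zero

    -- Monotonicity of ρ, cross-multiplied: the sparseness of a smaller set is restated at the level
    -- of H itself, so that it can be subtracted from the density of H.
    sparse-inside′ : ∀ A → # A < N → 2 * b * (suc j * inside H A) ≤ a * (suc (2 * j) * # A)
    sparse-inside′ A lt = *-cancelʳ-≤ _ _ (suc i) (begin
      2 * b * (suc j * I) * suc i ≡⟨ c₁ b j I i ⟩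
      2 * b * (suc i * I) * suc j ≤⟨ *-monoˡ-≤ (suc j) (sparse-inside A lt) ⟩
      a * (suc (2 * i) * x) * suc j ≡⟨ c₂ a i x j ⟩
      a * x * (suc (2 * i) * suc j) ≤⟨ *-monoʳ-≤ (a * x) cross ⟩
      a * x * (suc (2 * j) * suc i) ≡⟨ c₃ a x j i ⟩
      a * (suc (2 * j) * x) * suc i ∎)
      where
      open ≤-Reasoning
      x I i : ℕ
      x = # A
      I = inside H A
      i = lev k x
      i≤j : i ≤ j
      i≤j = lev-mono k (<⇒≤ lt)
      c₁ : ∀ b j I i → 2 * b * (suc j * I) * suc i ≡ 2 * b * (suc i * I) * suc j
      c₁ = solve-∀
      c₂ : ∀ a i x j → a * (suc (2 * i) * x) * suc j ≡ a * x * (suc (2 * i) * suc j)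
      c₂ = solve-∀
      c₃ : ∀ a x j i → a * x * (suc (2 * j) * suc i) ≡ a * (suc (2 * j) * x) * suc i
      c₃ = solve-∀
      e₁ : ∀ i j → suc (2 * i) * suc j ≡ (2 * (i * j) + i + j + 1) + i
      e₁ = solve-∀
      e₂ : ∀ i j → (2 * (i * j) + i + j + 1) + j ≡ suc (2 * j) * suc i
      e₂ = solve-∀
      cross : suc (2 * i) * suc j ≤ suc (2 * j) * suc i
      cross = ≤-trans (≤-reflexive (e₁ i j)) (≤-trans (+-monoʳ-≤ _ i≤j) (≤-reflexive (e₂ i j)))

    inside-∑ : ∀ A → inside H A ≡ ∑ (λ u → ∑ (λ v → ind (A u) * (ind (A v) * ind (adj H u v))))
    inside-∑ A = ∑-cong λ u → sym (∑-* (ind (A u)) _)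

    member-pair : ∀ {A u v} → u ∈ A → v ∈ A → Edge H u v → ind (A u) * (ind (A v) * ind (adj H u v)) ≡ 1
    member-pair p q e rewrite ind-in p | ind-in q | e = refl

    cut : (A C : SubH) → (∀ {u v} → Edge H u v → (u ∈ A × v ∈ A) ⊎ (u ∈ C × v ∈ C)) → E ≤ inside H A + inside H C
    cut A C cov = begin
      E ≡⟨ degSum-∑ H ⟩
      ∑ (λ u → ∑ (λ v → ind (adj H u v))) ≤⟨ ∑-mono (λ u → ∑-mono λ v → point u v) ⟩
      ∑ (λ u → ∑ (λ v → F A u v + F C u v)) ≡⟨ ∑-cong (λ u → ∑-+ (F A u) (F C u)) ⟩
      ∑ (λ u → ∑ (F A u) + ∑ (F C u)) ≡⟨ ∑-+ _ _ ⟩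
      ∑ (λ u → ∑ (F A u)) + ∑ (λ u → ∑ (F C u)) ≡⟨ sym (cong₂ _+_ (inside-∑ A) (inside-∑ C)) ⟩
      inside H A + inside H C ∎
      where
      open ≤-Reasoning
      F : SubH → VH → VH → ℕ
      F A u v = ind (A u) * (ind (A v) * ind (adj H u v))
      point : ∀ u v → ind (adj H u v) ≤ F A u v + F C u v
      point u v = ind-≤ {A = adj H u} λ { ⟨ e ⟩ → case e (cov e) }
        where
        case : Edge H u v → (u ∈ A × v ∈ A) ⊎ (u ∈ C × v ∈ C) → 1 ≤ F A u v + F C u v
        case e (inj₁ (p , q)) = ≤-trans (≤-reflexive (sym (member-pair p q e))) (m≤m+n _ _)
        case e (inj₂ (p , q)) = ≤-trans (≤-reflexive (sym (member-pair p q e))) (m≤n+m _ _)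

    -- C is sparser than H by minimality, so the degree sum I that is missing from C must make up at
    -- least the density of H on the x vertices outside. With one vertex outside this yields
    -- `min-degree`, with X outside it yields `expansion`.
    cut-dense : (C : SubH) (I x : ℕ) → # C < N → x + # C ≤ N → E ≤ I + inside H C →
      a * (suc (2 * j) * x) ≤ 2 * b * (suc j * I)
    cut-dense C I x C<N x+C≤N E≤ = +-cancelʳ-≤ (a * (suc (2 * j) * # C)) _ _ (begin
      a * (suc (2 * j) * x) + a * (suc (2 * j) * # C) ≡⟨ c₁ a j x (# C) ⟩
      a * (suc (2 * j) * (x + # C)) ≤⟨ *-monoʳ-≤ a (*-monoʳ-≤ (suc (2 * j)) x+C≤N) ⟩
      a * (suc (2 * j) * N) ≤⟨ proj₂ dense ⟩
      2 * b * (suc j * E) ≤⟨ *-monoʳ-≤ (2 * b) (*-monoʳ-≤ (suc j) E≤) ⟩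
      2 * b * (suc j * (I + inside H C)) ≡⟨ c₂ b j I (inside H C) ⟩
      2 * b * (suc j * I) + 2 * b * (suc j * inside H C) ≤⟨ +-monoʳ-≤ _ (sparse-inside′ C C<N) ⟩
      2 * b * (suc j * I) + a * (suc (2 * j) * # C) ∎)
      where
      open ≤-Reasoning
      c₁ : ∀ a j x c → a * (suc (2 * j) * x) + a * (suc (2 * j) * c) ≡ a * (suc (2 * j) * (x + c))
      c₁ = solve-∀
      c₂ : ∀ b j x c → 2 * b * (suc j * (x + c)) ≡ 2 * b * (suc j * x) + 2 * b * (suc j * c)
      c₂ = solve-∀

    #-∁ : ∀ X → # X + # (∁ X) ≤ N
    #-∁ X = ≤-trans (#-pack {A = X} {B = ∁ X} {C = X ∪ ∁ X} (into ∘ inj₁) (into ∘ inj₂) (λ p q → outof q p)) (#≤N _)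

    #-∁< : ∀ {X} → 1 ≤ # X → # (∁ X) < N
    #-∁< {X} X≥1 = ≤-trans (+-monoˡ-≤ (# (∁ X)) X≥1) (#-∁ X)

    -- Deleting v lowers the degree sum by at most `D + D`; the density of H is then bounded below
    -- through ρ ≥ 1.
    min-degree : ∀ v → a ≤ 4 * b * # (adj H v)
    min-degree v = *-cancelʳ-≤ _ _ (suc j) (begin
      a * suc j ≤⟨ *-monoʳ-≤ a (s≤s (m≤m+n j (j + 0))) ⟩
      a * suc (2 * j) ≡⟨ cong (a *_) (sym (*-identityʳ (suc (2 * j)))) ⟩
      a * (suc (2 * j) * 1) ≤⟨ cut-dense (∁ ｛ v ｝) (D + D) 1 (#-∁< v≥1) (≤-trans (+-monoˡ-≤ _ v≥1) (#-∁ ｛ v ｝)) split ⟩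
      2 * b * (suc j * (D + D)) ≡⟨ c b j D ⟩
      4 * b * D * suc j ∎)
      where
      open ≤-Reasoning
      D : ℕ
      D = # (adj H v)
      C : SubH
      C = ∁ ｛ v ｝
      c : ∀ b j D → 2 * b * (suc j * (D + D)) ≡ 4 * b * D * suc j
      c = solve-∀
      v≥1 : 1 ≤ # ｛ v ｝
      v≥1 = #-pos {A = ｛ v ｝} {u = v} (into refl)
      F : VH → VH → ℕ
      F u w = ind (C u) * (ind (C w) * ind (adj H u w))
      once : ∑ (λ u → ∑ (λ w → ind (｛ v ｝ u) * ind (adj H v w))) ≤ D
      once = begin
        ∑ (λ u → ∑ (λ w → ind (｛ v ｝ u) * ind (adj H v w))) ≡⟨ ∑-cong (λ u → trans (∑-* (ind (｛ v ｝ u)) (λ w → ind (adj H v w))) (*-comm _ D)) ⟩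
        ∑ (λ u → D * ind (｛ v ｝ u)) ≡⟨ ∑-* D _ ⟩
        D * # ｛ v ｝ ≤⟨ *-monoʳ-≤ D (#-｛｝ v) ⟩
        D * 1 ≡⟨ *-identityʳ D ⟩
        D ∎
      point : ∀ u w → ind (adj H u w) ≤ (ind (｛ v ｝ u) * ind (adj H v w) + ind (｛ v ｝ w) * ind (adj H v u)) + F u w
      point u w = ind-≤ {A = adj H u} λ { ⟨ e ⟩ → case e (u ≟F v) (w ≟F v) }
        where
        case : Edge H u w → Dec (u ≡ v) → Dec (w ≡ v) → 1 ≤ (ind (｛ v ｝ u) * ind (adj H v w) + ind (｛ v ｝ w) * ind (adj H v u)) + F u w
        case e (yes refl) _ rewrite ind-in {A = ｛ v ｝} {v} (into refl) | e = s≤s z≤n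
        case e (no _) (yes refl) rewrite ind-in {A = ｛ v ｝} {v} (into refl) | edge-sym e =
          ≤-trans (m≤n+m 1 (ind (｛ v ｝ u) * ind (adj H v v))) (m≤m+n _ _)
        case e (no p) (no q) = ≤-trans (≤-reflexive (sym (member-pair {A = C} (into λ r → p (outof r)) (into λ r → q (outof r)) e))) (m≤n+m _ _)
      split : E ≤ (D + D) + inside H C
      split = begin
        E ≡⟨ degSum-∑ H ⟩
        ∑ (λ u → ∑ (λ w → ind (adj H u w))) ≤⟨ ∑-mono (λ u → ∑-mono λ w → point u w) ⟩
        ∑ (λ u → ∑ (λ w → (ind (｛ v ｝ u) * ind (adj H v w) + ind (｛ v ｝ w) * ind (adj H v u)) + F u w))
          ≡⟨ trans (∑-cong λ u → trans (∑-+ _ _) (cong (_+ ∑ (F u)) (∑-+ _ _))) (trans (∑-+ _ _) (cong (_+ ∑ (λ u → ∑ (F u))) (∑-+ _ _))) ⟩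
        (∑ (λ u → ∑ (λ w → ind (｛ v ｝ u) * ind (adj H v w))) + ∑ (λ u → ∑ (λ w → ind (｛ v ｝ w) * ind (adj H v u)))) + ∑ (λ u → ∑ (F u))
          ≤⟨ +-mono-≤ (+-mono-≤ once (≤-trans (≤-reflexive (∑-swap _)) once)) (≤-reflexive (sym (inside-∑ C))) ⟩
        (D + D) + inside H C ∎

    -- Unless ∂X has half the size of X, `A = X ∪ ∂X` has at most three quarters of the vertices.
    -- Every edge lies inside A or inside the complement of X; both are sparse, which gives ρ(j)|X|
    -- ≤ ρ(j')(|X| + |∂X|) for the level j' of A. As ρ(j) - ρ(j') = (j - j')/((j + 1)(j' + 1)), the
    -- ratio |X|/|∂X| is at most a quadratic in j', and j' ≤ 3i + 1.
    expansion : ∀ i (X : SubH) → k ≤ # X → # X ≤ k * 2 ^ i → 2 * # X ≤ N → # X ≤ 18 * (suc i * suc i) * # (∂ X)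
    expansion i X k≤X X≤ 2X≤N with # X ≤? 2 * # (∂ X)
    ... | yes le = ≤-trans le (*-monoˡ-≤ (# (∂ X)) (≤-trans (m≤m+n 2 16) (m≤m*n 18 (suc i * suc i))))
    ... | no ¬le = begin
      x ≤⟨ *-cancelˡ-≤ (suc e) gap ⟩
      (2 + j') * suc (2 * j') * d ≤⟨ *-monoˡ-≤ d (*-mono-≤ (+-monoʳ-≤ 2 j'≤) (s≤s (*-monoʳ-≤ 2 j'≤))) ⟩
      (2 + suc (3 * i)) * suc (2 * suc (3 * i)) * d ≤⟨ *-monoˡ-≤ d (≤-trans (m≤m+n _ (9 * suc i)) (≤-reflexive (c₀ i))) ⟩
      18 * (suc i * suc i) * d ∎
      where
      open ≤-Reasoning
      x d y j' e : ℕ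
      A : SubH
      A = X ∪ ∂ X
      x = # X
      d = # (∂ X)
      y = # A
      j' = lev k y
      c₀ : ∀ i → (2 + suc (3 * i)) * suc (2 * suc (3 * i)) + 9 * suc i ≡ 18 * (suc i * suc i)
      c₀ = solve-∀
      x≥1 : 1 ≤ x
      x≥1 = ≤-trans k≥1 k≤X
      y≤ : y ≤ x + d
      y≤ = #-∪ X (∂ X)
      2d<x : 2 * d < x
      2d<x = ≰⇒> ¬le
      2y≤3x : 2 * y ≤ 3 * x
      2y≤3x = begin
        2 * y ≤⟨ *-monoʳ-≤ 2 y≤ ⟩
        2 * (x + d) ≡⟨ *-distribˡ-+ 2 x d ⟩
        2 * x + 2 * d ≤⟨ +-monoʳ-≤ (2 * x) (<⇒≤ 2d<x) ⟩
        2 * x + x ≡⟨ +-comm (2 * x) x ⟩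
        3 * x ∎
      4y≤3N : 4 * y ≤ 3 * N
      4y≤3N = begin
        4 * y ≡⟨ *-assoc 2 2 y ⟩
        2 * (2 * y) ≤⟨ *-monoʳ-≤ 2 2y≤3x ⟩
        2 * (3 * x) ≡⟨ trans (sym (*-assoc 2 3 x)) (*-assoc 3 2 x) ⟩
        3 * (2 * x) ≤⟨ *-monoʳ-≤ 3 2X≤N ⟩
        3 * N ∎
      N≥1 : 1 ≤ N
      N≥1 = ≤-trans x≥1 (#≤N X)
      y<N : y < N
      y<N = *-cancelˡ-< 4 y N (≤-trans (s≤s 4y≤3N) (+-monoˡ-≤ (3 * N) N≥1))
      k≤y : k ≤ y
      k≤y = ≤-trans k≤X (#-mono (into ∘ inj₁))
      j'<j : suc j' ≤ j
      j'<j = lev-gap k {y} {N} k≥1 k≤y 4y≤3N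
      e = j ∸ suc j'
      j≡ : j ≡ suc (j' + e)
      j≡ = sym (m+[n∸m]≡n j'<j)
      j'≤ : j' ≤ suc (3 * i)
      j'≤ = lev-upper k i {y} k≥1 (≤-trans 2y≤3x (*-monoʳ-≤ 3 X≤))
      E≤ : E ≤ inside H A + inside H (∁ X)
      E≤ = cut A (∁ X) λ {u} {v} ed → split ed (u ∈? X) (v ∈? X)
        where
        into-A : ∀ {u v} → Edge H u v → u ∈ X → v ∈ A
        into-A {u} {v} ed p with v ∈? X
        ... | yes q = into (inj₁ q)
        ... | no q = into (inj₂ (into (into (u , p , ed) , q)))
        split : ∀ {u v} → Edge H u v → Dec (u ∈ X) → Dec (v ∈ X) → (u ∈ A × v ∈ A) ⊎ (u ∈ ∁ X × v ∈ ∁ X)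
        split ed (yes p) _ = inj₁ (into (inj₁ p) , into-A ed p)
        split ed (no p) (yes q) = inj₁ (into-A (edge-sym ed) q , into (inj₁ q))
        split ed (no p) (no q) = inj₂ (into p , into q)
      main : suc (2 * j) * suc j' * x ≤ suc j * suc (2 * j') * (x + d)
      main = *-cancelˡ-≤ a ⦃ >-nonZero a≥1 ⦄ (begin
        a * (suc (2 * j) * suc j' * x) ≡⟨ c₁ a j j' x ⟩
        a * (suc (2 * j) * x) * suc j' ≤⟨ *-monoˡ-≤ (suc j') (cut-dense (∁ X) (inside H A) x (#-∁< x≥1) (#-∁ X) E≤) ⟩
        2 * b * (suc j * inside H A) * suc j' ≡⟨ c₂ b j (inside H A) j' ⟩
        2 * b * (suc j' * inside H A) * suc j ≤⟨ *-monoˡ-≤ (suc j) (sparse-inside A y<N) ⟩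
        a * (suc (2 * j') * y) * suc j ≤⟨ *-monoˡ-≤ (suc j) (*-monoʳ-≤ a (*-monoʳ-≤ (suc (2 * j')) y≤)) ⟩
        a * (suc (2 * j') * (x + d)) * suc j ≡⟨ c₃ a j' (x + d) j ⟩
        a * (suc j * suc (2 * j') * (x + d)) ∎)
        where
        c₁ : ∀ a j j' x → a * (suc (2 * j) * suc j' * x) ≡ a * (suc (2 * j) * x) * suc j'
        c₁ = solve-∀
        c₂ : ∀ b j x j' → 2 * b * (suc j * x) * suc j' ≡ 2 * b * (suc j' * x) * suc j
        c₂ = solve-∀
        c₃ : ∀ a j' x j → a * (suc (2 * j') * x) * suc j ≡ a * (suc j * suc (2 * j') * x)
        c₃ = solve-∀
      -- Here j = j' + e + 1, and j + 1 = j' + e + 2 ≤ (e + 1)(j' + 2). Hence `suc e` cancels and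
      -- the bound no longer depends on the order of H.
      gap : suc e * x ≤ suc e * ((2 + j') * suc (2 * j') * d)
      gap = +-cancelˡ-≤ (suc j * suc (2 * j') * x) _ _ (begin
        suc j * suc (2 * j') * x + suc e * x ≡⟨ cong (λ j → suc j * suc (2 * j') * x + suc e * x) j≡ ⟩
        suc (suc (j' + e)) * suc (2 * j') * x + suc e * x ≡⟨ c₁ j' e x ⟩
        suc (2 * suc (j' + e)) * suc j' * x ≡⟨ cong (λ j → suc (2 * j) * suc j' * x) (sym j≡) ⟩
        suc (2 * j) * suc j' * x ≤⟨ main ⟩
        suc j * suc (2 * j') * (x + d) ≡⟨ *-distribˡ-+ (suc j * suc (2 * j')) x d ⟩
        suc j * suc (2 * j') * x + suc j * suc (2 * j') * d ≡⟨ cong (λ j₁ → suc j * suc (2 * j') * x + suc j₁ * suc (2 * j') * d) j≡ ⟩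
        suc j * suc (2 * j') * x + (2 + (j' + e)) * suc (2 * j') * d
          ≤⟨ +-monoʳ-≤ (suc j * suc (2 * j') * x) (≤-trans (m≤m+n _ (e * suc j' * suc (2 * j') * d)) (≤-reflexive (c₂ j' e d))) ⟩
        suc j * suc (2 * j') * x + suc e * ((2 + j') * suc (2 * j') * d) ∎)
        where
        c₁ : ∀ j' e x → suc (suc (j' + e)) * suc (2 * j') * x + suc e * x ≡ suc (2 * suc (j' + e)) * suc j' * x
        c₁ = solve-∀
        c₂ : ∀ j' e d → (2 + (j' + e)) * suc (2 * j') * d + e * suc j' * suc (2 * j') * d ≡ suc e * ((2 + j') * suc (2 * j') * d)
        c₂ = solve-∀

    expander : Expander H k
    expander = record { expand = expansion }

-- Growth by repeated doubling

module _ (a : ℕ → ℕ) (mono : ∀ {p q} → p ≤ q → a p ≤ a q) (N : ℕ) where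

  -- While the sequence stays between x and 2x and at most N/2, each step gains at least x/τ; τ such
  -- steps gain x.
  doubling : ∀ τ x p → 1 ≤ τ →
    (∀ r → p ≤ r → r < p + τ → 2 * a r ≤ N → x ≤ a r → a r ≤ 2 * x → x + τ * a r ≤ τ * a (suc r)) →
    x ≤ a p → 2 * x ≤ a (p + τ) ⊎ N < 2 * a (p + τ)
  doubling τ x p τ≥1 grow x≤ with N <? 2 * a (p + τ) | 2 * x ≤? a (p + τ)
  ... | yes big | _ = inj₂ big
  ... | no _ | yes le = inj₁ le
  ... | no ¬big | no ¬le = inj₁ (*-cancelˡ-≤ τ ⦃ >-nonZero τ≥1 ⦄ (≤-trans (≤-reflexive (twice τ x)) (slope τ ≤-refl)))
    where
    twice : ∀ τ x → τ * (2 * x) ≡ τ * x + τ * x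
    twice = solve-∀
    slope : ∀ i → i ≤ τ → i * x + τ * x ≤ τ * a (p + i)
    slope zero _ = *-monoʳ-≤ τ (≤-trans x≤ (mono (m≤m+n p 0)))
    slope (suc i) i<τ = begin
      suc i * x + τ * x ≡⟨ +-assoc x (i * x) (τ * x) ⟩
      x + (i * x + τ * x) ≤⟨ +-monoʳ-≤ x (slope i (<⇒≤ i<τ)) ⟩
      x + τ * a (p + i) ≤⟨ grow (p + i) (m≤m+n p i) (+-monoʳ-< p i<τ)
          (≤-trans (*-monoʳ-≤ 2 below) (≮⇒≥ ¬big)) (≤-trans x≤ (mono (m≤m+n p i))) (≤-trans below (<⇒≤ (≰⇒> ¬le))) ⟩
      τ * a (suc (p + i)) ≡⟨ cong (λ r → τ * a r) (sym (+-suc p i)) ⟩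
      τ * a (p + suc i) ∎
      where
      open ≤-Reasoning
      below : a (p + i) ≤ a (p + τ)
      below = mono (+-monoʳ-≤ p (<⇒≤ i<τ))

  module _ (x : ℕ) (T τ : ℕ → ℕ) (T-suc : ∀ i → T (suc i) ≡ T i + τ i) (τ≥1 : ∀ i → 1 ≤ τ i) (L : ℕ)
    (grow : ∀ i r → i < L → T i ≤ r → r < T (suc i) → 2 * a r ≤ N → x * 2 ^ i ≤ a r → a r ≤ x * 2 ^ suc i →
      x * 2 ^ i + τ i * a r ≤ τ i * a (suc r)) where

    private
      swap : ∀ x y → 2 * (x * y) ≡ x * (2 * y)
      swap = solve-∀

    climb : ∀ i₀ → x * 2 ^ i₀ ≤ a (T i₀) → ∀ e → i₀ + e ≤ L →
      x * 2 ^ (i₀ + e) ≤ a (T (i₀ + e)) ⊎ N < 2 * a (T (i₀ + e))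
    climb i₀ start zero _ rewrite +-identityʳ i₀ = inj₁ start
    climb i₀ start (suc e) le rewrite +-suc i₀ e with climb i₀ start e (<⇒≤ le)
    ... | inj₂ big = inj₂ (≤-trans big (*-monoʳ-≤ 2 (mono (≤-trans (m≤m+n _ (τ (i₀ + e))) (≤-reflexive (sym (T-suc (i₀ + e))))))))
    ... | inj₁ lo with doubling (τ (i₀ + e)) (x * 2 ^ (i₀ + e)) (T (i₀ + e)) (τ≥1 _)
              (λ r p≤r r<p 2a≤N lo' hi → grow (i₀ + e) r le p≤r (subst (r <_) (sym (T-suc _)) r<p) 2a≤N lo' (≤-trans hi (≤-reflexive (swap x (2 ^ (i₀ + e)))))) lo
    ...   | inj₁ lo' = inj₁ (≤-trans (≤-reflexive (sym (swap x (2 ^ (i₀ + e))))) (≤-trans lo' (≤-reflexive (cong a (sym (T-suc _))))))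
    ...   | inj₂ big = inj₂ (≤-trans big (≤-reflexive (cong (λ z → 2 * a z) (sym (T-suc _)))))

    -- A sequence that has reached `x * 2 ^ L`, and hence N, has also passed N/2, so only the second
    -- alternative of `climb` remains.
    climb-out : ∀ i₀ → i₀ ≤ L → x * 2 ^ i₀ ≤ a (T i₀) → 1 ≤ N → N ≤ x * 2 ^ L → N < 2 * a (T L)
    climb-out i₀ i₀≤L start N≥1 N≤ = finish (subst (λ z → x * 2 ^ z ≤ a (T z) ⊎ N < 2 * a (T z)) (m+[n∸m]≡n i₀≤L)
        (climb i₀ start (L ∸ i₀) (≤-reflexive (m+[n∸m]≡n i₀≤L))))
      where
      finish : x * 2 ^ L ≤ a (T L) ⊎ N < 2 * a (T L) → N < 2 * a (T L)
      finish (inj₂ big) = big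
      finish (inj₁ lo) = ≤-trans (m<m+n N N≥1) (≤-trans (≤-reflexive (cong (N +_) (sym (+-identityʳ N)))) (*-monoʳ-≤ 2 (≤-trans N≤ lo)))

-- The working hypotheses and the spreading of balls

-- The degrees are at least 4q, second neighbourhoods have size at least k₀ (two-step), sets expand from size k on,
-- and the order of H is about k 2^Λ.
record Setting : Set where
  field
    H : Graph
    s' t q k k₀ Λ : ℕ
    free : KstFree (suc s') t H
    degree≥ : ∀ v → 4 * q ≤ # (adj H v)
    2s≤q : 2 * suc s' ≤ q
    k≥1 : 1 ≤ k
    k₀-small : t * k₀ ^ s' ≤ q * q ^ s'
    exp : Expander H k
    N≤ : n H ≤ k * 2 ^ Λ
    N≥1 : 1 ≤ n H

opaque
  rate : ℕ → ℕ
  rate i = 18 * (suc i * suc i)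

  rate-def : ∀ i → rate i ≡ 18 * (suc i * suc i)
  rate-def i = refl

  rate≥1 : ∀ i → 1 ≤ rate i
  rate≥1 i = s≤s z≤n

  -- A ball around a vertex has size k 2^i after time i steps; it has size k after two.
  time : ℕ → ℕ
  time zero = 2
  time (suc i) = time i + 2 * rate (suc i)

  time-zero : time 0 ≡ 2
  time-zero = refl

  time-suc : ∀ i → time (suc i) ≡ time i + 2 * rate (suc i)
  time-suc i = refl

module Core (X : Setting) where
  open Setting X public
  open Walks H public

  s w : ℕ
  s = suc s'
  w = rate Λ

  s<q : s < q
  s<q = ≤-trans (≤-trans (+-monoˡ-≤ s (s≤s (z≤n {s'}))) (≤-reflexive (cong (s +_) (sym (+-identityʳ s))))) 2s≤q

  w≥1 : 1 ≤ w
  w≥1 = rate≥1 Λ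

  holds : ∀ {u v} → u ∈ adj H v → Edge H v u
  holds ⟨ e ⟩ = e

  Bad : SubH → SubH
  Bad F = set (λ x → q ≤? # (adj H x ∩ F))

  -- With more than y bad vertices, `kst` would find s vertices of F with t common neighbours in
  -- `Bad F`. The two sets may overlap; the sides of the K_{s,t} are disjoint because adjacent
  -- vertices differ.
  bad-bound : ∀ F y → t * # F ^ s ≤ y * (q ∸ s) ^ s → # (Bad F) ≤ y
  bad-bound F y le with # (Bad F) ≤? y
  ... | yes p = p
  ... | no ¬p = let (f , g , fi , gi , f∈ , g∈ , e) = kst s t q (Bad F) F s<q (≤-trans (s≤s z≤n) (≰⇒> ¬p)) outof
                      (≤-trans le (*-monoˡ-≤ ((q ∸ s) ^ s) (<⇒≤ (≰⇒> ¬p))))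
                in ⊥-elim (free (f , g , fi , gi , (λ i j → edge-irrefl (e i j)) , e))

  not-bad : ∀ {F x} → ¬ x ∈ Bad F → # (adj H x ∩ F) < q
  not-bad p = ≰⇒> (p ∘ into)

  -- A K_{s-1,t} between B and Y would become a K_{s,t} on adding v, which is adjacent to all of Y
  -- and lies outside B. So `kst` applies one size down and |B|^{s-1} must be of order q^s: this is
  -- the source of the exponent s/(s-1).
  two-step : ∀ v (Y B : SubH) → Y ⊆ adj H v → ¬ v ∈ B → 2 * q ≤ # Y → (∀ {y} → y ∈ Y → 2 * q ≤ # (adj H y ∩ B)) → k₀ ≤ # B
  two-step v Y B Y⊆ v∉B 2q≤Y rich with k₀ ≤? # B
  ... | yes p = p
  ... | no ¬p = let (f , g , fi , gi , f∈ , g∈ , e) = kst s' t (2 * q) Y B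
                      (≤-trans (≤-trans (n≤1+n s) s<q) q≤2q) (≤-trans (≤-trans (s≤s z≤n) s<q) (≤-trans q≤2q 2q≤Y)) rich bound
                in ⊥-elim (free (fun f , g , (λ {x} {y} → fun-inj f f∈ fi {x} {y}) , (λ {x} {y} → gi {x} {y}) ,
                     (λ i j → edge-irrefl (edges f g g∈ e i j)) , edges f g g∈ e))
    where
    open ≤-Reasoning
    q≤2q : q ≤ 2 * q
    q≤2q = m≤m+n q (q + 0)
    bound : t * # B ^ s' ≤ # Y * (2 * q ∸ s') ^ s'
    bound = begin
      t * # B ^ s' ≤⟨ *-monoʳ-≤ t (^-monoˡ-≤ s' (<⇒≤ (≰⇒> ¬p))) ⟩
      t * k₀ ^ s' ≤⟨ k₀-small ⟩
      q * q ^ s' ≤⟨ *-mono-≤ (≤-trans q≤2q 2q≤Y) (^-monoˡ-≤ s' (m+n≤o⇒m≤o∸n q (≤-trans (+-monoʳ-≤ q (≤-trans (n≤1+n s') (<⇒≤ s<q))) (≤-reflexive (cong (q +_) (sym (+-identityʳ q))))))) ⟩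
      # Y * (2 * q ∸ s') ^ s' ∎
    fun : (Fin s' → VH) → Fin s → VH
    fun f zero = v
    fun f (suc i) = f i
    fun-inj : ∀ f → (∀ i → f i ∈ B) → Injective _≡_ _≡_ f → ∀ {x y} → fun f x ≡ fun f y → x ≡ y
    fun-inj f f∈ inj {zero} {zero} _ = refl
    fun-inj f f∈ inj {zero} {suc j} refl = ⊥-elim (v∉B (f∈ j))
    fun-inj f f∈ inj {suc i} {zero} refl = ⊥-elim (v∉B (f∈ i))
    fun-inj f f∈ inj {suc i} {suc j} e = cong suc (inj e)
    edges : ∀ f (g : Fin t → VH) → (∀ j → g j ∈ Y) → (∀ i j → Edge H (f i) (g j)) → ∀ i j → Edge H (fun f i) (g j)
    edges f g g∈ e zero j = holds (Y⊆ (g∈ j))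
    edges f g g∈ e (suc i) j = e i j

  expand-level : ∀ i A → k ≤ # A → # A ≤ k * 2 ^ i → 2 * # A ≤ n H → # A ≤ rate i * # (∂ A)
  expand-level i A k≤ A≤ 2A≤ = subst (λ z → # A ≤ z * # (∂ A)) (sym (rate-def i)) (Expander.expand exp i A k≤ A≤ 2A≤)

  expand-w : ∀ A → k ≤ # A → 2 * # A ≤ n H → # A ≤ w * # (∂ A)
  expand-w A k≤ 2A≤ = expand-level Λ A k≤ (≤-trans (#≤N A) N≤) 2A≤

  module _ {Z S : SubH} where

    -- Expansion promises a gain of x/w, and the obstacles on the boundary take at most x/(2w) of
    -- it, so half of the gain survives.
    grow-step : ∀ r w o x → # (Ball Z S r) ≤ w * # (∂ (Ball Z S r)) → # (∂ (Ball Z S r) ∩ Z) ≤ o → 2 * w * o ≤ x →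
      x ≤ # (Ball Z S r) → x + 2 * w * # (Ball Z S r) ≤ 2 * w * # (Ball Z S (suc r))
    grow-step r w o x ex ob ox x≤ = +-cancelʳ-≤ x _ _ (begin
      x + 2 * w * a + x ≡⟨ c₁ x (2 * w * a) ⟩
      2 * w * a + 2 * x ≤⟨ +-monoʳ-≤ (2 * w * a) (*-monoʳ-≤ 2 (≤-trans x≤ ex)) ⟩
      2 * w * a + 2 * (w * d) ≡⟨ c₂ w a d ⟩
      2 * w * (a + d) ≤⟨ *-monoʳ-≤ (2 * w) (ball-grow r) ⟩
      2 * w * (a' + # (∂ (Ball Z S r) ∩ Z)) ≤⟨ *-monoʳ-≤ (2 * w) (+-monoʳ-≤ a' ob) ⟩
      2 * w * (a' + o) ≡⟨ *-distribˡ-+ (2 * w) a' o ⟩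
      2 * w * a' + 2 * w * o ≤⟨ +-monoʳ-≤ _ ox ⟩
      2 * w * a' + x ∎)
      where
      open ≤-Reasoning
      a a' d : ℕ
      a = # (Ball Z S r)
      a' = # (Ball Z S (suc r))
      d = # (∂ (Ball Z S r))
      c₁ : ∀ x y → x + y + x ≡ y + 2 * x
      c₁ = solve-∀
      c₂ : ∀ w a d → 2 * w * a + 2 * (w * d) ≡ 2 * w * (a + d)
      c₂ = solve-∀

    -- The crude version of growth: one rate w at every scale, and the whole of Z charged at every
    -- step. It asks for a start of size `2 * w * # Z`, which is affordable wherever a power of Λ
    -- can be spared.
    spread : ∀ p x → k ≤ x → x ≤ # (Ball Z S p) → 2 * w * # Z ≤ x → n H < 2 * # (Ball Z S (p + Λ * (2 * w)))
    spread p x k≤x x≤ Z≤ = climb-out (λ r → # (Ball Z S r)) (λ le → #-mono (ball-≤ le)) (n H) x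
      (λ i → p + i * (2 * w)) (λ _ → 2 * w) (λ i → trans (cong (p +_) (+-comm (2 * w) (i * (2 * w)))) (sym (+-assoc p _ _)))
      (λ _ → ≤-trans w≥1 (m≤m+n w (w + 0))) Λ level 0 z≤n
      (≤-trans (≤-reflexive (*-identityʳ x)) (≤-trans x≤ (#-mono (ball-≤ (m≤m+n p 0))))) N≥1 (≤-trans N≤ (*-monoˡ-≤ (2 ^ Λ) k≤x))
      where
      level : ∀ i r → i < Λ → p + i * (2 * w) ≤ r → r < p + suc i * (2 * w) → 2 * # (Ball Z S r) ≤ n H →
        x * 2 ^ i ≤ # (Ball Z S r) → # (Ball Z S r) ≤ x * 2 ^ suc i → x * 2 ^ i + 2 * w * # (Ball Z S r) ≤ 2 * w * # (Ball Z S (suc r))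
      level i r _ _ _ 2a≤ lo _ = grow-step r w (# Z) (x * 2 ^ i) (expand-w _ (≤-trans k≤x (≤-trans x≤x2 lo)) 2a≤)
        (#-mono (proj₂ ∘ outof)) (≤-trans Z≤ x≤x2) lo
        where
        x≤x2 : x ≤ x * 2 ^ i
        x≤x2 = m≤m*n x (2 ^ i) ⦃ m^n≢0 2 i ⦄

-- Greedy choice, hubs and partial linkages

between : {A : Set} {a b start fin : A} {path rest init : List A} → path ≡ start ∷ rest → path ≡ init ++ [ fin ] →
  start ≡ a → fin ≡ b → a ≢ b → Σ (List A) λ xs → path ≡ a ∷ xs ++ [ b ]
between {init = []} refl refl refl refl a≢b = ⊥-elim (a≢b refl)
between {init = _ ∷ xs} refl refl refl refl _ = xs , refl

-- A new choice is placed at index zero and avoids the union of all earlier ones, so a smaller index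
-- means a later choice. `anti` then reduces the union to a single set.
greedy : {N : ℕ} {A : Set} (P : A → Sub N) (OK : Sub N → A → Set) (c b : ℕ) → (∀ a → # (P a) ≤ c) →
  (∀ {U U' a} → U ⊆ U' → OK U' a → OK U a) → (∀ U → # U ≤ b → Σ A (OK U)) →
  ∀ m → m * c ≤ b → Σ (Fin m → A) λ f → ∀ i j → j F.< i → OK (P (f i)) (f j)
greedy P OK c b small anti choose zero _ = (λ ()) , λ ()
greedy {A = A} P OK c b small anti choose (suc m) le =
  let (f , ok) = greedy P OK c b small anti choose m (≤-trans (m≤n+m (m * c) c) le)
      (a , oka) = choose (⋃ (P ∘ f)) (≤-trans (#-⋃ (P ∘ f) (small ∘ f)) (≤-trans (m≤n+m (m * c) c) le))
  in add f a , added f ok a oka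
  where
  add : (Fin m → A) → A → Fin (suc m) → A
  add f a zero = a
  add f a (suc i) = f i
  added : ∀ f → (∀ i j → j F.< i → OK (P (f i)) (f j)) → ∀ a → OK (⋃ (P ∘ f)) a →
    ∀ i j → j F.< i → OK (P (add f a i)) (add f a j)
  added f ok a oka (suc i) zero _ = anti (λ p → into (i , p)) oka
  added f ok a oka (suc i) (suc j) (s≤s lt) = ok i j lt
  added f ok a oka zero zero ()
  added f ok a oka zero (suc j) ()

choose-if : {A P : Set} → Dec P → A → A → A
choose-if (yes _) a b = a
choose-if (no _) a b = b

choose-yes : {A P : Set} (d : Dec P) {a b : A} → P → choose-if d a b ≡ a
choose-yes (yes _) p = refl
choose-yes (no ¬p) p = ⊥-elim (¬p p)

choose-no : {A P : Set} (d : Dec P) {a b : A} → ¬ P → choose-if d a b ≡ b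
choose-no (yes p) ¬p = ⊥-elim (¬p p)
choose-no (no _) _ = refl

AdjWalk-snoc : ∀ (H : Graph) xs {u y : V H} → AdjWalk H (xs ++ [ u ]) → Edge H u y → AdjWalk H ((xs ++ [ u ]) ++ [ y ])
AdjWalk-snoc H [] w e = e , tt
AdjWalk-snoc H (x ∷ []) (w , _) e = w , e , tt
AdjWalk-snoc H (x ∷ z ∷ xs) (w , ws) e = w , AdjWalk-snoc H (z ∷ xs) ws e

module Hubs (X : Setting) where
  open Core X

  leaves : SubH → (VH → SubH) → SubH
  leaves L E = set (λ z → any? (λ y → (y ∈? L) ×-dec (z ∈? E y)))

  leaves-size : ∀ L E m → (∀ {y} → y ∈ L → # (E y) ≡ m) → # (leaves L E) ≤ m * # L
  leaves-size L E m size = ≤-trans (#-sup part _ λ p → let (y , q) = outof p in y , into q)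
    (≤-trans (∑-mono each) (≤-reflexive (∑-* m _)))
    where
    part : VH → SubH
    part y = set (λ z → (y ∈? L) ×-dec (z ∈? E y))
    each : ∀ y → # (part y) ≤ m * ind (L y)
    each y = go (y ∈? L)
      where
      go : Dec (y ∈ L) → # (part y) ≤ m * ind (L y)
      go (yes p) = ≤-trans (#-mono {B = E y} (λ q → proj₂ (outof q)))
        (≤-reflexive (trans (size p) (sym (trans (cong (m *_) (ind-in p)) (*-identityʳ m)))))
      go (no ¬p) = ≤-trans (≤-reflexive (#-empty λ q → ¬p (proj₁ (outof q)))) z≤n

  -- F is known when the centre u is chosen, whereas R, in the application the arm leading to u, is
  -- found only afterwards. So u can be required to be good for F but not for R, and only the layer
  -- L is kept off R, while the leaves may meet it.
  record Hub (F R : SubH) (u : VH) (h m : ℕ) : Set where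
    field
      L : SubH
      E : VH → SubH
      L⊆ : L ⊆ adj H u
      L-size : # L ≡ h
      L∉F : ∀ {y} → y ∈ L → ¬ y ∈ F
      L∉R : ∀ {y} → y ∈ L → ¬ y ∈ R
      E⊆ : ∀ {y} → y ∈ L → E y ⊆ adj H y
      E-size : ∀ {y} → y ∈ L → # (E y) ≡ m
      E∉F : ∀ {y z} → y ∈ L → z ∈ E y → ¬ z ∈ F
      E-sep : ∀ {y y' z} → y ∈ L → y' ∈ L → z ∈ E y → z ∈ E y' → y ≡ y'

  module _ {F R : SubH} {u : VH} {c m : ℕ} (K : Hub F R u c m) (y : VH) (y∈ : y ∈ adj H u) (y∉F : ¬ y ∈ F) (y∉R : ¬ y ∈ R)
    (y∉L : ¬ y ∈ Hub.L K) (Ey : SubH) (Ey⊆ : Ey ⊆ adj H y) (Ey-size : # Ey ≡ m) (Ey∉F : ∀ {z} → z ∈ Ey → ¬ z ∈ F)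
    (Ey-new : ∀ {z} → z ∈ Ey → ¬ z ∈ leaves (Hub.L K) (Hub.E K)) where

    private
      module K = Hub K
      E⁺ : VH → SubH
      E⁺ y' = choose-if (y' ≟F y) Ey (K.E y')
      old : ∀ {y'} → y' ∈ K.L → E⁺ y' ≡ K.E y'
      old {y'} p = choose-no (y' ≟F y) λ { refl → y∉L p }
      new : E⁺ y ≡ Ey
      new = choose-yes (y ≟F y) refl
      case : ∀ {y'} → y' ∈ (K.L ∪ ｛ y ｝) → y' ∈ K.L ⊎ y' ≡ y
      case p = [ inj₁ , (λ q → inj₂ (outof q)) ]′ (outof p)
      to-old : ∀ {y' z} → y' ∈ K.L → z ∈ E⁺ y' → z ∈ K.E y'
      to-old p = subst (_ ∈_) (old p)
      to-new : ∀ {z} → z ∈ E⁺ y → z ∈ Ey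
      to-new = subst (_ ∈_) new

    hub⁺ : Hub F R u (suc c) m
    hub⁺ = record
      { L = K.L ∪ ｛ y ｝ ; E = E⁺
      ; L⊆ = λ p → [ K.L⊆ , (λ { refl → y∈ }) ]′ (case p)
      ; L-size = ≤-antisym
          (≤-trans (#-∪ K.L ｛ y ｝) (≤-trans (+-mono-≤ (≤-reflexive K.L-size) (#-｛｝ y)) (≤-reflexive (+-comm c 1))))
          (≤-trans (≤-reflexive (+-comm 1 c)) (≤-trans (+-mono-≤ (≤-reflexive (sym K.L-size)) (#-pos {A = ｛ y ｝} {u = y} (into refl)))
            (#-pack ∪ˡ ∪ʳ (λ p q → y∉L (subst (_∈ K.L) (outof q) p)))))
      ; L∉F = λ p → [ K.L∉F , (λ { refl → y∉F }) ]′ (case p)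
      ; L∉R = λ p → [ K.L∉R , (λ { refl → y∉R }) ]′ (case p)
      ; E⊆ = λ p → [ (λ q z∈ → K.E⊆ q (to-old q z∈)) , (λ { refl z∈ → Ey⊆ (to-new z∈) }) ]′ (case p)
      ; E-size = λ p → [ (λ q → trans (cong # (old q)) (K.E-size q)) , (λ { refl → trans (cong # new) Ey-size }) ]′ (case p)
      ; E∉F = λ p z∈ → [ (λ q → K.E∉F q (to-old q z∈)) , (λ { refl → Ey∉F (to-new z∈) }) ]′ (case p)
      ; E-sep = λ p p' z z' → sep (case p) (case p') z z' }
      where
      sep : ∀ {y₁ y₂ z} → y₁ ∈ K.L ⊎ y₁ ≡ y → y₂ ∈ K.L ⊎ y₂ ≡ y → z ∈ E⁺ y₁ → z ∈ E⁺ y₂ → y₁ ≡ y₂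
      sep (inj₁ p) (inj₁ p') z z' = K.E-sep p p' (to-old p z) (to-old p' z')
      sep (inj₁ p) (inj₂ refl) z z' = ⊥-elim (Ey-new (to-new z') (into (_ , p , to-old p z)))
      sep (inj₂ refl) (inj₁ p) z z' = ⊥-elim (Ey-new (to-new z) (into (_ , p , to-old p z')))
      sep (inj₂ refl) (inj₂ refl) _ _ = refl

  module _ (F R : SubH) (u : VH) (h m β : ℕ) (good : ¬ u ∈ Bad (F ∪ Bad F)) (β≥ : t * (h * m) ^ s ≤ β * (q ∸ s) ^ s)
    (fits : # R + (h + β) ≤ 2 * q) (m≤ : m ≤ 2 * q) where

    opaque
      -- That u lies outside `Bad (F ∪ Bad F)` looks two steps ahead: all but fewer than q
      -- neighbours y of u are outside F and have fewer than q neighbours in F. Excluding also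
      -- `Bad B`, of size at most β, leaves such a y with 2q neighbours off F and off the leaves B
      -- already taken, from which its own m leaves are drawn.
      make-hub : ∀ c → c ≤ h → Hub F R u c m
      make-hub zero _ = record { L = ∅ ; E = λ _ → ∅ ; L⊆ = λ { ⟨ () ⟩ } ; L-size = #-empty {A = ∅} (λ { ⟨ () ⟩ }) ; L∉F = λ { ⟨ () ⟩ }
        ; L∉R = λ { ⟨ () ⟩ } ; E⊆ = λ { ⟨ () ⟩ } ; E-size = λ { ⟨ () ⟩ } ; E∉F = λ { ⟨ () ⟩ } ; E-sep = λ { ⟨ () ⟩ } }
      make-hub (suc c) c<h = add (make-hub c (<⇒≤ c<h))
        where
        open ≤-Reasoning
        q≥1 : 1 ≤ q
        q≥1 = ≤-trans (s≤s z≤n) s<q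
        add : Hub F R u c m → Hub F R u (suc c) m
        add K = finish (#-pick∖ {A = adj H u} {B = avoid} bound)
          where
          module K = Hub K
          B avoid : SubH
          B = leaves K.L K.E
          avoid = (adj H u ∩ (F ∪ Bad F)) ∪ (R ∪ (K.L ∪ Bad B))
          B≤ : # B ≤ h * m
          B≤ = ≤-trans (leaves-size K.L K.E m K.E-size) (≤-trans (≤-reflexive (trans (cong (m *_) K.L-size) (*-comm m c))) (*-monoˡ-≤ m (<⇒≤ c<h)))
          Bad≤ : # (Bad B) ≤ β
          Bad≤ = bad-bound B β (≤-trans (*-monoʳ-≤ t (^-monoˡ-≤ s B≤)) β≥)
          three : ∀ q → q + 2 * q + q ≡ 4 * q
          three = solve-∀
          bound : # avoid < # (adj H u)
          bound = begin-strict
            # avoid ≤⟨ #-∪ _ _ ⟩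
            # (adj H u ∩ (F ∪ Bad F)) + # (R ∪ (K.L ∪ Bad B)) ≤⟨ +-mono-≤ (<⇒≤ (not-bad good)) (≤-trans (#-∪ R _) (+-monoʳ-≤ (# R)
                 (≤-trans (#-∪ K.L (Bad B)) (+-mono-≤ (≤-trans (≤-reflexive K.L-size) (<⇒≤ c<h)) Bad≤)))) ⟩
            q + (# R + (h + β)) ≤⟨ +-monoʳ-≤ q fits ⟩
            q + 2 * q <⟨ m<m+n _ q≥1 ⟩
            q + 2 * q + q ≡⟨ three q ⟩
            4 * q ≤⟨ degree≥ u ⟩
            # (adj H u) ∎
          finish : (Σ VH λ y → y ∈ adj H u × ¬ y ∈ avoid) → Hub F R u (suc c) m
          finish (y , y∈ , out) = let (Ey , Ey⊆ , size) = #-shrink rest m (≤-trans m≤ rest≥) in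
            hub⁺ K y y∈ (λ p → out (∪ˡ (into (y∈ , ∪ˡ p)))) (λ p → out (∪ʳ (∪ˡ p))) (λ p → out (∪ʳ (∪ʳ (∪ˡ p)))) Ey
              (λ p → proj₁ (outof (Ey⊆ p))) size (λ p q → proj₂ (outof (Ey⊆ p)) (∪ˡ q)) (λ p q → proj₂ (outof (Ey⊆ p)) (∪ʳ q))
            where
            rest : SubH
            rest = adj H y ∖ (F ∪ B)
            y∉BadF : ¬ y ∈ Bad F
            y∉BadF p = out (∪ˡ (into (y∈ , ∪ʳ p)))
            y∉BadB : ¬ y ∈ Bad B
            y∉BadB p = out (∪ʳ (∪ʳ (∪ʳ p)))
            sub : ∀ {z} → z ∈ adj H y → z ∈ rest ⊎ z ∈ ((adj H y ∩ F) ∪ (adj H y ∩ B))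
            sub {z} a = go (z ∈? F) (z ∈? B)
              where
              go : Dec (z ∈ F) → Dec (z ∈ B) → z ∈ rest ⊎ z ∈ ((adj H y ∩ F) ∪ (adj H y ∩ B))
              go (yes p) _ = inj₂ (∪ˡ (into (a , p)))
              go (no _) (yes p) = inj₂ (∪ʳ (into (a , p)))
              go (no p) (no p') = inj₁ (into (a , λ z∈ → [ p , p' ]′ (outof z∈)))
            split : ∀ q → 4 * q ≡ 2 * q + (q + q)
            split = solve-∀
            rest≥ : 2 * q ≤ # rest
            rest≥ = +-cancelʳ-≤ (q + q) _ _ (begin
              2 * q + (q + q) ≡⟨ sym (split q) ⟩
              4 * q ≤⟨ degree≥ y ⟩
              # (adj H y) ≤⟨ #-cover sub ⟩
              # rest + # ((adj H y ∩ F) ∪ (adj H y ∩ B)) ≤⟨ +-monoʳ-≤ (# rest) (≤-trans (#-∪ _ _) (+-mono-≤ (<⇒≤ (not-bad y∉BadF)) (<⇒≤ (not-bad y∉BadB)))) ⟩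
              # rest + (q + q) ∎)

upd : {m : ℕ} {A : Set} → (Fin m → Fin m → A) → Fin m → Fin m → A → Fin m → Fin m → A
upd f i j x a b with (a ≟F i) ×-dec (b ≟F j)
... | yes _ = x
... | no _ = f a b

upd-view : {m : ℕ} {A : Set} (f : Fin m → Fin m → A) (i j : Fin m) (x : A) (a b : Fin m) →
  (a ≡ i × b ≡ j × upd f i j x a b ≡ x) ⊎ (upd f i j x a b ≡ f a b)
upd-view f i j x a b with (a ≟F i) ×-dec (b ≟F j)
... | yes (p , q) = inj₁ (p , q , refl)
... | no _ = inj₂ refl

upd-same : {m : ℕ} {A : Set} (f : Fin m → Fin m → A) (i j : Fin m) (x : A) → upd f i j x i j ≡ x
upd-same f i j x with (i ≟F i) ×-dec (j ≟F j)
... | yes _ = refl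
... | no ¬p = ⊥-elim (¬p (refl , refl))

all-pairs : {m : ℕ} {St : Set} (done : St → Fin m → Fin m → Bool) →
  (∀ st i j → i F.< j → done st i j ≡ false →
    Σ St λ st' → done st' i j ≡ true × (∀ a b → done st a b ≡ true → done st' a b ≡ true)) →
  St → Σ St λ st → ∀ i j → i F.< j → done st i j ≡ true
all-pairs {m} {St} done advance st₀ =
  let (st , d , _) = sweep (cartesianProduct (allFin m) (allFin m)) st₀
  in st , λ i j lt → d (∈-cartesianProduct⁺ (∈-allFin i) (∈-allFin j)) lt
  where
  Keeps : St → St → Set
  Keeps st st' = ∀ a b → done st a b ≡ true → done st' a b ≡ true
  one : ∀ st i j → Σ St λ st' → (i F.< j → done st' i j ≡ true) × Keeps st st'
  one st i j with i <F? j
  ... | no ¬lt = st , (λ lt → ⊥-elim (¬lt lt)) , λ _ _ d → d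
  ... | yes lt with done st i j in eq
  ...   | true = st , (λ _ → eq) , λ _ _ d → d
  ...   | false = let (st' , d , k) = advance st i j lt eq in st' , (λ _ → d) , k
  sweep : ∀ ps st → Σ St λ st' → (∀ {i j} → (i , j) ∈ᴸ ps → i F.< j → done st' i j ≡ true) × Keeps st st'
  sweep [] st = st , (λ ()) , λ _ _ d → d
  sweep ((i , j) ∷ ps) st = let (st₁ , d₁ , k₁) = one st i j ; (st₂ , d₂ , k₂) = sweep ps st₁ in
    st₂ , (λ { (here refl) lt → k₂ _ _ (d₁ lt) ; (there p) lt → d₂ p lt }) , λ a b d → k₂ a b (k₁ a b d)

module Linkages (H : Graph) {m : ℕ} (v : Fin m → V H) (v-inj : Injective _≡_ _≡_ v) where
  open Walks H

  record Linkage : Set where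
    field
      inner : Fin m → Fin m → List VH
      done : Fin m → Fin m → Bool
      fresh : ∀ i j → done i j ≡ false → inner i j ≡ []
      path-ok : ∀ i j → done i j ≡ true → AdjWalk H (v i ∷ inner i j ++ [ v j ]) × Unique (v i ∷ inner i j ++ [ v j ])
      off-cores : ∀ i j {x} → x ∈ᴸ inner i j → ∀ l → x ≢ v l
      separate : ∀ i j i' j' {x} → x ∈ᴸ inner i j → x ∈ᴸ inner i' j' → i ≡ i' × j ≡ j'

    used : SubH
    used = set (λ x → any? (λ i → any? (λ j → x ∈? elems (inner i j))))

    used-in : ∀ i j {x} → x ∈ᴸ inner i j → x ∈ used
    used-in i j p = into (i , j , into p)

    used-size : ∀ {b} → (∀ i j → length (inner i j) ≤ b) → # used ≤ m * (m * b)
    used-size {b} le = ≤-trans (#-mono sub) (#-⋃ (λ i → ⋃ (λ j → elems (inner i j)))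
        (λ i → #-⋃ (λ j → elems (inner i j)) (λ j → ≤-trans (#-elems _) (le i j))))
      where
      sub : used ⊆ ⋃ (λ i → ⋃ (λ j → elems (inner i j)))
      sub p = let (i , j , q) = outof p in into (i , into (j , q))

  open Linkage

  no-links : Linkage
  no-links = record { inner = λ _ _ → [] ; done = λ _ _ → false ; fresh = λ _ _ _ → refl ; path-ok = λ _ _ () ; off-cores = λ _ _ () ; separate = λ _ _ _ _ () }

  module Link (K : Linkage) (i j : Fin m) (undone : done K i j ≡ false) (xs : List VH)
    (ok : AdjWalk H (v i ∷ xs ++ [ v j ]) × Unique (v i ∷ xs ++ [ v j ]))
    (off : ∀ {x} → x ∈ᴸ xs → ∀ l → x ≢ v l) (new : ∀ {x} → x ∈ᴸ xs → ¬ x ∈ used K) where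

    inner⁺ : Fin m → Fin m → List VH
    inner⁺ = upd (inner K) i j xs

    inner⁺-view : ∀ a b {x} → x ∈ᴸ inner⁺ a b → (a ≡ i × b ≡ j × x ∈ᴸ xs) ⊎ x ∈ᴸ inner K a b
    inner⁺-view a b {x} p with upd-view (inner K) i j xs a b
    ... | inj₁ (e , e' , q) = inj₁ (e , e' , subst (x ∈ᴸ_) q p)
    ... | inj₂ q = inj₂ (subst (x ∈ᴸ_) q p)

    link : Linkage
    link = record { inner = inner⁺ ; done = upd (done K) i j true ; fresh = fresh′ ; path-ok = path′ ; off-cores = off′ ; separate = sep′ }
      where
      fresh′ : ∀ a b → upd (done K) i j true a b ≡ false → inner⁺ a b ≡ []
      fresh′ a b d with (a ≟F i) ×-dec (b ≟F j)
      ... | no _ = fresh K a b d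
      fresh′ a b () | yes _
      path′ : ∀ a b → upd (done K) i j true a b ≡ true →
        AdjWalk H (v a ∷ inner⁺ a b ++ [ v b ]) × Unique (v a ∷ inner⁺ a b ++ [ v b ])
      path′ a b d with (a ≟F i) ×-dec (b ≟F j)
      ... | yes (refl , refl) = ok
      ... | no _ = path-ok K a b d
      off′ : ∀ a b {x} → x ∈ᴸ inner⁺ a b → ∀ l → x ≢ v l
      off′ a b p with inner⁺-view a b p
      ... | inj₁ (_ , _ , q) = off q
      ... | inj₂ q = off-cores K a b q
      sep′ : ∀ a b a' b' {x} → x ∈ᴸ inner⁺ a b → x ∈ᴸ inner⁺ a' b' → a ≡ a' × b ≡ b'
      sep′ a b a' b' p p' with inner⁺-view a b p | inner⁺-view a' b' p'
      ... | inj₁ (refl , refl , _) | inj₁ (refl , refl , _) = refl , refl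
      ... | inj₁ (_ , _ , q) | inj₂ q' = ⊥-elim (new q (used-in K a' b' q'))
      ... | inj₂ q | inj₁ (_ , _ , q') = ⊥-elim (new q' (used-in K a b q))
      ... | inj₂ q | inj₂ q' = separate K a b a' b' q q'

    -- Overwriting the entry (i, j) loses nothing, because an undone entry is empty by `fresh`.
    used⁺ : used K ⊆ used link
    used⁺ {x} p = let (a , b , q) = outof p in go a b q (upd-view (inner K) i j xs a b)
      where
      go : ∀ a b → x ∈ elems (inner K a b) → (a ≡ i × b ≡ j × inner⁺ a b ≡ xs) ⊎ (inner⁺ a b ≡ inner K a b) → x ∈ used link
      go a b q (inj₂ e) = into (a , b , subst (λ z → x ∈ elems z) (sym e) q)
      go a b q (inj₁ (refl , refl , _)) with outof (subst (λ z → x ∈ elems z) (fresh K i j undone) q)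
      ... | ()

    done⁺ : ∀ a b → done K a b ≡ true → done link a b ≡ true
    done⁺ a b d with (a ≟F i) ×-dec (b ≟F j)
    ... | yes _ = refl
    ... | no _ = d

    done-new : done link i j ≡ true
    done-new = upd-same (done K) i j true

  to-clique : (K : Linkage) → (∀ i j → i F.< j → done K i j ≡ true) → TopClique H m
  to-clique K d = record
    { branch = v ; branch-inj = v-inj ; inner = inner K ; isPath = λ i j lt → path-ok K i j (d i j lt)
    ; avoidBranch = λ i j _ x p l → off-cores K i j p l
    ; disjoint = λ i j i' j' _ _ ne x p p' → ne (separate K i j i' j' p p') }

both-ways : {N : ℕ} {A B : Sub N} → N < 2 * # A → N < 2 * # B → Σ (Fin N) λ x → x ∈ A × x ∈ B
both-ways {N} {A} {B} hA hB with any? (λ x → (x ∈? A) ×-dec (x ∈? B))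
... | yes p = p
... | no ¬p = ⊥-elim (<-irrefl refl (begin-strict
  N + N <⟨ +-mono-< hA hB ⟩
  2 * # A + 2 * # B ≡⟨ sym (*-distribˡ-+ 2 (# A) (# B)) ⟩
  2 * (# A + # B) ≤⟨ *-monoʳ-≤ 2 (#-pack {A = A} {B} {A ∪ B} (into ∘ inj₁) (into ∘ inj₂) (λ a b → ¬p (_ , a , b))) ⟩
  2 * # (A ∪ B) ≤⟨ *-monoʳ-≤ 2 (#≤N (A ∪ B)) ⟩
  2 * N ≡⟨ cong (N +_) (+-identityʳ N) ⟩
  N + N ∎))
  where open ≤-Reasoning

-- Linking by geodesics

-- The path between cores i and j avoids L, the earlier paths and the guards of the other cores;
-- being a geodesic, it is thin near i and j.
module GeodesicLinking (H : Graph) {m : ℕ} (v : Fin m → V H) (v-inj : Injective _≡_ _≡_ v)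
  (L : Sub (n H)) (guard : Fin m → Sub (n H)) (r T : ℕ)
  (v∉L : ∀ l → ¬ v l ∈ L) (v∈guard : ∀ l → v l ∈ guard l)
  (apart : ∀ {i l} → i ≢ l → ∀ {x} → x ∈ Walks.Ball H L ｛ v i ｝ r → ¬ x ∈ guard l) where
  open Walks H
  open Linkages H v v-inj
  open Linkage

  obstacle : Linkage → Fin m → Fin m → SubH
  obstacle K i j = (L ∪ used K) ∪ set (λ x → any? (λ l → ¬? (l ≟F i) ×-dec ¬? (l ≟F j) ×-dec (x ∈? guard l)))

  obstacle-cases : ∀ K i j {x} → x ∈ obstacle K i j → (x ∈ L ⊎ x ∈ used K) ⊎ (Σ (Fin m) λ l → l ≢ i × l ≢ j × x ∈ guard l)
  obstacle-cases K i j p = [ (λ q → inj₁ (outof q)) , (λ q → inj₂ (outof q)) ]′ (outof p)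

  near : Linkage → Fin m → ℕ → SubH
  near K e p = Ball (L ∪ used K) ｛ v e ｝ p

  -- In `thin` the balls `near K e p` avoid all vertices used so far. They only shrink when a link
  -- is added, so the bound persists; a path is disjoint from them, hence the neighbourhood `Nb`.
  -- The value `2 + p` is the number of vertices of a geodesic within radius `suc p` of its end.
  record Good (K : Linkage) : Set where
    field
      len : ∀ i j → length (inner K i j) ≤ 2 * T
      off-L : ∀ i j {x} → x ∈ᴸ inner K i j → ¬ x ∈ L
      off-guard : ∀ i j {x} → x ∈ᴸ inner K i j → ∀ l → l ≢ i → l ≢ j → ¬ x ∈ guard l
      thin : ∀ i j e → (e ≡ i ⊎ e ≡ j) → ∀ p → p < r → # (elems (inner K i j) ∩ Nb (near K e p)) ≤ 2 + p

  module Advance (K : Linkage) (G : Good K) (i j : Fin m) (i≢j : i ≢ j) (undone : done K i j ≡ false)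
    (P : GeoPath (obstacle K i j) ｛ v j ｝ ｛ v i ｝ (T + T)) (xs : List VH) (shape : GeoPath.path P ≡ v i ∷ xs ++ [ v j ]) where
    open Good
    module P = GeoPath P
    Z : SubH
    Z = obstacle K i j
    on-path : ∀ {x} → x ∈ᴸ xs → x ∈ᴸ P.path
    on-path p = subst (_ ∈ᴸ_) (sym (shape)) (there (∈-++⁺ˡ p))
    clear : ∀ {x} → x ∈ᴸ xs → ¬ x ∈ Z
    clear p = P.avoid (on-path p)
    not-guarded : ∀ {x} → x ∈ᴸ xs → ∀ l → l ≢ i → l ≢ j → ¬ x ∈ guard l
    not-guarded p l l≢i l≢j g = clear p (into (inj₂ (into (l , l≢i , l≢j , g))))
    path-unique : Unique (v i ∷ xs ++ [ v j ])
    path-unique = subst Unique (shape) P.unique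
    off : ∀ {x} → x ∈ᴸ xs → ∀ l → x ≢ v l
    off {x} p l e with l ≟F i | l ≟F j
    ... | yes refl | _ with path-unique
    ...   | all ∷ _ = All.lookup all (∈-++⁺ˡ p) (sym e)
    off {x} p l e | no _ | yes refl with path-unique
    ...   | _ ∷ u = not-last xs u p e
      where
      not-last : ∀ ys → Unique (ys ++ [ v j ]) → x ∈ᴸ ys → x ≢ v j
      not-last (y ∷ ys) (all ∷ _) (here refl) e = All.lookup all (∈-++⁺ʳ ys (here refl)) e
      not-last (y ∷ ys) (_ ∷ u) (there q) e = not-last ys u q e
    off {x} p l e | no l≢i | no l≢j = not-guarded p l l≢i l≢j (subst (_∈ guard l) (sym e) (v∈guard l))
    valid : AdjWalk H (v i ∷ xs ++ [ v j ]) × Unique (v i ∷ xs ++ [ v j ])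
    valid = subst (AdjWalk H) shape P.walk , path-unique
    unused : ∀ {x} → x ∈ᴸ xs → ¬ x ∈ used K
    unused p q = clear p (into (inj₁ (into (inj₂ q))))
    open Link K i j undone xs valid off unused public
    L∪used⁺ : (L ∪ used K) ⊆ (L ∪ used link)
    L∪used⁺ p with outof p
    ... | inj₁ q = into (inj₁ q)
    ... | inj₂ q = into (inj₂ (used⁺ q))
    near⁺ : ∀ e p → near link e p ⊆ near K e p
    near⁺ e p = ball-mono p (λ _ q → L∪used⁺ q) id
    -- The new geodesic is sparse in balls that avoid the whole obstacle, guards included, while
    -- `thin` speaks of balls that avoid only L and the used vertices. By `apart` the two agree in
    -- the needed direction up to radius r, because no foreign guard is met there.
    near-obstacle : ∀ e → (e ≡ i ⊎ e ≡ j) → ∀ p → p ≤ r → near link e p ⊆ Ball Z ｛ v e ｝ p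
    near-obstacle e ij p p≤r = ball-mono p sub id
      where
      sub : ∀ {u} → u ∈ near link e p → u ∈ Z → u ∈ (L ∪ used link)
      sub b z with outof z
      ... | inj₁ q = L∪used⁺ q
      ... | inj₂ q = let (l , l≢i , l≢j , g) = outof q in
        ⊥-elim (apart {e} {l} (λ { refl → [ l≢i , l≢j ]′ ij }) (ball-≤ p≤r (ball-mono p (λ _ → into ∘ inj₁) id b)) g)
    thin-new : ∀ e → (e ≡ i ⊎ e ≡ j) → ∀ p → p < r → # (elems xs ∩ Nb (near link e p)) ≤ 2 + p
    thin-new e ij p p<r = ≤-trans (#-mono sub) (count e ij)
      where
      sub : (elems xs ∩ Nb (near link e p)) ⊆ (elems P.path ∩ Ball Z ｛ v e ｝ (suc p))
      sub q = let (x∈ , nb) = outof q in into (into (on-path (outof x∈)) ,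
        into (inj₂ (clear (outof x∈) , Nb-mono (near-obstacle e ij p (<⇒≤ p<r)) nb)))
      count : ∀ e → (e ≡ i ⊎ e ≡ j) → # (elems P.path ∩ Ball Z ｛ v e ｝ (suc p)) ≤ 2 + p
      count e (inj₁ refl) = P.near-start (suc p)
      count e (inj₂ refl) = P.near-fin (suc p)
    good⁺ : Good link
    good⁺ = record { len = len′ ; off-L = off-L′ ; off-guard = off-guard′ ; thin = thin′ }
      where
      len′ : ∀ a b → length (inner⁺ a b) ≤ 2 * T
      len′ a b with upd-view (inner K) i j xs a b
      ... | inj₂ e rewrite e = len G a b
      ... | inj₁ (_ , _ , e) rewrite e = ≤-pred (≤-trans (≤-trans (s≤s (≤-trans (m≤m+n (length xs) 1) (≤-reflexive (sym (length-++ xs)))))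
              (≤-reflexive (cong length (sym (shape))))) (≤-trans P.short (≤-reflexive (cong (λ z → suc (T + z)) (sym (+-identityʳ T))))))
      off-L′ : ∀ a b {x} → x ∈ᴸ inner⁺ a b → ¬ x ∈ L
      off-L′ a b p with inner⁺-view a b p
      ... | inj₁ (_ , _ , q) = λ l → clear q (into (inj₁ (into (inj₁ l))))
      ... | inj₂ q = off-L G a b q
      off-guard′ : ∀ a b {x} → x ∈ᴸ inner⁺ a b → ∀ l → l ≢ a → l ≢ b → ¬ x ∈ guard l
      off-guard′ a b p with inner⁺-view a b p
      ... | inj₁ (refl , refl , q) = not-guarded q
      ... | inj₂ q = off-guard G a b q
      thin′ : ∀ a b e → (e ≡ a ⊎ e ≡ b) → ∀ p → p < r → # (elems (inner⁺ a b) ∩ Nb (near link e p)) ≤ 2 + p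
      thin′ a b e ab p p<r = go (upd-view (inner K) i j xs a b)
        where
        Claim : List VH → Set
        Claim ys = # (elems ys ∩ Nb (near link e p)) ≤ 2 + p
        go : (a ≡ i × b ≡ j × inner⁺ a b ≡ xs) ⊎ (inner⁺ a b ≡ inner K a b) → Claim (inner⁺ a b)
        go (inj₁ (a≡i , b≡j , q)) = subst Claim (sym q) (thin-new e (subst₂ (λ x y → e ≡ x ⊎ e ≡ y) a≡i b≡j ab) p p<r)
        go (inj₂ q) = subst Claim (sym q) (≤-trans (#-mono λ z → let (z₁ , z₂) = outof z in into (z₁ , Nb-mono (near⁺ e p) z₂)) (thin G a b e ab p p<r))

  module _ (grow : ∀ K → Good K → ∀ i j → i ≢ j → ∀ e → (e ≡ i ⊎ e ≡ j) →
      n H < 2 * # (Ball (obstacle K i j) ｛ v e ｝ T)) where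

    joining : ∀ K → Good K → ∀ i j → i ≢ j → GeoPath (obstacle K i j) ｛ v j ｝ ｛ v i ｝ (T + T)
    joining K G i j i≢j =
      let (x , p , q) = both-ways (grow K G i j i≢j j (inj₂ refl)) (grow K G i j i≢j i (inj₁ refl))
          (y , y∈ , b) = ball-meet T T p q
      in geodesic (T + T) b y∈

    advance : (st : Σ Linkage Good) (i j : Fin m) → i F.< j → done (proj₁ st) i j ≡ false →
      Σ (Σ Linkage Good) λ st' → done (proj₁ st') i j ≡ true × (∀ a b → done (proj₁ st) a b ≡ true → done (proj₁ st') a b ≡ true)
    advance (K , G) i j i<j undone = go (joining K G i j i≢j)
      where
      i≢j : i ≢ j
      i≢j refl = <-irrefl refl i<j
      go : GeoPath (obstacle K i j) ｛ v j ｝ ｛ v i ｝ (T + T) →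
        Σ (Σ Linkage Good) λ st' → done (proj₁ st') i j ≡ true × (∀ a b → done K a b ≡ true → done (proj₁ st') a b ≡ true)
      go P with between (GeoPath.from-start P) (GeoPath.to-fin P) (outof (GeoPath.start∈ P)) (outof (GeoPath.fin∈ P)) (i≢j ∘ v-inj)
      ... | xs , shape = (A.link , A.good⁺) , A.done-new , A.done⁺
        where module A = Advance K G i j i≢j undone P xs shape

    clique : TopClique H m
    clique = let ((K , _) , d) = all-pairs (done ∘ proj₁) advance (no-links , start) in to-clique K d
      where
      start : Good no-links
      start = record { len = λ _ _ → z≤n ; off-L = λ _ _ () ; off-guard = λ _ _ ()
        ; thin = λ _ _ _ _ p _ → ≤-trans (#-mono (proj₁ ∘ outof)) (≤-trans (#-elems []) z≤n) }

elsewhere : {A : Set} {e i j l : A} → e ≡ i ⊎ e ≡ j → l ≢ i → l ≢ j → e ≢ l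
elsewhere (inj₁ refl) l≢i _ refl = l≢i refl
elsewhere (inj₂ refl) _ l≢j refl = l≢j refl

module Linking (X : Setting) {m : ℕ} (v : Fin m → V (Setting.H X)) (v-inj : Injective _≡_ _≡_ v)
  (L : Sub (n (Setting.H X))) (guard : Fin m → Sub (n (Setting.H X))) (r T : ℕ)
  (v∉L : ∀ l → ¬ v l ∈ L) (v∈guard : ∀ l → v l ∈ guard l)
  (apart : ∀ {i l} → i ≢ l → ∀ {x} → x ∈ Walks.Ball (Setting.H X) L ｛ v i ｝ r → ¬ x ∈ guard l) where
  open Core X
  open Linkages H v v-inj
  open Linkage
  open GeodesicLinking H v v-inj L guard r T v∉L v∈guard apart public

  core-clear : ∀ K i j e → (e ≡ i ⊎ e ≡ j) → ¬ v e ∈ obstacle K i j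
  core-clear K i j e ij z with outof z
  ... | inj₂ g = let (l , l≢i , l≢j , p) = outof g in
    apart {e} {l} (elsewhere ij l≢i l≢j) (ball-≤ {p = 0} {q = r} z≤n (into (into refl , v∉L e))) p
  ... | inj₁ z' with outof z'
  ...   | inj₁ p = v∉L e p
  ...   | inj₂ p = let (a , b , q) = outof p in off-cores K a b (outof q) e refl

  used-bound : ∀ K → Good K → # (used K) ≤ m * (m * (2 * T))
  used-bound K G = used-size K (Good.len G)

  obstacle-size : ∀ K → Good K → ∀ i j {a b} → # L ≤ a → (∀ l → # (guard l) ≤ b) →
    # (obstacle K i j) ≤ (a + m * (m * (2 * T))) + m * b
  obstacle-size K G i j la lb = ≤-trans (#-∪ _ _) (+-mono-≤
    (≤-trans (#-∪ L (used K)) (+-mono-≤ la (used-bound K G)))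
    (≤-trans (#-mono (λ p → let (l , _ , _ , g) = outof p in into (l , g))) (#-⋃ guard lb)))

-- Cores of large degree

module Star (X : Setting) where
  open Core X

  module _ (m Δ x : ℕ) (v : Fin m → V H) (v-inj : Injective _≡_ _≡_ v) (Δ≤ : ∀ l → Δ ≤ # (adj H (v l))) where
    T z : ℕ
    T = 1 + Λ * (2 * w)
    z = m * (m * (2 * T)) + m

    not-∅ : ∀ l → ¬ v l ∈ ∅
    not-∅ l ⟨ () ⟩

    open Linking X v v-inj ∅ (λ l → ｛ v l ｝) 0 T not-∅ (λ _ → into refl)
      (λ i≢l p q → i≢l (v-inj (trans (sym (outof (proj₁ (outof p)))) (outof q))))
    open Linkages H v v-inj

    -- A neighbourhood of size `x + z` keeps x vertices after the obstacle is deleted, so the ball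
    -- outweighs the obstacle from radius one on. The early phase needs no protection, and each
    -- guard is just its core.
    star-clique : k ≤ x → x + z ≤ Δ → 2 * w * z ≤ x → TopClique H m
    star-clique k≤x x+z≤Δ z≤x = clique grow
      where
      grow : ∀ K → Good K → ∀ i j → i ≢ j → ∀ e → (e ≡ i ⊎ e ≡ j) → n H < 2 * # (Ball (obstacle K i j) ｛ v e ｝ T)
      grow K G i j _ e ij = spread 1 x k≤x (+-cancelʳ-≤ z _ _ (begin
          x + z ≤⟨ x+z≤Δ ⟩
          Δ ≤⟨ Δ≤ e ⟩
          # (adj H (v e)) ≤⟨ #-∖ (adj H (v e)) Z ⟩
          # (adj H (v e) ∖ Z) + # Z ≤⟨ +-mono-≤ (#-mono first) Z≤ ⟩
          # (Ball Z ｛ v e ｝ 1) + z ∎)) (≤-trans (*-monoʳ-≤ (2 * w) Z≤) z≤x)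
        where
        open ≤-Reasoning
        Z : SubH
        Z = obstacle K i j
        Z≤ : # Z ≤ z
        Z≤ = ≤-trans (obstacle-size K G i j {0} {1} (≤-reflexive (#-empty {A = ∅} λ { ⟨ () ⟩ })) (λ l → #-｛｝ (v l)))
          (≤-reflexive (cong (m * (m * (2 * T)) +_) (*-identityʳ m)))
        first : (adj H (v e) ∖ Z) ⊆ Ball Z ｛ v e ｝ 1
        first p = let (a , u) = outof p in ball-nb 0 (into (into refl , core-clear K i j e ij)) (holds a) u

-- Cores that are far apart

module Sparse (X : Setting) where
  open Core X

  module _ (m Δ i₁ i₂ : ℕ) (L : Sub (n H)) (low : ∀ {u} → ¬ u ∈ L → # (adj H u) < Δ) (L≤ : # L ≤ m)
    where

    time-mono : ∀ {i j} → i ≤ j → time i ≤ time j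
    time-mono i≤j = go (≤⇒≤′ i≤j)
      where
      go : ∀ {i j} → i ≤′ j → time i ≤ time j
      go ≤′-refl = ≤-refl
      go (≤′-step {j} le) = ≤-trans (go le) (≤-trans (m≤m+n _ _) (≤-reflexive (sym (time-suc j))))

    r R T : ℕ
    r = time i₁
    R = time i₂
    T = time Λ

    -- Outside L degrees are below Δ, so a vertex together with its neighbours numbers at most Δ.
    volume : ∀ v p → # (Ball L ｛ v ｝ p) ≤ Δ ^ p
    volume v zero = ≤-trans (#-mono (proj₁ ∘ outof)) (#-｛｝ v)
    volume v (suc p) = begin
      # (Ball L ｛ v ｝ (suc p)) ≤⟨ #-sup part _ cover ⟩
      ∑ (λ x → # (part x)) ≤⟨ ∑-mono each ⟩
      ∑ (λ x → Δ * ind (B x)) ≡⟨ ∑-* Δ _ ⟩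
      Δ * # B ≤⟨ *-monoʳ-≤ Δ (volume v p) ⟩
      Δ * Δ ^ p ∎
      where
      open ≤-Reasoning
      B : SubH
      B = Ball L ｛ v ｝ p
      part : VH → SubH
      part x = set (λ u → (x ∈? B) ×-dec (u ∈? (｛ x ｝ ∪ adj H x)))
      cover : ∀ {u} → u ∈ Ball L ｛ v ｝ (suc p) → Σ VH λ x → u ∈ part x
      cover {u} q with outof q
      ... | inj₁ b = u , into (b , into (inj₁ (into refl)))
      ... | inj₂ (_ , nb) = let (x , b , e) = outof nb in x , into (b , into (inj₂ ⟨ e ⟩))
      each : ∀ x → # (part x) ≤ Δ * ind (B x)
      each x with x ∈? B
      ... | yes b rewrite ind-in b | *-identityʳ Δ = ≤-trans (#-mono (proj₂ ∘ outof)) (≤-trans (#-∪ ｛ x ｝ (adj H x))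
          (≤-trans (+-monoˡ-≤ _ (#-｛｝ x)) (low (ball-avoid p b))))
      ... | no ¬b = ≤-trans (≤-reflexive (#-empty λ q → ¬b (proj₁ (outof q)))) z≤n

    guard : (Fin m → VH) → Fin m → SubH
    guard v l = Ball L ｛ v l ｝ r

    Apart : (Fin m → VH) → Set
    Apart v = ∀ {i l} → i ≢ l → ∀ p → p ≤ R → ∀ {x} → x ∈ Ball L ｛ v i ｝ p → ¬ x ∈ guard v l

    module Cores (i₁≤i₂ : i₁ ≤ i₂) (room : m * Δ ^ (R + r) + m < n H) where

      opaque
        cores : Σ (Fin m → VH) λ v → (∀ i → ¬ v i ∈ L) × (∀ i j → j F.< i → ¬ v j ∈ Ball L ｛ v i ｝ (R + r))
        cores = let (f , ok) = greedy {A = Σ VH λ v → ¬ v ∈ L} (λ v → Ball L ｛ proj₁ v ｝ (R + r)) (λ U v → ¬ proj₁ v ∈ U) (Δ ^ (R + r)) (m * Δ ^ (R + r))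
                      (λ v → volume (proj₁ v) (R + r)) (λ U⊆ p q → p (U⊆ q)) pick m ≤-refl
                in proj₁ ∘ f , proj₂ ∘ f , ok
          where
          pick : ∀ U → # U ≤ m * Δ ^ (R + r) → Σ (Σ VH λ v → ¬ v ∈ L) λ v → ¬ proj₁ v ∈ U
          pick U U≤ = let (u , _ , out) = #-pick∖ {A = ∁ ∅} {B = U ∪ L} (≤-trans (s≤s (≤-trans (#-∪ U L) (+-mono-≤ U≤ L≤)))
                            (≤-trans room (≤-reflexive (sym (#-all λ u → into λ { ⟨ () ⟩ })))))
                      in (u , λ l → out (into (inj₂ l))) , λ p → out (into (inj₁ p))

      v : Fin m → VH
      v = proj₁ cores
      v∉L : ∀ i → ¬ v i ∈ L
      v∉L = proj₁ (proj₂ cores)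

      far : ∀ {i l} → i ≢ l → ¬ v l ∈ Ball L ｛ v i ｝ (R + r)
      far {i} {l} i≢l b with <F-cmp i l
      ... | tri≈ _ e _ = i≢l e
      ... | tri> _ _ lt = proj₂ (proj₂ cores) i l lt b
      ... | tri< lt _ _ with ball-meet 0 (R + r) (into (into refl , v∉L l)) b
      ...   | y , y∈ , b' with outof y∈
      ...     | refl = proj₂ (proj₂ cores) l i lt b'

      v-inj : Injective _≡_ _≡_ v
      v-inj {i} {l} e with i ≟F l
      ... | yes p = p
      ... | no ne = ⊥-elim (far ne (ball-≤ {p = 0} {q = R + r} z≤n (into (into (sym e) , v∉L l))))

      apart : Apart v
      apart {i} {l} i≢l p p≤R a b with ball-meet p r a b
      ... | y , y∈ , c with outof y∈
      ...   | refl = far i≢l (ball-≤ {p = p + r} {q = R + r} (+-monoˡ-≤ r p≤R) c)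

    -- The ball around a core passes through three regimes. Up to radius r, reached at level i₁,
    -- foreign paths are kept out by its guard and its own paths are thin, so the obstacles are
    -- linear in m. Up to radius R, reached at level i₂, every used vertex may obstruct, but no
    -- foreign guard is met. After that the guards are charged in full, at `m * Δ ^ r`.
    module Placed (v : Fin m → VH) (v-inj : Injective _≡_ _≡_ v) (v∉L : ∀ i → ¬ v i ∈ L) (apart : Apart v) (i₁≤i₂ : i₁ ≤ i₂)
      (n₁ : 5 * m ≤ 2 * q) (n₂ : k + 7 * m ≤ k₀)
      (early : ∀ i → i < i₁ → 2 * rate (suc i) * (m + 2 * (m * (2 + time (suc i)))) ≤ k * 2 ^ i)
      (middle : ∀ i → i₁ ≤ i → i < Λ → 2 * rate (suc i) * (m + m * (m * (2 * T))) ≤ k * 2 ^ i)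
      (late : ∀ i → i₂ ≤ i → i < Λ → 2 * rate (suc i) * ((m + m * (m * (2 * T))) + m * Δ ^ r) ≤ k * 2 ^ i) where

      r≥2 : 2 ≤ r
      r≥2 = ≤-trans (≤-reflexive (sym time-zero)) (time-mono z≤n)

      open Linking X v v-inj L (guard v) r T v∉L (λ l → ball-≤ {p = 0} {q = r} z≤n (into (into refl , v∉L l)))
        (λ i≢l p → apart i≢l r (time-mono i₁≤i₂) p)
      open Linkages H v v-inj
      open Linkage

      module Growth (K : Linkage) (G : Good K) (i j : Fin m) (e : Fin m) (ij : e ≡ i ⊎ e ≡ j) where
        Z : SubH
        Z = obstacle K i j
        A : ℕ → SubH
        A = Ball Z ｛ v e ｝
        front : ℕ → SubH
        front p = ∂ (A p) ∩ Z

        A⊆near : ∀ p → A p ⊆ near K e p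
        A⊆near p = ball-mono p (λ _ q → ∪ˡ q) id

        front-L : ∀ p {x} → x ∈ front p → x ∈ L ⊎ x ∈ Ball L ｛ v e ｝ (suc p)
        front-L p {x} q = go (x ∈? L)
          where
          nb : x ∈ Nb (A p)
          nb = proj₁ (outof (proj₁ (outof q)))
          nb' : x ∈ Nb (Ball L ｛ v e ｝ p)
          nb' = Nb-mono (ball-mono p (λ _ z → ∪ˡ (∪ˡ z)) id) nb
          go : Dec (x ∈ L) → x ∈ L ⊎ x ∈ Ball L ｛ v e ｝ (suc p)
          go (yes l) = inj₁ l
          go (no l) = inj₂ (into (inj₂ (l , nb')))

        front-Z : ∀ p {x} → x ∈ front p → x ∈ Z
        front-Z p q = proj₂ (outof q)

        front-near : ∀ p {x} → x ∈ front p → x ∈ Nb (near K e p)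
        front-near p q = Nb-mono (A⊆near p) (proj₁ (outof (proj₁ (outof q))))

        front-early : ∀ p → p < r → # (front p) ≤ m + 2 * (m * (2 + p))
        front-early p p<r = ≤-trans (#-cover {B = L} {C = own₁ ∪ own₂} sub) (+-mono-≤ L≤ (≤-trans (#-∪ own₁ own₂)
            (≤-trans (+-mono-≤ (#-⋃ _ (λ l → Good.thin G e l e (inj₁ refl) p p<r)) (#-⋃ _ (λ l → Good.thin G l e e (inj₂ refl) p p<r)))
              (≤-reflexive (cong (m * (2 + p) +_) (sym (+-identityʳ _)))))))
          where
          own₁ own₂ : SubH
          own₁ = ⋃ (λ l → elems (inner K e l) ∩ Nb (near K e p))
          own₂ = ⋃ (λ l → elems (inner K l e) ∩ Nb (near K e p))
          on-path : ∀ {x} → x ∈ front p → x ∈ Ball L ｛ v e ｝ (suc p) → ∀ a b → x ∈ elems (inner K a b) → Dec (e ≡ a) → Dec (e ≡ b) → x ∈ (own₁ ∪ own₂)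
          on-path q _ a b x∈ (yes refl) _ = ∪ˡ (into (b , into (x∈ , front-near p q)))
          on-path q _ a b x∈ (no _) (yes refl) = ∪ʳ (into (a , into (x∈ , front-near p q)))
          on-path q bl a b x∈ (no ne) (no ne') = ⊥-elim (Good.off-guard G a b (outof x∈) e ne ne' (ball-≤ {p = suc p} {q = r} p<r bl))
          in-Z : ∀ {x} → x ∈ front p → x ∈ Ball L ｛ v e ｝ (suc p) →
            (x ∈ L ⊎ x ∈ used K) ⊎ (Σ (Fin m) λ l → l ≢ i × l ≢ j × x ∈ guard v l) → x ∈ L ⊎ x ∈ (own₁ ∪ own₂)
          in-Z q bl (inj₂ (l , l≢i , l≢j , y)) =
            ⊥-elim (apart {e} {l} (elsewhere ij l≢i l≢j) r (time-mono i₁≤i₂) (ball-≤ {p = suc p} {q = r} p<r bl) y)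
          in-Z q bl (inj₁ (inj₁ l)) = inj₁ l
          in-Z q bl (inj₁ (inj₂ u)) = let (a , b , x∈) = outof u in inj₂ (on-path q bl a b x∈ (e ≟F a) (e ≟F b))
          sub : ∀ {x} → x ∈ front p → x ∈ L ⊎ x ∈ (own₁ ∪ own₂)
          sub q = [ inj₁ , (λ bl → in-Z q bl (obstacle-cases K i j (front-Z p q))) ]′ (front-L p q)

        front-middle : ∀ p → p < R → # (front p) ≤ m + m * (m * (2 * T))
        front-middle p p<R = ≤-trans (#-cover {B = L} {C = used K} sub) (+-mono-≤ L≤ (used-bound K G))
          where
          in-Z : ∀ {x} → x ∈ Ball L ｛ v e ｝ (suc p) →
            (x ∈ L ⊎ x ∈ used K) ⊎ (Σ (Fin m) λ l → l ≢ i × l ≢ j × x ∈ guard v l) → x ∈ L ⊎ x ∈ used K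
          in-Z bl (inj₂ (l , l≢i , l≢j , y)) = ⊥-elim (apart {e} {l} (elsewhere ij l≢i l≢j) (suc p) p<R bl y)
          in-Z bl (inj₁ z) = z
          sub : ∀ {x} → x ∈ front p → x ∈ L ⊎ x ∈ used K
          sub q = [ inj₁ , (λ bl → in-Z bl (obstacle-cases K i j (front-Z p q))) ]′ (front-L p q)

        front-late : ∀ p → # (front p) ≤ (m + m * (m * (2 * T))) + m * Δ ^ r
        front-late p = ≤-trans (#-mono (front-Z p)) (obstacle-size K G i j L≤ (λ l → volume (v l) r))

        front-in : ∀ p {x y} → y ∈ A p → Edge H y x → x ∈ Z → x ∈ front p
        front-in p {x} {y} y∈ e z = into (into (into (y , y∈ , e) , λ x∈ → ball-avoid p x∈ z) , z)

        e∈A : ∀ p → v e ∈ A p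
        e∈A p = ball-≤ {p = 0} {q = p} z≤n (into (into refl , core-clear K i j e ij))

        start : k ≤ # (A 2)
        start = +-cancelʳ-≤ (7 * m) _ _ (begin
          k + 7 * m ≤⟨ n₂ ⟩
          k₀ ≤⟨ two-step (v e) Y B (λ y → proj₂ (outof y)) (λ b → proj₂ (outof b) (into refl)) Y≥ rich ⟩
          # B ≤⟨ #-mono (proj₁ ∘ outof) ⟩
          # (A 2 ∪ front 1) ≤⟨ #-∪ (A 2) (front 1) ⟩
          # (A 2) + # (front 1) ≤⟨ +-monoʳ-≤ (# (A 2)) (front-early 1 r≥2) ⟩
          # (A 2) + (m + 2 * (m * 3)) ≡⟨ cong (# (A 2) +_) (c₁ m) ⟩
          # (A 2) + 7 * m ∎)
          where
          open ≤-Reasoning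
          c₁ : ∀ m → m + 2 * (m * 3) ≡ 7 * m
          c₁ = solve-∀
          c₂ : ∀ m → m + 2 * (m * 2) ≡ 5 * m
          c₂ = solve-∀
          c₃ : ∀ q → 2 * q + 2 * q ≡ 4 * q
          c₃ = solve-∀
          Y B : SubH
          Y = A 1 ∩ adj H (v e)
          B = (A 2 ∪ front 1) ∖ ｛ v e ｝
          Y≥ : 2 * q ≤ # Y
          Y≥ = +-cancelʳ-≤ (2 * q) _ _ (begin
            2 * q + 2 * q ≡⟨ c₃ q ⟩
            4 * q ≤⟨ degree≥ (v e) ⟩
            # (adj H (v e)) ≤⟨ #-cover {B = Y} {C = front 0} sub ⟩
            # Y + # (front 0) ≤⟨ +-monoʳ-≤ (# Y) (front-early 0 (≤-trans (s≤s z≤n) r≥2)) ⟩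
            # Y + (m + 2 * (m * 2)) ≡⟨ cong (# Y +_) (c₂ m) ⟩
            # Y + 5 * m ≤⟨ +-monoʳ-≤ (# Y) n₁ ⟩
            # Y + 2 * q ∎)
            where
            sub : ∀ {x} → x ∈ adj H (v e) → x ∈ Y ⊎ x ∈ front 0
            sub {x} a = go (x ∈? Z)
              where
              go : Dec (x ∈ Z) → x ∈ Y ⊎ x ∈ front 0
              go (no z) = inj₁ (into (ball-nb 0 (e∈A 0) (holds a) z , a))
              go (yes z) = inj₂ (front-in 0 (e∈A 0) (holds a) z)
          rich : ∀ {y} → y ∈ Y → 2 * q ≤ # (adj H y ∩ B)
          rich {y} y∈ = +-cancelʳ-≤ 1 _ _ (begin
            2 * q + 1 ≤⟨ +-monoʳ-≤ (2 * q) (≤-trans (≤-trans (s≤s z≤n) s<q) (m≤m+n q (q + 0))) ⟩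
            2 * q + 2 * q ≡⟨ c₃ q ⟩
            4 * q ≤⟨ degree≥ y ⟩
            # (adj H y) ≤⟨ #-cover {B = adj H y ∩ B} {C = ｛ v e ｝} sub ⟩
            # (adj H y ∩ B) + # ｛ v e ｝ ≤⟨ +-monoʳ-≤ _ (#-｛｝ (v e)) ⟩
            # (adj H y ∩ B) + 1 ∎)
            where
            reach : ∀ {x} → x ∈ adj H y → x ∈ (A 2 ∪ front 1)
            reach {x} a = go (x ∈? Z)
              where
              go : Dec (x ∈ Z) → x ∈ (A 2 ∪ front 1)
              go (no z) = ∪ˡ (ball-nb 1 (proj₁ (outof y∈)) (holds a) z)
              go (yes z) = ∪ʳ (front-in 1 (proj₁ (outof y∈)) (holds a) z)
            sub : ∀ {x} → x ∈ adj H y → x ∈ (adj H y ∩ B) ⊎ x ∈ ｛ v e ｝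
            sub {x} a = go (x ≟F v e)
              where
              go : Dec (x ≡ v e) → x ∈ (adj H y ∩ B) ⊎ x ∈ ｛ v e ｝
              go (yes p) = inj₂ (into p)
              go (no p) = inj₁ (into (a , into (reach a , λ x∈ → p (outof x∈))))

        -- The rate follows the scale. With the uniform rate w the first levels would need m times a
        -- power of Λ below k, which may fail when m is itself only a power of Λ; with
        -- `rate (suc i)` it is enough that m times a polynomial in i is below `k * 2 ^ i`.
        grown : n H < 2 * # (A T)
        grown = climb-out (λ p → # (A p)) (λ le → #-mono (ball-≤ le)) (n H) k time (λ i → 2 * rate (suc i)) time-suc
          (λ i → ≤-trans (rate≥1 (suc i)) (m≤m+n _ _)) Λ level 0 z≤n (≤-trans (≤-reflexive (*-identityʳ k)) (subst (λ z → k ≤ # (A z)) (sym time-zero) start)) N≥1 N≤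
          where
          obstructed : ∀ i p → i < Λ → time i ≤ p → p < time (suc i) → Σ ℕ λ o → # (front p) ≤ o × 2 * rate (suc i) * o ≤ k * 2 ^ i
          obstructed i p i<Λ lo hi = go (i <? i₁) (i <? i₂)
            where
            go : Dec (i < i₁) → Dec (i < i₂) → Σ ℕ λ o → # (front p) ≤ o × 2 * rate (suc i) * o ≤ k * 2 ^ i
            go (yes lt) _ = _ , ≤-trans (front-early p (≤-trans hi (time-mono lt))) (+-monoʳ-≤ m (*-monoʳ-≤ 2 (*-monoʳ-≤ m (+-monoʳ-≤ 2 (<⇒≤ hi))))) , early i lt
            go (no ge) (yes lt) = _ , front-middle p (≤-trans hi (time-mono lt)) , middle i (≮⇒≥ ge) i<Λ
            go (no _) (no ge) = _ , front-late p , late i (≮⇒≥ ge) i<Λ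
          level : ∀ i p → i < Λ → time i ≤ p → p < time (suc i) → 2 * # (A p) ≤ n H → k * 2 ^ i ≤ # (A p) → # (A p) ≤ k * 2 ^ suc i →
            k * 2 ^ i + 2 * rate (suc i) * # (A p) ≤ 2 * rate (suc i) * # (A (suc p))
          level i p i<Λ lo hi small a≥ a≤ = let (o , front≤ , o≤) = obstructed i p i<Λ lo hi in
            grow-step p (rate (suc i)) o (k * 2 ^ i)
              (expand-level (suc i) (A p) (≤-trans (m≤m*n k (2 ^ i) ⦃ m^n≢0 2 i ⦄) a≥) a≤ small) front≤ o≤ a≥

      sparse-clique : TopClique H m
      sparse-clique = clique λ K G i j _ e ij → Growth.grown K G i j e ij

    module _ (i₁≤i₂ : i₁ ≤ i₂) (room : m * Δ ^ (R + r) + m < n H) (n₁ : 5 * m ≤ 2 * q) (n₂ : k + 7 * m ≤ k₀)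
      (early : ∀ i → i < i₁ → 2 * rate (suc i) * (m + 2 * (m * (2 + time (suc i)))) ≤ k * 2 ^ i)
      (middle : ∀ i → i₁ ≤ i → i < Λ → 2 * rate (suc i) * (m + m * (m * (2 * T))) ≤ k * 2 ^ i)
      (late : ∀ i → i₂ ≤ i → i < Λ → 2 * rate (suc i) * ((m + m * (m * (2 * T))) + m * Δ ^ r) ≤ k * 2 ^ i) where

      far-cores-clique : TopClique H m
      far-cores-clique = Placed.sparse-clique C.v C.v-inj C.v∉L C.apart i₁≤i₂ n₁ n₂ early middle late
        where module C = Cores i₁≤i₂ room

-- Cores and units

-- From a healthy core one still reaches S vertices after deleting any small set Q that spares most of the star D.
module Health (X : Setting) (θ S ρ : ℕ) where
  open Core X

  record Healthy (U : SubH) : Set where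
    field
      core : VH
      core∉U : ¬ core ∈ U
      D : SubH
      D⊆ : D ⊆ adj H core
      D-size : # D ≡ 4 * q
      reach : ∀ Q → ¬ core ∈ Q → # Q ≤ θ → # (Q ∩ D) ≤ q → S ≤ # (Ball (U ∪ Q) ｛ core ｝ ρ)

module Carving (X : Setting) where
  open Core X

  module _ (f θ S J ρ b₁ b₂ : ℕ) (ρ-def : 2 + J * (4 * w) ≡ ρ)
    (bad₁ : t * (f + 2 * w * f) ^ s ≤ b₁ * (q ∸ s) ^ s)
    (bad₂ : t * ((f + 2 * w * f) + b₁) ^ s ≤ b₂ * (q ∸ s) ^ s)
    (room : (f + 2 * w * f) + b₂ < n H)
    (k+θ≤k₀ : k + θ ≤ k₀) (θ-small : 4 * w * θ ≤ k) (S≥1 : 1 ≤ S) (S≤ : 2 * S ≤ k * 2 ^ J)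
    (half : 2 * (2 * w * f + S) ≤ n H) where

    open Health X θ S ρ public

    module Carve (U : SubH) (U≤ : # U ≤ f) where

      -- Adjoining a suitable ball around an unhealthy vertex keeps a set closed.
      Closed : SubH → Set
      Closed A = 2 * w * # (∂ A ∖ U) ≤ # A

      Stuck : VH → SubH → SubH → Set
      Stuck v D Q = ¬ v ∈ Q × # Q ≤ θ × # (Q ∩ D) ≤ q × # (Ball (U ∪ Q) ｛ v ｝ ρ) < S

      -- An unhealthy vertex must come with its set Q, because the piece to be carved out is a ball
      -- avoiding Q. A search over all subsets decides the alternative.
      stuck? : ∀ v D → Dec (Σ SubH (Stuck v D))
      stuck? v D = anySub? (λ Q → ¬? (v ∈? Q) ×-dec (_ ≤? _) ×-dec (_ ≤? _) ×-dec (_ <? _)) resp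
        where
        resp : ∀ {A B} → (∀ u → A u ≡ B u) → Stuck v D A → Stuck v D B
        resp {A} {B} e (a , b , c , d) = (λ p → a (B⊆A p)) , ≤-trans (#-mono B⊆A) b ,
            ≤-trans (#-mono λ p → let (x , y) = outof p in into (B⊆A x , y)) c ,
            ≤-trans (s≤s (#-mono (ball-mono {U ∪ B} {U ∪ A} ρ (λ _ → ∪-elim ∪ˡ (λ p → ∪ʳ (A⊆B p))) id))) d
          where
          B⊆A : B ⊆ A
          B⊆A = ∈-cong (λ u → sym (e u))
          A⊆B : A ⊆ B
          A⊆B = ∈-cong e

      -- A closed set is small: it expands in H, but its boundary outside U is small.
      closed-small : ∀ A → Closed A → k ≤ # A → 2 * # A ≤ n H → # A ≤ 2 * w * f
      closed-small A cl k≤ small = +-cancelˡ-≤ (# A) _ _ (begin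
        # A + # A ≡⟨ cong (# A +_) (sym (+-identityʳ (# A))) ⟩
        2 * # A ≤⟨ *-monoʳ-≤ 2 (expand-w A k≤ small) ⟩
        2 * (w * # (∂ A)) ≡⟨ sym (*-assoc 2 w _) ⟩
        2 * w * # (∂ A) ≤⟨ *-monoʳ-≤ (2 * w) (≤-trans (#-∖ (∂ A) U) (+-monoʳ-≤ _ U≤)) ⟩
        2 * w * (# (∂ A ∖ U) + f) ≡⟨ *-distribˡ-+ (2 * w) _ f ⟩
        2 * w * # (∂ A ∖ U) + 2 * w * f ≤⟨ +-monoˡ-≤ (2 * w * f) cl ⟩
        # A + 2 * w * f ∎)
        where open ≤-Reasoning

      module Piece (A : SubH) (cl : Closed A) (v : VH) (v∉F : ¬ v ∈ (U ∪ A)) (v-good : ¬ v ∈ Bad ((U ∪ A) ∪ Bad (U ∪ A)))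
        (D : SubH) (D⊆ : D ⊆ adj H v) (D-size : # D ≡ 4 * q) (Q : SubH) (stuck : Stuck v D Q) where
        F Z : SubH
        F = U ∪ A
        Z = F ∪ Q
        B : ℕ → SubH
        B = Ball Z ｛ v ｝
        v∉Z : ¬ v ∈ Z
        v∉Z = ∪-elim v∉F (proj₁ stuck)
        v∈B : ∀ p → v ∈ B p
        v∈B p = ball-≤ {p = 0} {q = p} z≤n (into (into refl , v∉Z))

        U∪Q⊆Z : (U ∪ Q) ⊆ Z
        U∪Q⊆Z = ∪-elim (λ p → ∪ˡ (∪ˡ p)) ∪ʳ

        B-small : # (B ρ) < S
        B-small = ≤-trans (s≤s (#-mono (ball-mono {Z} {U ∪ Q} ρ (λ _ → U∪Q⊆Z) id))) (proj₂ (proj₂ (proj₂ stuck)))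

        four : ∀ q → 4 * q ≡ 2 * q + (q + q)
        four = solve-∀

        -- Of the 4q vertices of D fewer than q lie in `F ∪ Bad F`, as v is good, and at most q in
        -- Q. The remaining 2q feed `two-step`; its second layer may meet Q, and this costs the θ in
        -- `k + θ ≤ k₀`.
        start : k ≤ # (B 2)
        start = +-cancelʳ-≤ θ _ _ (begin
          k + θ ≤⟨ k+θ≤k₀ ⟩
          k₀ ≤⟨ two-step v Y N₂ (λ y → D⊆ (proj₁ (outof y))) (λ p → proj₂ (outof p) (into refl)) Y≥ rich ⟩
          # N₂ ≤⟨ #-mono (λ p → proj₁ (outof p)) ⟩
          # (B 2 ∪ Q) ≤⟨ ≤-trans (#-∪ (B 2) Q) (+-monoʳ-≤ (# (B 2)) (proj₁ (proj₂ stuck))) ⟩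
          # (B 2) + θ ∎)
          where
          open ≤-Reasoning
          Y N₂ : SubH
          Y = D ∖ ((F ∪ Bad F) ∪ Q)
          N₂ = (B 2 ∪ Q) ∖ ｛ v ｝
          Y≥ : 2 * q ≤ # Y
          Y≥ = +-cancelʳ-≤ (q + q) _ _ (begin
            2 * q + (q + q) ≡⟨ sym (four q) ⟩
            4 * q ≡⟨ sym D-size ⟩
            # D ≤⟨ #-cover sub ⟩
            # Y + # ((adj H v ∩ (F ∪ Bad F)) ∪ (Q ∩ D)) ≤⟨ +-monoʳ-≤ (# Y) (≤-trans (#-∪ _ _) (+-mono-≤ (<⇒≤ (not-bad v-good)) (proj₁ (proj₂ (proj₂ stuck))))) ⟩
            # Y + (q + q) ∎)
            where
            sub : ∀ {x} → x ∈ D → x ∈ Y ⊎ x ∈ ((adj H v ∩ (F ∪ Bad F)) ∪ (Q ∩ D))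
            sub {x} d = go (x ∈? (F ∪ Bad F)) (x ∈? Q)
              where
              go : Dec (x ∈ (F ∪ Bad F)) → Dec (x ∈ Q) → x ∈ Y ⊎ x ∈ ((adj H v ∩ (F ∪ Bad F)) ∪ (Q ∩ D))
              go (yes p) _ = inj₂ (∪ˡ (into (D⊆ d , p)))
              go (no _) (yes p) = inj₂ (∪ʳ (into (p , d)))
              go (no p) (no p') = inj₁ (into (d , ∪-elim p p'))
          rich : ∀ {y} → y ∈ Y → 2 * q ≤ # (adj H y ∩ N₂)
          rich {y} y∈ = +-cancelʳ-≤ (q + q) _ _ (begin
            2 * q + (q + q) ≡⟨ sym (four q) ⟩
            4 * q ≤⟨ degree≥ y ⟩
            # (adj H y) ≤⟨ #-cover sub ⟩
            # (adj H y ∩ N₂) + # ((adj H y ∩ F) ∪ ｛ v ｝) ≤⟨ +-monoʳ-≤ _ (≤-trans (#-∪ _ _) (+-mono-≤ (<⇒≤ (not-bad λ p → y∉ (∪ˡ (∪ʳ p)))) (≤-trans (#-｛｝ v) (≤-trans (s≤s z≤n) s<q)))) ⟩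
            # (adj H y ∩ N₂) + (q + q) ∎)
            where
            y∉ : ¬ y ∈ ((F ∪ Bad F) ∪ Q)
            y∉ = proj₂ (outof y∈)
            y∈B : y ∈ B 1
            y∈B = ball-nb 0 (v∈B 0) (holds (D⊆ (proj₁ (outof y∈)))) (∪-elim (λ p → y∉ (∪ˡ (∪ˡ p))) (λ p → y∉ (∪ʳ p)))
            sub : ∀ {x} → x ∈ adj H y → x ∈ (adj H y ∩ N₂) ⊎ x ∈ ((adj H y ∩ F) ∪ ｛ v ｝)
            sub {x} a = go (x ∈? F) (x ∈? Q) (x ≟F v)
              where
              go : Dec (x ∈ F) → Dec (x ∈ Q) → Dec (x ≡ v) → x ∈ (adj H y ∩ N₂) ⊎ x ∈ ((adj H y ∩ F) ∪ ｛ v ｝)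
              go (yes p) _ _ = inj₂ (∪ˡ (into (a , p)))
              go (no _) _ (yes e) = inj₂ (∪ʳ (into e))
              go (no p) (yes p') (no e) = inj₁ (into (a , into (∪ʳ p' , λ x∈ → e (outof x∈))))
              go (no p) (no p') (no e) = inj₁ (into (a , into (∪ˡ (ball-nb 1 y∈B (holds a) (∪-elim p p')) , λ x∈ → e (outof x∈))))

        -- Were every ball from radius 2 on to grow by the factor 1 + 1/(4w), J doublings would
        -- carry it from k beyond S before radius ρ, against `B-small`.
        slow : Σ ℕ λ p → p < ρ × 2 ≤ p × 4 * w * # (B (suc p)) ≤ # (B p) + 4 * w * # (B p)
        slow = find (anyUpTo? (λ p → (2 ≤? p) ×-dec (4 * w * # (B (suc p)) ≤? # (B p) + 4 * w * # (B p))) ρ)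
          where
          find : Dec (Σ ℕ λ p → p < ρ × (2 ≤ p × 4 * w * # (B (suc p)) ≤ # (B p) + 4 * w * # (B p))) →
            Σ ℕ λ p → p < ρ × 2 ≤ p × 4 * w * # (B (suc p)) ≤ # (B p) + 4 * w * # (B p)
          find (yes r) = r
          find (no ¬p) = ⊥-elim (<⇒≱ big (*-monoʳ-≤ 2 (<⇒≤ B-small)))
            where
            big : 2 * S < 2 * # (B ρ)
            -- `climb-out` runs here with 2S in the place of the order of H, so that passing one
            -- half means exceeding S.
            big = subst (λ r → 2 * S < 2 * # (B r)) ρ-def (climb-out (λ p → # (B p)) (λ le → #-mono (ball-≤ le)) (2 * S) k (λ i → 2 + i * (4 * w)) (λ _ → 4 * w)
              (λ i → trans (cong (2 +_) (+-comm (4 * w) (i * (4 * w)))) (sym (+-assoc 2 (i * (4 * w)) (4 * w))))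
              (λ _ → ≤-trans w≥1 (m≤m+n w _)) J level 0 z≤n (≤-trans (≤-reflexive (*-identityʳ k)) start) (≤-trans S≥1 (m≤m+n S _)) S≤)
              where
              level : ∀ i r → i < J → 2 + i * (4 * w) ≤ r → r < 2 + suc i * (4 * w) → 2 * # (B r) ≤ 2 * S →
                k * 2 ^ i ≤ # (B r) → # (B r) ≤ k * 2 ^ suc i → k * 2 ^ i + 4 * w * # (B r) ≤ 4 * w * # (B (suc r))
              level i r i<J lo hi _ a≥ _ = ≤-trans (+-monoˡ-≤ _ a≥) (<⇒≤ (≰⇒> λ le → ¬p (r ,
                ≤-trans hi (≤-trans (+-monoʳ-≤ 2 (*-monoˡ-≤ (4 * w) i<J)) (≤-reflexive ρ-def)) , ≤-trans (m≤m+n 2 _) lo , le)))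

        module Enlarge (p : ℕ) (p<ρ : p < ρ) (2≤p : 2 ≤ p) (slow-p : 4 * w * # (B (suc p)) ≤ # (B p) + 4 * w * # (B p)) where
          A⁺ front : SubH
          A⁺ = A ∪ B p
          front = B (suc p) ∖ B p

          apart : ∀ {x} → x ∈ A → x ∈ B p → ⊥
          apart a b = ball-avoid p b (∪ˡ (∪ʳ a))

          size : # A + # (B p) ≤ # A⁺
          size = #-pack ∪ˡ ∪ʳ apart

          k≤B : k ≤ # (B p)
          k≤B = ≤-trans start (#-mono (ball-≤ 2≤p))

          front-small : 4 * w * # front ≤ # (B p)
          front-small = +-cancelʳ-≤ (4 * w * # (B p)) _ _ (begin
            4 * w * # front + 4 * w * # (B p) ≡⟨ sym (*-distribˡ-+ (4 * w) _ _) ⟩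
            4 * w * (# front + # (B p)) ≤⟨ *-monoʳ-≤ (4 * w) (#-pack (λ q → proj₁ (outof q)) (ball-suc p) (λ x y → proj₂ (outof x) y)) ⟩
            4 * w * # (B (suc p)) ≤⟨ slow-p ⟩
            # (B p) + 4 * w * # (B p) ∎)
            where open ≤-Reasoning

          boundary : ∀ {x} → x ∈ (∂ A⁺ ∖ U) → x ∈ ((∂ A ∖ U) ∪ (front ∪ Q))
          boundary {x} p₁ = go (outof nb) (x ∈? Q)
            where
            nb : x ∈ Nb A⁺
            nb = proj₁ (outof (proj₁ (outof p₁)))
            x∉ : ¬ x ∈ A⁺
            x∉ = proj₂ (outof (proj₁ (outof p₁)))
            x∉U : ¬ x ∈ U
            x∉U = proj₂ (outof p₁)
            go : (Σ VH λ y → y ∈ A⁺ × Edge H y x) → Dec (x ∈ Q) → x ∈ ((∂ A ∖ U) ∪ (front ∪ Q))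
            go _ (yes r) = ∪ʳ (∪ʳ r)
            go (y , y∈ , e) (no x∉Q) = ∪-elim
              (λ a → ∪ˡ (into (into (into (y , a , e) , λ a' → x∉ (∪ˡ a')) , x∉U)))
              (λ b → ∪ʳ (∪ˡ (into (ball-nb p b e (∪-elim (∪-elim x∉U (λ a → x∉ (∪ˡ a))) x∉Q) , λ b' → x∉ (∪ʳ b'))))) y∈

          -- The piece pays for its own boundary: apart from old boundary, only the front of the
          -- ball and Q can occur. Slow growth makes the front at most |B|/(4w), and `θ-small` gives
          -- the same bound for Q.
          closed⁺ : Closed A⁺
          closed⁺ = begin
            2 * w * # (∂ A⁺ ∖ U) ≤⟨ *-monoʳ-≤ (2 * w) (≤-trans (#-mono boundary) (≤-trans (#-∪ _ _) (+-monoʳ-≤ _ (≤-trans (#-∪ front Q) (+-monoʳ-≤ (# front) (proj₁ (proj₂ stuck))))))) ⟩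
            2 * w * (# (∂ A ∖ U) + (# front + θ)) ≡⟨ *-distribˡ-+ (2 * w) _ _ ⟩
            2 * w * # (∂ A ∖ U) + 2 * w * (# front + θ) ≤⟨ +-mono-≤ cl (*-cancelˡ-≤ 2 halved) ⟩
            # A + # (B p) ≤⟨ size ⟩
            # A⁺ ∎
            where
            open ≤-Reasoning
            c : ∀ w x y → 2 * (2 * w * (x + y)) ≡ 4 * w * x + 4 * w * y
            c = solve-∀
            halved : 2 * (2 * w * (# front + θ)) ≤ 2 * # (B p)
            halved = begin
              2 * (2 * w * (# front + θ)) ≡⟨ c w (# front) θ ⟩
              4 * w * # front + 4 * w * θ ≤⟨ +-mono-≤ front-small (≤-trans θ-small k≤B) ⟩
              # (B p) + # (B p) ≡⟨ cong (# (B p) +_) (sym (+-identityʳ _)) ⟩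
              2 * # (B p) ∎

          A⁺≤ : # A⁺ ≤ # A + S
          A⁺≤ = ≤-trans (#-∪ A (B p)) (+-monoʳ-≤ (# A) (≤-trans (#-mono (ball-≤ (<⇒≤ p<ρ))) (<⇒≤ B-small)))

          A⁺> : suc (# A) ≤ # A⁺
          A⁺> = ≤-trans (≤-trans (≤-reflexive (+-comm 1 (# A))) (+-monoʳ-≤ (# A) (≤-trans k≥1 k≤B))) size

          k≤A⁺ : k ≤ # A⁺
          k≤A⁺ = ≤-trans k≤B (#-mono ∪ʳ)

      -- By `closed-small` no closed set of size at least k has size strictly between `2 * w * f`
      -- and n/2. One piece adds at most S vertices, so by `half` the set cannot leap over this gap
      -- and stays below it for ever.
      enlarge : (A : SubH) → Closed A → # A ≤ 2 * w * f → (v : VH) → ¬ v ∈ (U ∪ A) → ¬ v ∈ Bad ((U ∪ A) ∪ Bad (U ∪ A)) →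
        (D : SubH) → D ⊆ adj H v → # D ≡ 4 * q → (Q : SubH) → Stuck v D Q →
        Σ SubH λ A⁺ → Closed A⁺ × # A⁺ ≤ 2 * w * f × suc (# A) ≤ # A⁺
      enlarge A cl A≤ v v∉ vg D D⊆ Ds Q st = go (P.slow)
        where
        module P = Piece A cl v v∉ vg D D⊆ Ds Q st
        go : (Σ ℕ λ p → p < ρ × 2 ≤ p × 4 * w * # (P.B (suc p)) ≤ # (P.B p) + 4 * w * # (P.B p)) →
          Σ SubH λ A⁺ → Closed A⁺ × # A⁺ ≤ 2 * w * f × suc (# A) ≤ # A⁺
        go (p , p<ρ , 2≤p , sl) = E.A⁺ , E.closed⁺ , closed-small E.A⁺ E.closed⁺ E.k≤A⁺
            (≤-trans (*-monoʳ-≤ 2 (≤-trans E.A⁺≤ (+-monoˡ-≤ S A≤))) half) , E.A⁺>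
          where module E = P.Enlarge p p<ρ 2≤p sl

      fresh-vertex : (A : SubH) → # A ≤ 2 * w * f → Σ VH λ v → ¬ v ∈ (U ∪ A) × ¬ v ∈ Bad ((U ∪ A) ∪ Bad (U ∪ A))
      fresh-vertex A A≤ = let (v , _ , out) = #-pick∖ {A = ∁ ∅} {B = F ∪ Bad (F ∪ Bad F)} bound in v , (λ p → out (∪ˡ p)) , (λ p → out (∪ʳ p))
        where
        F : SubH
        F = U ∪ A
        F≤ : # F ≤ f + 2 * w * f
        F≤ = ≤-trans (#-∪ U A) (+-mono-≤ U≤ A≤)
        B₁≤ : # (Bad F) ≤ b₁
        B₁≤ = bad-bound F b₁ (≤-trans (*-monoʳ-≤ t (^-monoˡ-≤ s F≤)) bad₁)
        B₂≤ : # (Bad (F ∪ Bad F)) ≤ b₂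
        B₂≤ = bad-bound (F ∪ Bad F) b₂ (≤-trans (*-monoʳ-≤ t (^-monoˡ-≤ s (≤-trans (#-∪ F (Bad F)) (+-mono-≤ F≤ B₁≤)))) bad₂)
        bound : # (F ∪ Bad (F ∪ Bad F)) < # (∁ {n H} ∅)
        bound = ≤-trans (s≤s (≤-trans (#-∪ F _) (+-mono-≤ F≤ B₂≤))) (≤-trans room (≤-reflexive (sym (#-all {A = ∁ ∅} λ u → into λ { ⟨ () ⟩ }))))

      -- Every piece adds at least one vertex and the size is capped at `2 * w * f`, so a healthy
      -- vertex is met before the fuel is spent.
      carve : ∀ fuel A → Closed A → # A ≤ 2 * w * f → 2 * w * f < # A + fuel → Healthy U
      carve zero A cl A≤ lt = ⊥-elim (<⇒≱ lt (≤-trans (≤-reflexive (+-identityʳ _)) A≤))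
      carve (suc fuel) A cl A≤ lt = pick (fresh-vertex A A≤)
        where
        pick : (Σ VH λ v → ¬ v ∈ (U ∪ A) × ¬ v ∈ Bad ((U ∪ A) ∪ Bad (U ∪ A))) → Healthy U
        pick (v , v∉ , vg) = test (#-shrink (adj H v) (4 * q) (degree≥ v))
          where
          test : (Σ SubH λ D → D ⊆ adj H v × # D ≡ 4 * q) → Healthy U
          test (D , D⊆ , Ds) = decide (stuck? v D)
            where
            decide : Dec (Σ SubH (Stuck v D)) → Healthy U
            decide (no ¬st) = record { core = v ; core∉U = λ p → v∉ (∪ˡ p) ; D = D ; D⊆ = D⊆ ; D-size = Ds
              ; reach = λ Q v∉Q Q≤ QD≤ → ≮⇒≥ λ lt' → ¬st (Q , v∉Q , Q≤ , QD≤ , lt') }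
            decide (yes (Q , st)) = go (enlarge A cl A≤ v v∉ vg D D⊆ Ds Q st)
              where
              go : (Σ SubH λ A⁺ → Closed A⁺ × # A⁺ ≤ 2 * w * f × suc (# A) ≤ # A⁺) → Healthy U
              go (A⁺ , cl⁺ , A⁺≤ , A⁺>) = carve fuel A⁺ cl⁺ A⁺≤ (≤-trans lt (≤-trans (≤-reflexive (+-suc (# A) fuel)) (+-monoˡ-≤ fuel A⁺>)))

      opaque
        healthy : Healthy U
        healthy = carve (suc (2 * w * f)) ∅ closed∅ (≤-trans (≤-reflexive (#-empty {A = ∅} λ { ⟨ () ⟩ })) z≤n)
            (m≤n+m (suc (2 * w * f)) (# {n H} ∅))
          where
          none : ∀ {x} → ¬ x ∈ (∂ ∅ ∖ U)
          none {x} p = empty (outof {u = x} (proj₁ (outof {u = x} (proj₁ (outof p)))))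
            where
            empty : (Σ VH λ y → y ∈ ∅ × Edge H y x) → ⊥
            empty (_ , ⟨ () ⟩ , _)
          closed∅ : Closed ∅
          closed∅ = ≤-trans (≤-reflexive (trans (cong (2 * w *_) (#-empty none)) (*-zeroʳ (2 * w)))) z≤n

module Frames (X : Setting) (m h ℓ : ℕ) where
  open Core X
  open Hubs X

  -- A core joined by disjoint arms to hub centres; the layer consists of the h neighbours y chosen at each
  -- centre (idx y names the arm), and every layer vertex carries m private leaves E y.
  record Frame (c : ℕ) : Set where
    field
      core : VH
      arms : ℕ → List VH
      layer : SubH
      idx : VH → ℕ
      E : VH → SubH
      idx< : ∀ {y} → y ∈ layer → idx y < c
      walk : ∀ {y} → y ∈ layer → AdjWalk H (core ∷ arms (idx y) ++ [ y ])
      uniq : ∀ a → a < c → Unique (core ∷ arms a)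
      len : ∀ a → a < c → length (arms a) ≤ ℓ
      arm-sep : ∀ a b → a < c → b < c → ∀ {x} → x ∈ᴸ arms a → x ∈ᴸ arms b → a ≡ b
      layer-core : ∀ {y} → y ∈ layer → y ≢ core
      layer-arm : ∀ {y} → y ∈ layer → ∀ a → a < c → ¬ y ∈ᴸ arms a
      layer≥ : c * h ≤ # layer
      layer≤ : # layer ≤ c * h
      fibre≤ : ∀ a → # (set (λ y → (y ∈? layer) ×-dec (idx y ≟ a))) ≤ h
      E⊆ : ∀ {y} → y ∈ layer → E y ⊆ adj H y
      E-size : ∀ {y} → y ∈ layer → # (E y) ≡ m
      E-sep : ∀ {y y' z} → y ∈ layer → y' ∈ layer → z ∈ E y → z ∈ E y' → y ≡ y'

    on-arms : SubH
    on-arms = ⋃ {μ = c} (λ a → elems (arms (toℕ a)))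

    -- The leaves belong to none of these: different units are disjoint only in their feet, and a
    -- leaf of one unit may lie in another.
    spine body foot : SubH
    spine = ｛ core ｝ ∪ on-arms
    body = on-arms ∪ layer
    foot = ｛ core ｝ ∪ body

    on-arms-size : # on-arms ≤ c * ℓ
    on-arms-size = #-⋃ _ (λ a → ≤-trans (#-elems _) (len (toℕ a) (toℕ<n a)))

    spine-size : # spine ≤ 1 + c * ℓ
    spine-size = ≤-trans (#-∪ _ _) (+-mono-≤ (#-｛｝ core) on-arms-size)

    body-size : # body ≤ c * ℓ + c * h
    body-size = ≤-trans (#-∪ _ _) (+-mono-≤ on-arms-size layer≤)

    foot-size : # foot ≤ 1 + (c * ℓ + c * h)
    foot-size = ≤-trans (#-∪ _ _) (+-mono-≤ (#-｛｝ core) body-size)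

    on-arms-in : ∀ a → a < c → ∀ {x} → x ∈ᴸ arms a → x ∈ on-arms
    on-arms-in a a<c p = into (fromℕ< a<c , into (subst (λ b → _ ∈ᴸ arms b) (sym (toℕ-fromℕ< a<c)) p))

    on-arms-out : ∀ {x} → x ∈ on-arms → Σ ℕ λ a → a < c × x ∈ᴸ arms a
    on-arms-out p = let (a , q) = outof p in toℕ a , toℕ<n a , outof q

  empty-frame : VH → Frame 0
  empty-frame v = record { core = v ; arms = λ _ → [] ; layer = ∅ ; idx = λ _ → 0 ; E = λ _ → ∅ ; idx< = λ { ⟨ () ⟩ } ; walk = λ { ⟨ () ⟩ }
    ; uniq = λ _ () ; len = λ _ () ; arm-sep = λ _ _ () ; layer-core = λ { ⟨ () ⟩ } ; layer-arm = λ { ⟨ () ⟩ } ; layer≥ = z≤n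
    ; layer≤ = ≤-reflexive (#-empty {A = ∅} λ { ⟨ () ⟩ }) ; fibre≤ = λ a → ≤-trans (≤-reflexive (#-empty λ p → none (proj₁ (outof p)))) z≤n
    ; E⊆ = λ { ⟨ () ⟩ } ; E-size = λ { ⟨ () ⟩ } ; E-sep = λ { ⟨ () ⟩ } }
    where
    none : ∀ {x : VH} → x ∈ ∅ → ⊥
    none ⟨ () ⟩

  module Extend {c : ℕ} (K : Frame c) (arm : List VH) (F : SubH) (u : VH) (hub : Hub F (elems arm) u h m)
    (arm-walk : AdjWalk H (Frame.core K ∷ arm)) (arm-uniq : Unique (Frame.core K ∷ arm)) (arm-end : Σ (List VH) λ xs → arm ≡ xs ++ [ u ])
    (arm-len : length arm ≤ ℓ) (arm-new : ∀ {x} → x ∈ᴸ arm → ¬ x ∈ Frame.body K)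
    (core∈F : Frame.core K ∈ F) (body⊆F : Frame.body K ⊆ F) (leaves⊆F : leaves (Frame.layer K) (Frame.E K) ⊆ F) where
    private
      module K = Frame K
      module U = Hub hub

    arms⁺ : ℕ → List VH
    arms⁺ a = choose-if (a ≟ c) arm (K.arms a)

    idx⁺ : VH → ℕ
    idx⁺ y = choose-if (y ∈? U.L) c (K.idx y)

    E⁺ : VH → SubH
    E⁺ y = choose-if (y ∈? U.L) (U.E y) (K.E y)

    L⁺ : SubH
    L⁺ = K.layer ∪ U.L

    arms-new : arms⁺ c ≡ arm
    arms-new = choose-yes (c ≟ c) refl

    arms-old : ∀ {a} → a < c → arms⁺ a ≡ K.arms a
    arms-old {a} a<c = choose-no (a ≟ c) λ { refl → <-irrefl refl a<c }

    disjoint : ∀ {y} → y ∈ K.layer → ¬ y ∈ U.L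
    disjoint p q = U.L∉F q (body⊆F (∪ʳ p))

    idx-new : ∀ {y} → y ∈ U.L → idx⁺ y ≡ c
    idx-new {y} p = choose-yes (y ∈? U.L) p

    idx-old : ∀ {y} → y ∈ K.layer → idx⁺ y ≡ K.idx y
    idx-old {y} p = choose-no (y ∈? U.L) (disjoint p)

    E-new : ∀ {y} → y ∈ U.L → E⁺ y ≡ U.E y
    E-new {y} p = choose-yes (y ∈? U.L) p

    E-old : ∀ {y} → y ∈ K.layer → E⁺ y ≡ K.E y
    E-old {y} p = choose-no (y ∈? U.L) (disjoint p)

    arm-case : ∀ {a} → a < suc c → a < c ⊎ a ≡ c
    arm-case lt = m≤n⇒m<n∨m≡n (≤-pred lt)

    walk-new : ∀ {y} → y ∈ U.L → AdjWalk H (K.core ∷ arm ++ [ y ])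
    walk-new p = go (proj₁ arm-end) (proj₂ arm-end)
      where
      go : ∀ xs → arm ≡ xs ++ [ u ] → AdjWalk H (K.core ∷ arm ++ [ _ ])
      go xs e = subst (λ as → AdjWalk H (K.core ∷ as ++ [ _ ])) (sym e)
        (AdjWalk-snoc H (K.core ∷ xs) (subst (λ as → AdjWalk H (K.core ∷ as)) e arm-walk) (holds (U.L⊆ p)))

    clash : ∀ {a} → a < c → ∀ {x} → x ∈ᴸ arm → x ∈ᴸ K.arms a → ⊥
    clash a<c p q = arm-new p (∪ˡ (K.on-arms-in _ a<c q))

    sep⁺ : ∀ {a b} → a < c ⊎ a ≡ c → b < c ⊎ b ≡ c → ∀ {x} → x ∈ᴸ arms⁺ a → x ∈ᴸ arms⁺ b → a ≡ b
    sep⁺ (inj₁ la) (inj₁ lb) p q = K.arm-sep _ _ la lb (subst (_ ∈ᴸ_) (arms-old la) p) (subst (_ ∈ᴸ_) (arms-old lb) q)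
    sep⁺ (inj₁ la) (inj₂ refl) p q = ⊥-elim (clash la (subst (_ ∈ᴸ_) arms-new q) (subst (_ ∈ᴸ_) (arms-old la) p))
    sep⁺ (inj₂ refl) (inj₁ lb) p q = ⊥-elim (clash lb (subst (_ ∈ᴸ_) arms-new p) (subst (_ ∈ᴸ_) (arms-old lb) q))
    sep⁺ (inj₂ refl) (inj₂ refl) _ _ = refl

    layer-arm⁺ : ∀ {y a} → y ∈ K.layer ⊎ y ∈ U.L → a < c ⊎ a ≡ c → ¬ y ∈ᴸ arms⁺ a
    layer-arm⁺ (inj₁ p) (inj₁ la) q = K.layer-arm p _ la (subst (_ ∈ᴸ_) (arms-old la) q)
    layer-arm⁺ (inj₁ p) (inj₂ refl) q = arm-new (subst (_ ∈ᴸ_) arms-new q) (∪ʳ p)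
    layer-arm⁺ (inj₂ p) (inj₁ la) q = U.L∉F p (body⊆F (∪ˡ (K.on-arms-in _ la (subst (_ ∈ᴸ_) (arms-old la) q))))
    layer-arm⁺ (inj₂ p) (inj₂ refl) q = U.L∉R p (into (subst (_ ∈ᴸ_) arms-new q))

    E-clash : ∀ {y y' z} → y ∈ K.layer → y' ∈ U.L → z ∈ E⁺ y → z ∈ E⁺ y' → ⊥
    E-clash {y} p p' z z' = U.E∉F p' (subst (_ ∈_) (E-new p') z') (leaves⊆F (into (y , p , subst (_ ∈_) (E-old p) z)))

    E-sep⁺ : ∀ {y y' z} → y ∈ K.layer ⊎ y ∈ U.L → y' ∈ K.layer ⊎ y' ∈ U.L → z ∈ E⁺ y → z ∈ E⁺ y' → y ≡ y'
    E-sep⁺ (inj₁ p) (inj₁ p') z z' = K.E-sep p p' (subst (_ ∈_) (E-old p) z) (subst (_ ∈_) (E-old p') z')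
    E-sep⁺ (inj₁ p) (inj₂ p') z z' = ⊥-elim (E-clash p p' z z')
    E-sep⁺ (inj₂ p) (inj₁ p') z z' = ⊥-elim (E-clash p' p z' z)
    E-sep⁺ (inj₂ p) (inj₂ p') z z' = U.E-sep p p' (subst (_ ∈_) (E-new p) z) (subst (_ ∈_) (E-new p') z')

    fibre⁺ : ∀ a → # (set (λ y → (y ∈? L⁺) ×-dec (idx⁺ y ≟ a))) ≤ h
    fibre⁺ a = go (a ≟ c)
      where
      case : ∀ {y} → y ∈ set (λ y → (y ∈? L⁺) ×-dec (idx⁺ y ≟ a)) → (y ∈ K.layer ⊎ y ∈ U.L) × idx⁺ y ≡ a
      case p = outof (proj₁ (outof p)) , proj₂ (outof p)
      go : Dec (a ≡ c) → _
      go (yes refl) = ≤-trans (#-mono λ p → sub (case p)) (≤-reflexive U.L-size)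
        where
        sub : ∀ {y} → (y ∈ K.layer ⊎ y ∈ U.L) × idx⁺ y ≡ c → y ∈ U.L
        sub (inj₁ p , e) = ⊥-elim (<-irrefl (trans (sym (idx-old p)) e) (K.idx< p))
        sub (inj₂ p , _) = p
      go (no a≢c) = ≤-trans (#-mono λ p → sub (case p)) (K.fibre≤ a)
        where
        sub : ∀ {y} → (y ∈ K.layer ⊎ y ∈ U.L) × idx⁺ y ≡ a → y ∈ set (λ y → (y ∈? K.layer) ×-dec (K.idx y ≟ a))
        sub (inj₁ p , e) = into (p , trans (sym (idx-old p)) e)
        sub (inj₂ p , e) = ⊥-elim (a≢c (trans (sym e) (idx-new p)))

    frame⁺ : Frame (suc c)
    frame⁺ = record
      { core = K.core ; arms = arms⁺ ; layer = L⁺ ; idx = idx⁺ ; E = E⁺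
      ; idx< = ∪-elim (λ p → subst (_< suc c) (sym (idx-old p)) (m≤n⇒m≤1+n (K.idx< p))) (λ p → ≤-reflexive (cong suc (idx-new p)))
      ; walk = ∪-elim
          (λ p → subst (λ as → AdjWalk H (K.core ∷ as ++ [ _ ])) (sym (trans (cong arms⁺ (idx-old p)) (arms-old (K.idx< p)))) (K.walk p))
          (λ p → subst (λ as → AdjWalk H (K.core ∷ as ++ [ _ ])) (sym (trans (cong arms⁺ (idx-new p)) arms-new)) (walk-new p))
      ; uniq = λ a lt → [ (λ la → subst (λ as → Unique (K.core ∷ as)) (sym (arms-old la)) (K.uniq a la)) ,
          (λ { refl → subst (λ as → Unique (K.core ∷ as)) (sym arms-new) arm-uniq }) ]′ (arm-case lt)
      ; len = λ a lt → [ (λ la → subst (λ as → length as ≤ ℓ) (sym (arms-old la)) (K.len a la)) ,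
          (λ { refl → subst (λ as → length as ≤ ℓ) (sym arms-new) arm-len }) ]′ (arm-case lt)
      ; arm-sep = λ a b la lb → sep⁺ (arm-case la) (arm-case lb)
      ; layer-core = ∪-elim K.layer-core (λ p e → U.L∉F p (subst (_∈ F) (sym e) core∈F))
      ; layer-arm = λ p a la → layer-arm⁺ (outof p) (arm-case la)
      ; layer≥ = ≤-trans (≤-reflexive (+-comm h (c * h))) (≤-trans (+-mono-≤ K.layer≥ (≤-reflexive (sym U.L-size))) (#-pack ∪ˡ ∪ʳ disjoint))
      ; layer≤ = ≤-trans (#-∪ _ _) (≤-trans (+-mono-≤ K.layer≤ (≤-reflexive U.L-size)) (≤-reflexive (+-comm (c * h) h)))
      ; fibre≤ = fibre⁺
      ; E⊆ = ∪-elim (λ p z → K.E⊆ p (subst (_ ∈_) (E-old p) z)) (λ p z → U.E⊆ p (subst (_ ∈_) (E-new p) z))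
      ; E-size = ∪-elim (λ p → trans (cong # (E-old p)) (K.E-size p)) (λ p → trans (cong # (E-new p)) (U.E-size p))
      ; E-sep = λ p p' → E-sep⁺ (outof p) (outof p') }

    foot-case : ∀ {x} → x ∈ Frame.foot frame⁺ → x ∈ K.foot ⊎ (x ∈ᴸ arm ⊎ x ∈ U.L)
    foot-case = ∪-elim (λ p → inj₁ (∪ˡ p)) (∪-elim (λ p → arm-part (Frame.on-arms-out frame⁺ p))
        (∪-elim (λ p → inj₁ (∪ʳ (∪ʳ p))) (λ p → inj₂ (inj₂ p))))
      where
      arm-part : ∀ {x} → (Σ ℕ λ a → a < suc c × x ∈ᴸ arms⁺ a) → x ∈ K.foot ⊎ (x ∈ᴸ arm ⊎ x ∈ U.L)
      arm-part (a , lt , p) = [ (λ la → inj₁ (∪ʳ (∪ˡ (K.on-arms-in a la (subst (_ ∈ᴸ_) (arms-old la) p))))) ,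
        (λ { refl → inj₂ (inj₁ (subst (_ ∈ᴸ_) arms-new p)) }) ]′ (arm-case lt)

    arms-case : ∀ {x} → x ∈ Frame.on-arms frame⁺ → x ∈ K.on-arms ⊎ x ∈ᴸ arm
    arms-case p = go (Frame.on-arms-out frame⁺ p)
      where
      go : ∀ {x} → (Σ ℕ λ a → a < suc c × x ∈ᴸ arms⁺ a) → x ∈ K.on-arms ⊎ x ∈ᴸ arm
      go (a , lt , p) = [ (λ la → inj₁ (K.on-arms-in a la (subst (_ ∈ᴸ_) (arms-old la) p))) ,
        (λ { refl → inj₂ (subst (_ ∈ᴸ_) arms-new p) }) ]′ (arm-case lt)

-- Building the units

module Units (X : Setting) where
  open Core X

  module _ (m h ℓ θ S ρ f β fH b₃ b₄ : ℕ)
    (ℓ-def : ρ + Λ * (2 * w) ≡ ℓ) (θ≥ : 2 * m * ℓ + 2 * m * h ≤ θ) (2m≤q : 2 * m ≤ q) (fits : ℓ + (h + β) ≤ 2 * q)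
    (k≤S : k ≤ S) (S≥ : 2 * w * (f + θ) ≤ S)
    (fH≥ : ((f + θ) + m * (2 * m * h)) + (4 * q + 1) ≤ fH)
    (bad₃ : t * fH ^ s ≤ b₃ * (q ∸ s) ^ s) (bad₄ : t * (fH + b₃) ^ s ≤ b₄ * (q ∸ s) ^ s) (half : 2 * (b₄ + 1) ≤ n H)
    (β≥ : t * (h * m) ^ s ≤ β * (q ∸ s) ^ s) where
    open Hubs X
    open Frames X m h ℓ
    open Health X θ S ρ

    module Build (U : SubH) (U≤ : # U ≤ f) (hc : Healthy U) where
      open Healthy hc

      -- By `arms-thin` and `layer-off` the part built so far meets D in at most c ≤ 2m ≤ q
      -- vertices. It is therefore one of the deletions Q allowed in `Healthy.reach`, and the core
      -- can send out a further arm.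
      record Stage (c : ℕ) : Set where
        field
          frame : Frame c
        open Frame frame public using (body; foot; on-arms; layer; E)
        field
          same-core : Frame.core frame ≡ core
          avoids : ∀ {x} → x ∈ foot → ¬ x ∈ U
          arms-thin : # (on-arms ∩ D) ≤ c
          layer-off : ∀ {x} → x ∈ layer → ¬ x ∈ D

      stage₀ : Stage 0
      stage₀ = record { frame = empty-frame core ; same-core = refl
        ; avoids = λ p q → go (foot-only p) q ; arms-thin = ≤-reflexive (#-empty λ p → none (proj₁ (outof p)))
        ; layer-off = λ { ⟨ () ⟩ } }
        where
        none : ∀ {x} → ¬ x ∈ Frame.on-arms (empty-frame core)
        none p = absurd (outof p)
          where
          absurd : ∀ {x} → (Σ (Fin 0) λ a → x ∈ elems []) → ⊥
          absurd (() , _)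
        foot-only : ∀ {x} → x ∈ Frame.foot (empty-frame core) → x ≡ core
        foot-only = ∪-elim (λ p → outof p) (∪-elim (λ p → ⊥-elim (none p)) (λ { ⟨ () ⟩ }))
        go : ∀ {x} → x ≡ core → ¬ x ∈ U
        go refl = core∉U

      module Step {c : ℕ} (c<2m : c < 2 * m) (K : Frame c) (same : Frame.core K ≡ core) (avoids : ∀ {x} → x ∈ Frame.foot K → ¬ x ∈ U)
        (thin : # (Frame.on-arms K ∩ D) ≤ c) (off : ∀ {x} → x ∈ Frame.layer K → ¬ x ∈ D) where
        open Frame K using (body; on-arms; layer; E)

        Z F : SubH
        Z = U ∪ body
        F = (Z ∪ leaves layer E) ∪ (D ∪ ｛ core ｝)

        c≤ : c ≤ 2 * m
        c≤ = <⇒≤ c<2m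

        core∉body : ¬ core ∈ body
        core∉body = ∪-elim (λ p → on-arm (Frame.on-arms-out K p)) (λ p → Frame.layer-core K p (sym same))
          where
          on-arm : (Σ ℕ λ a → a < c × core ∈ᴸ Frame.arms K a) → ⊥
          on-arm (a , lt , p) = go (Frame.uniq K a lt)
            where
            go : Unique (Frame.core K ∷ Frame.arms K a) → ⊥
            go (all ∷ _) = All.lookup all p same

        core∉Z : ¬ core ∈ Z
        core∉Z = ∪-elim core∉U core∉body

        body≤ : # body ≤ θ
        body≤ = ≤-trans (Frame.body-size K) (≤-trans (+-mono-≤ (*-monoˡ-≤ ℓ c≤) (*-monoˡ-≤ h c≤)) θ≥)

        body-D : # (body ∩ D) ≤ q
        body-D = ≤-trans (#-mono sub) (≤-trans thin (≤-trans c≤ 2m≤q))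
          where
          sub : (body ∩ D) ⊆ (on-arms ∩ D)
          sub p = let (b , d) = outof p in ∪-elim (λ a → into (a , d)) (λ l → ⊥-elim (off l d)) b

        Z≤ : # Z ≤ f + θ
        Z≤ = ≤-trans (#-∪ U body) (+-mono-≤ U≤ body≤)

        big : n H < 2 * # (Ball Z ｛ core ｝ ℓ)
        big = subst (λ r → n H < 2 * # (Ball Z ｛ core ｝ r)) ℓ-def
          (spread ρ S k≤S (reach body core∉body body≤ body-D) (≤-trans (*-monoʳ-≤ (2 * w) Z≤) S≥))

        F≤ : # F ≤ fH
        F≤ = ≤-trans (≤-trans (#-∪ _ _) (+-mono-≤ (≤-trans (#-∪ Z _) (+-mono-≤ Z≤ lv≤)) (≤-trans (#-∪ D ｛ core ｝) (+-mono-≤ (≤-reflexive D-size) (#-｛｝ core))))) fH≥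
          where
          lv≤ : # (leaves layer E) ≤ m * (2 * m * h)
          lv≤ = ≤-trans (leaves-size layer E m (Frame.E-size K)) (*-monoʳ-≤ m (≤-trans (Frame.layer≤ K) (*-monoˡ-≤ h c≤)))

        -- The ball around the core covers more than half of H, and the bad vertices together with
        -- the core at most half.
        target : Σ VH λ u → u ∈ Ball Z ｛ core ｝ ℓ × ¬ u ∈ (Bad (F ∪ Bad F) ∪ ｛ core ｝)
        target = #-pick∖ (*-cancelˡ-< 2 _ _ (≤-trans (s≤s (≤-trans (*-monoʳ-≤ 2 (≤-trans (#-∪ _ _) (+-mono-≤ b≤ (#-｛｝ core)))) half)) big))
          where
          b≤ : # (Bad (F ∪ Bad F)) ≤ b₄
          b≤ = bad-bound (F ∪ Bad F) b₄ (≤-trans (*-monoʳ-≤ t (^-monoˡ-≤ s (≤-trans (#-∪ F _) (+-mono-≤ F≤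
                (bad-bound F b₃ (≤-trans (*-monoʳ-≤ t (^-monoˡ-≤ s F≤)) bad₃)))))) bad₄)

        module Along (u : VH) (u-good : ¬ u ∈ Bad (F ∪ Bad F)) (P : GeoPath Z ｛ u ｝ ｛ core ｝ ℓ)
          (xs : List VH) (shape : GeoPath.path P ≡ core ∷ xs ++ [ u ]) where
          module P = GeoPath P
          arm : List VH
          arm = xs ++ [ u ]

          walk : AdjWalk H (core ∷ arm)
          walk = subst (AdjWalk H) shape P.walk
          uniq : Unique (core ∷ arm)
          uniq = subst Unique shape P.unique
          len : length arm ≤ ℓ
          len = ≤-pred (≤-trans (≤-reflexive (cong length (sym shape))) P.short)
          core∉arm : ¬ core ∈ᴸ arm
          core∉arm p = go uniq
            where
            go : Unique (core ∷ arm) → ⊥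
            go (all ∷ _) = All.lookup all p refl
          clear : ∀ {x} → x ∈ᴸ arm → ¬ x ∈ Z
          clear p = P.avoid (subst (_ ∈ᴸ_) (sym shape) (there p))

          hub : Hub F (elems arm) u h m
          hub = make-hub F (elems arm) u h m β u-good β≥ (≤-trans (+-monoˡ-≤ (h + β) (≤-trans (#-elems arm) len)) fits)
            (≤-trans (≤-trans (m≤m+n m (m + 0)) 2m≤q) (m≤m+n q (q + 0))) h ≤-refl

          core∈F : Frame.core K ∈ F
          core∈F = ∪ʳ (∪ʳ (into same))

          open Extend K arm F u hub (subst (λ v → AdjWalk H (v ∷ arm)) (sym same) walk) (subst (λ v → Unique (v ∷ arm)) (sym same) uniq)
            (xs , refl) len (λ p q → clear p (∪ʳ q)) core∈F (λ p → ∪ˡ (∪ˡ (∪ʳ p))) (λ p → ∪ˡ (∪ʳ p))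

          -- A geodesic has at most two vertices within distance one of its start, and the core is
          -- one of them. Vertices of D on the arm are adjacent to the core and outside Z, hence in
          -- that ball.
          new-D : # (elems arm ∩ D) ≤ 1
          new-D = +-cancelʳ-≤ 1 _ _ (begin
            # (elems arm ∩ D) + 1 ≤⟨ +-monoʳ-≤ _ (#-pos {A = ｛ core ｝} {u = core} (into refl)) ⟩
            # (elems arm ∩ D) + # ｛ core ｝ ≤⟨ #-pack sub₁ sub₂ (λ p q → core∉arm (subst (_∈ᴸ arm) (outof q) (outof (proj₁ (outof p))))) ⟩
            # (elems P.path ∩ Ball Z ｛ core ｝ 1) ≤⟨ P.near-start 1 ⟩
            2 ∎)
            where
            open ≤-Reasoning
            at-core : core ∈ Ball Z ｛ core ｝ 0
            at-core = into (into refl , core∉Z)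
            sub₁ : (elems arm ∩ D) ⊆ (elems P.path ∩ Ball Z ｛ core ｝ 1)
            sub₁ p = let (a , d) = outof p in into (into (subst (_ ∈ᴸ_) (sym shape) (there (outof a))) , ball-nb 0 at-core (holds (D⊆ d)) (clear (outof a)))
            sub₂ : ｛ core ｝ ⊆ (elems P.path ∩ Ball Z ｛ core ｝ 1)
            sub₂ p = into (into (subst (_ ∈ᴸ_) (sym shape) (here (outof p))) , subst (_∈ Ball Z ｛ core ｝ 1) (sym (outof p)) (ball-suc 0 at-core))

          avoids⁺ : ∀ {x} → x ∈ Frame.foot K ⊎ (x ∈ᴸ arm ⊎ x ∈ Hub.L hub) → ¬ x ∈ U
          avoids⁺ (inj₁ p) = avoids p
          avoids⁺ (inj₂ (inj₁ p)) q = clear p (∪ˡ q)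
          avoids⁺ (inj₂ (inj₂ p)) q = Hub.L∉F hub p (∪ˡ (∪ˡ (∪ˡ q)))

          thin⁺ : # (Frame.on-arms frame⁺ ∩ D) ≤ suc c
          thin⁺ = ≤-trans (#-cover {A = Frame.on-arms frame⁺ ∩ D} {B = on-arms ∩ D} {C = elems arm ∩ D} λ p → case (arms-case (proj₁ (outof p))) (proj₂ (outof p)))
              (≤-trans (+-mono-≤ thin new-D) (≤-reflexive (+-comm c 1)))
            where
            case : ∀ {x} → x ∈ on-arms ⊎ x ∈ᴸ arm → x ∈ D → x ∈ (on-arms ∩ D) ⊎ x ∈ (elems arm ∩ D)
            case (inj₁ a) d = inj₁ (into (a , d))
            case (inj₂ a) d = inj₂ (into (into a , d))

          off⁺ : ∀ {x} → x ∈ L⁺ → ¬ x ∈ D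
          off⁺ = ∪-elim off (λ l d → Hub.L∉F hub l (∪ʳ (∪ˡ d)))

          stage⁺ : Stage (suc c)
          stage⁺ = record { frame = frame⁺ ; same-core = same ; avoids = λ p → avoids⁺ (foot-case p) ; arms-thin = thin⁺ ; layer-off = off⁺ }

        next : Stage (suc c)
        next = go₁ target
          where
          go₁ : (Σ VH λ u → u ∈ Ball Z ｛ core ｝ ℓ × ¬ u ∈ (Bad (F ∪ Bad F) ∪ ｛ core ｝)) → Stage (suc c)
          go₁ (u , u∈ , u∉) = go₂ (ball-meet {Z} {｛ u ｝} {｛ core ｝} 0 ℓ (into (into refl , ball-avoid ℓ u∈)) u∈)
            where
            go₃ : GeoPath Z ｛ u ｝ ｛ core ｝ ℓ → Stage (suc c)
            go₃ P = let (xs , shape) = between (GeoPath.from-start P) (GeoPath.to-fin P) (outof (GeoPath.start∈ P)) (outof (GeoPath.fin∈ P))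
                          (λ e → u∉ (∪ʳ (into (sym e))))
                    in Along.stage⁺ u (λ p → u∉ (∪ˡ p)) P xs shape
            go₂ : (Σ VH λ y → y ∈ ｛ core ｝ × y ∈ Ball Z ｛ u ｝ ℓ) → Stage (suc c)
            go₂ (y , y∈ , b) = go₃ (geodesic ℓ b y∈)

      stages : ∀ c → c ≤ 2 * m → Stage c
      stages zero _ = stage₀
      stages (suc c) lt = go (stages c (<⇒≤ lt))
        where
        go : Stage c → Stage (suc c)
        go K = Step.next lt (Stage.frame K) (Stage.same-core K) (Stage.avoids K) (Stage.arms-thin K) (Stage.layer-off K)

    opaque
      units : (∀ U → # U ≤ f → Healthy U) → m * (1 + (2 * m * ℓ + 2 * m * h)) ≤ f →
        Σ (Fin m → Frame (2 * m)) λ K → ∀ i j → j F.< i → ∀ {x} → x ∈ Frame.foot (K j) → ¬ x ∈ Frame.foot (K i)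
      units health le = greedy Frame.foot (λ U K → ∀ {x} → x ∈ Frame.foot K → ¬ x ∈ U) (1 + (2 * m * ℓ + 2 * m * h)) f
          Frame.foot-size (λ U⊆ ok p q → ok p (U⊆ q)) pick m le
        where
        pick : ∀ U → # U ≤ f → Σ (Frame (2 * m)) λ K → ∀ {x} → x ∈ Frame.foot K → ¬ x ∈ U
        pick U U≤ = let K = Build.stages U U≤ (health U U≤) (2 * m) ≤-refl in Build.Stage.frame K , Build.Stage.avoids K

-- Linking the units

module ListPaths (H : Graph) where
  open Walks H

  walk-join : ∀ xs {a : VH} {ys} → AdjWalk H (xs ++ [ a ]) → AdjWalk H (a ∷ ys) → AdjWalk H (xs ++ a ∷ ys)
  walk-join [] _ w = w
  walk-join (x ∷ []) (e , _) w = e , w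
  walk-join (x ∷ z ∷ xs) (e , es) w = e , walk-join (z ∷ xs) es w

  walk-reverse : ∀ (xs : List VH) → AdjWalk H xs → AdjWalk H (reverse xs)
  walk-reverse [] _ = tt
  walk-reverse (x ∷ []) _ = tt
  walk-reverse (x ∷ y ∷ xs) (e , w) = subst (AdjWalk H) (sym (trans (unfold-reverse x (y ∷ xs)) (cong (_++ [ x ]) (unfold-reverse y xs))))
    (AdjWalk-snoc H (reverse xs) (subst (AdjWalk H) (unfold-reverse y xs) (walk-reverse (y ∷ xs) w)) (edge-sym e))

  unique-reverse : ∀ (xs : List VH) → Unique xs → Unique (reverse xs)
  unique-reverse [] u = []
  unique-reverse (x ∷ xs) (all ∷ u) = subst Unique (sym (unfold-reverse x xs))
    (Uniqueₚ.++⁺ (unique-reverse xs u) (All.[] ∷ []) λ { (p , here refl) → All.lookup all (reverse⁻ p) refl })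

  unique-snoc : ∀ {xs : List VH} {y} → Unique xs → ¬ y ∈ᴸ xs → Unique (xs ++ [ y ])
  unique-snoc u y∉ = Uniqueₚ.++⁺ u (All.[] ∷ []) λ { (p , here refl) → y∉ p }

  -- Two arms, walked outwards and inwards, joined by a middle path.
  module Concat (v v' y y' : VH) (as as' path rest init : List VH) (z z' : VH)
    (path-start : path ≡ z ∷ rest) (path-end : path ≡ init ++ [ z' ])
    (w : AdjWalk H (v ∷ as ++ [ y ])) (w' : AdjWalk H (v' ∷ as' ++ [ y' ])) (wp : AdjWalk H path)
    (yz : Edge H y z) (yz' : Edge H y' z')
    (u : Unique (v ∷ as)) (y∉ : ¬ y ∈ᴸ (v ∷ as)) (u' : Unique (v' ∷ as')) (y'∉ : ¬ y' ∈ᴸ (v' ∷ as')) (up : Unique path)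
    (apart : ∀ {x} → x ∈ᴸ (v ∷ as ++ [ y ]) → x ∈ᴸ (v' ∷ as' ++ [ y' ]) → ⊥)
    (clear : ∀ {x} → x ∈ᴸ (v ∷ as ++ [ y ]) → x ∈ᴸ path → ⊥)
    (clear' : ∀ {x} → x ∈ᴸ (v' ∷ as' ++ [ y' ]) → x ∈ᴸ path → ⊥) where

    back inner : List VH
    back = y' ∷ reverse as' ++ [ v' ]
    inner = as ++ y ∷ path ++ y' ∷ reverse as'

    back-reverse : back ≡ reverse (v' ∷ as' ++ [ y' ])
    back-reverse = sym (trans (unfold-reverse v' (as' ++ [ y' ])) (cong (_++ [ v' ]) (reverse-++ as' [ y' ])))

    inner-shape : inner ++ [ v' ] ≡ as ++ y ∷ path ++ back
    inner-shape = trans (++-assoc as _ _) (cong (λ l → as ++ y ∷ l) (++-assoc path (y' ∷ reverse as') [ v' ]))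

    outer-shape : (v ∷ as ++ [ y ]) ++ path ++ back ≡ v ∷ inner ++ [ v' ]
    outer-shape = cong (v ∷_) (trans (++-assoc as [ y ] (path ++ back)) (sym inner-shape))

    walk-back : AdjWalk H back
    walk-back = subst (AdjWalk H) (sym back-reverse) (walk-reverse _ w')

    walk-mid : AdjWalk H (path ++ back)
    walk-mid = subst (λ l → AdjWalk H (l ++ back)) (sym path-end) (subst (AdjWalk H) (sym (++-assoc init [ z' ] back))
      (walk-join init (subst (AdjWalk H) path-end wp) (edge-sym yz' , walk-back)))

    walk-all : AdjWalk H (v ∷ inner ++ [ v' ])
    walk-all = subst (λ l → AdjWalk H (v ∷ l)) (sym inner-shape)
      (walk-join (v ∷ as) w (subst (λ l → AdjWalk H (y ∷ l ++ back)) (sym path-start)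
        (yz , subst (λ l → AdjWalk H (l ++ back)) path-start walk-mid)))

    in-back : ∀ {x} → x ∈ᴸ back → x ∈ᴸ (v' ∷ as' ++ [ y' ])
    in-back p = reverse⁻ (subst (_ ∈ᴸ_) back-reverse p)

    unique-all : Unique (v ∷ inner ++ [ v' ])
    unique-all = subst Unique outer-shape
      (Uniqueₚ.++⁺ (unique-snoc u y∉) (Uniqueₚ.++⁺ up (subst Unique (sym back-reverse) (unique-reverse _ (unique-snoc u' y'∉)))
          (λ (p , p') → clear' (in-back p') p))
        (λ (p , p') → [ clear p , (λ q → apart p (in-back q)) ]′ (∈-++⁻ path p')))

    inner-parts : ∀ {x} → x ∈ᴸ inner → (x ∈ᴸ as ⊎ x ≡ y) ⊎ (x ∈ᴸ path ⊎ (x ∈ᴸ as' ⊎ x ≡ y'))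
    inner-parts p = [ (λ q → inj₁ (inj₁ q)) , at-y ]′ (∈-++⁻ as p)
      where
      at-y' : ∀ {x} → x ∈ᴸ (y' ∷ reverse as') → x ∈ᴸ as' ⊎ x ≡ y'
      at-y' (here e) = inj₂ e
      at-y' (there q) = inj₁ (reverse⁻ q)
      at-y : ∀ {x} → x ∈ᴸ (y ∷ path ++ y' ∷ reverse as') → (x ∈ᴸ as ⊎ x ≡ y) ⊎ (x ∈ᴸ path ⊎ (x ∈ᴸ as' ⊎ x ≡ y'))
      at-y (here e) = inj₁ (inj₂ e)
      at-y (there q) = inj₂ ([ inj₁ , (λ r → inj₂ (at-y' r)) ]′ (∈-++⁻ path q))

    inner-length : length inner ≡ (length as + 1) + (length path + (length as' + 1))
    inner-length = trans (length-++ as) (trans (cong (length as +_) (cong suc (length-++ path)))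
      (trans (c (length as) (length path) (length (reverse as'))) (cong (λ k → (length as + 1) + (length path + (k + 1))) (length-reverse as'))))
      where
      c : ∀ a b d → a + suc (b + suc d) ≡ (a + 1) + (b + (d + 1))
      c = solve-∀

module DenseLinking (X : Setting) where
  open Core X

  module _ (m h ℓ T B M x z : ℕ) (T-def : Λ * (2 * w) ≡ T)
    (M-def : suc (T + T) ≡ M) (B≥ : (ℓ + 1) + (M + (ℓ + 1)) ≤ B)
    (z≥ : (m * (m * B) + m * (1 + 2 * m * ℓ)) + ((2 * m * h + 2 * m * h) + 4 * (m * (m * M))) ≤ z)
    (k≤x : k ≤ x) (z≤x : 2 * w * z ≤ x) (roomy : 4 * (x + z) + 4 * (m * M) ≤ m * (2 * (m * h)))
    (K : Fin m → Frames.Frame X m h ℓ (2 * m))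
    (apart : ∀ {i j} → i ≢ j → ∀ {u} → u ∈ Frames.Frame.foot (K i) → u ∈ Frames.Frame.foot (K j) → ⊥) where
    open Frames X m h ℓ
    open Hubs X using (leaves)
    open ListPaths H

    module Fr (i : Fin m) = Frame (K i)

    v : Fin m → VH
    v i = Fr.core i

    core-foot : ∀ i → v i ∈ Fr.foot i
    core-foot i = ∪ˡ (into refl)

    arm-foot : ∀ i {a u} → a < 2 * m → u ∈ᴸ Fr.arms i a → u ∈ Fr.foot i
    arm-foot i lt p = ∪ʳ (∪ˡ (Fr.on-arms-in i _ lt p))

    layer-foot : ∀ i {u} → u ∈ Fr.layer i → u ∈ Fr.foot i
    layer-foot i p = ∪ʳ (∪ʳ p)

    spine-foot : ∀ i {u} → u ∈ Fr.spine i → u ∈ Fr.foot i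
    spine-foot i = ∪-elim ∪ˡ (λ p → ∪ʳ (∪ˡ p))

    same-foot : ∀ {i j u} → u ∈ Fr.foot i → u ∈ Fr.foot j → i ≡ j
    same-foot {i} {j} p q = go (i ≟F j)
      where
      go : Dec (i ≡ j) → i ≡ j
      go (yes e) = e
      go (no ne) = ⊥-elim (apart ne p q)

    v-inj : Injective _≡_ _≡_ v
    v-inj {i} {j} e = same-foot (core-foot i) (subst (_∈ Fr.foot j) (sym e) (core-foot j))

    open Linkages H v v-inj
    open Linkage

    -- The part of unit i used by a path leaving along arm a.
    Own : Fin m → ℕ → VH → Set
    Own i a u = (a < 2 * m × u ∈ᴸ Fr.arms i a) ⊎ (u ∈ Fr.layer i × Fr.idx i u ≡ a)

    own-foot : ∀ i {a u} → Own i a u → u ∈ Fr.foot i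
    own-foot i (inj₁ (lt , p)) = arm-foot i lt p
    own-foot i (inj₂ (p , _)) = layer-foot i p

    -- mid i j is the stretch of the path from i to j between the leaves of the two units, and port i j the arm of
    -- unit i that it uses.  A layer of which a quarter is hit joins the obstacles, which is what bounds hits.
    record State : Set where
      field
        links : Linkage
        mid : Fin m → Fin m → List VH
        port : Fin m → Fin m → ℕ

      mids : SubH
      mids = ⋃ (λ i → ⋃ (λ j → elems (mid i j)))

      field
        ordered : ∀ i j {u} → u ∈ᴸ inner links i j → i F.< j
        len : ∀ i j → length (inner links i j) ≤ B
        mid-len : ∀ i j → length (mid i j) ≤ M
        mid-off : ∀ i j {u} → u ∈ᴸ mid i j → ∀ l → ¬ u ∈ Fr.spine l
        parts : ∀ i j {u} → u ∈ᴸ inner links i j → u ∈ᴸ mid i j ⊎ (Own i (port i j) u ⊎ Own j (port j i) u)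
        hits : ∀ l → 4 * # (mids ∩ Fr.layer l) ≤ # (Fr.layer l) + 4 * M

      mids-in : ∀ i j {u} → u ∈ᴸ mid i j → u ∈ mids
      mids-in i j p = into (i , into (j , into p))

      mids-size : # mids ≤ m * (m * M)
      mids-size = #-⋃ _ (λ i → #-⋃ (λ j → elems (mid i j)) (λ j → ≤-trans (#-elems _) (mid-len i j)))

      overhit? : (l : Fin m) → Dec (# (Fr.layer l) ≤ 4 * # (mids ∩ Fr.layer l))
      overhit? l = _ ≤? _

      spines over : SubH
      spines = ⋃ Fr.spine
      over = set (λ u → any? (λ l → overhit? l ×-dec (u ∈? Fr.layer l)))

      obstacle : Fin m → Fin m → SubH
      obstacle i j = (used links ∪ spines) ∪ ((Fr.layer i ∪ Fr.layer j) ∪ over)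

      survivors : Fin m → SubH
      survivors e = set (λ y → (y ∈? Fr.layer e) ×-dec (¬? (y ∈? mids) ×-dec ¬? (any? (λ b → Fr.idx e y ≟ port e b))))

      exits : Fin m → SubH
      exits e = leaves (survivors e) (Fr.E e)

      -- All layers together have 2m²h vertices, as many as one unit has leaves, so they cannot all
      -- be forbidden. An overhit layer is at most four times as large as its set of hits, and hits
      -- in different layers are distinct vertices of middle stretches.
      over-size : # over ≤ 4 * (m * (m * M))
      over-size = begin
        # over ≤⟨ #-sup part over (λ p → let (l , o , q) = outof p in l , into (o , q)) ⟩
        ∑ (λ l → # (part l)) ≤⟨ ∑-mono each ⟩
        ∑ (λ l → 4 * # (mids ∩ Fr.layer l)) ≡⟨ ∑-* 4 _ ⟩
        4 * ∑ (λ l → # (mids ∩ Fr.layer l)) ≤⟨ *-monoʳ-≤ 4 (#-disjoint (λ l → mids ∩ Fr.layer l) mids (λ l p → proj₁ (outof p))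
            (λ {l} {l'} p q → same-foot (layer-foot l (proj₂ (outof p))) (layer-foot l' (proj₂ (outof q))))) ⟩
        4 * # mids ≤⟨ *-monoʳ-≤ 4 mids-size ⟩
        4 * (m * (m * M)) ∎
        where
        open ≤-Reasoning
        part : Fin m → SubH
        part l = set (λ u → overhit? l ×-dec (u ∈? Fr.layer l))
        each : ∀ l → # (part l) ≤ 4 * # (mids ∩ Fr.layer l)
        each l = go (overhit? l)
          where
          go : Dec (# (Fr.layer l) ≤ 4 * # (mids ∩ Fr.layer l)) → # (part l) ≤ 4 * # (mids ∩ Fr.layer l)
          go (yes o) = ≤-trans (#-mono {A = part l} {B = Fr.layer l} λ p → proj₂ (outof p)) o
          go (no ¬o) = ≤-trans (≤-reflexive (#-empty {A = part l} λ p → ¬o (proj₁ (outof p)))) z≤n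

      obstacle-size : ∀ i j → # (obstacle i j) ≤ z
      obstacle-size i j = ≤-trans (≤-trans (#-∪ _ _) (+-mono-≤
          (≤-trans (#-∪ _ _) (+-mono-≤ (used-size links len) (#-⋃ Fr.spine Fr.spine-size)))
          (≤-trans (#-∪ _ _) (+-mono-≤ (≤-trans (#-∪ _ _) (+-mono-≤ (Fr.layer≤ i) (Fr.layer≤ j))) over-size)))) z≥

      -- At most m of the 2m arms serve as ports, and at most a quarter of the layer plus M is hit,
      -- so mh/2 - M layer vertices survive. Hence twice as many arms as partners.
      survivors-many : ∀ e → 2 * (m * h) ≤ 4 * # (survivors e) + 4 * M
      survivors-many e = +-cancelʳ-≤ (L + 4 * (m * h)) _ _ (begin
        2 * (m * h) + (L + 4 * (m * h)) ≡⟨ c₁ m h L ⟩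
        L + 3 * (2 * m * h) ≤⟨ +-monoʳ-≤ L (*-monoʳ-≤ 3 (Fr.layer≥ e)) ⟩
        L + 3 * L ≤⟨ *-monoʳ-≤ 4 count ⟩
        4 * (# (survivors e) + (# (mids ∩ Fr.layer e) + m * h)) ≡⟨ c₂ (# (survivors e)) (# (mids ∩ Fr.layer e)) (m * h) ⟩
        4 * # (survivors e) + (4 * # (mids ∩ Fr.layer e) + 4 * (m * h)) ≤⟨ +-monoʳ-≤ (4 * # (survivors e)) (+-monoˡ-≤ (4 * (m * h)) (hits e)) ⟩
        4 * # (survivors e) + ((L + 4 * M) + 4 * (m * h)) ≡⟨ c₃ (4 * # (survivors e)) L (4 * M) (4 * (m * h)) ⟩
        (4 * # (survivors e) + 4 * M) + (L + 4 * (m * h)) ∎)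
        where
        open ≤-Reasoning
        L : ℕ
        L = # (Fr.layer e)
        c₁ : ∀ m h L → 2 * (m * h) + (L + 4 * (m * h)) ≡ L + 3 * (2 * m * h)
        c₁ = solve-∀
        c₂ : ∀ a b c → 4 * (a + (b + c)) ≡ 4 * a + (4 * b + 4 * c)
        c₂ = solve-∀
        c₃ : ∀ a b c d → a + ((b + c) + d) ≡ (a + c) + (b + d)
        c₃ = solve-∀
        busy : SubH
        busy = ⋃ (λ b → set (λ y → (y ∈? Fr.layer e) ×-dec (Fr.idx e y ≟ port e b)))
        sub : ∀ {y} → y ∈ Fr.layer e → y ∈ survivors e ⊎ y ∈ ((mids ∩ Fr.layer e) ∪ busy)
        sub {y} p = go (y ∈? mids) (any? (λ b → Fr.idx e y ≟ port e b))
          where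
          go : Dec (y ∈ mids) → Dec (Σ (Fin m) λ b → Fr.idx e y ≡ port e b) → y ∈ survivors e ⊎ y ∈ ((mids ∩ Fr.layer e) ∪ busy)
          go (yes q) _ = inj₂ (∪ˡ (into (q , p)))
          go (no _) (yes (b , q)) = inj₂ (∪ʳ (into (b , into (p , q))))
          go (no q) (no r) = inj₁ (into (p , q , r))
        count : L ≤ # (survivors e) + (# (mids ∩ Fr.layer e) + m * h)
        count = ≤-trans (#-cover sub) (+-monoʳ-≤ _ (≤-trans (#-∪ _ _) (+-monoʳ-≤ _ (#-⋃ _ (λ b → Fr.fibre≤ e (port e b))))))

      survivor-layer : ∀ e {y} → y ∈ survivors e → y ∈ Fr.layer e
      survivor-layer e p = proj₁ (outof p)

      exits-size : ∀ e → m * # (survivors e) ≤ # (exits e)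
      exits-size e = ≤-trans (≤-reflexive (sym (∑-* m _))) (≤-trans (∑-mono each)
          (#-disjoint part (exits e) (λ y p → let (q , r) = outof p in into (y , q , r))
            (λ p q → let (p₁ , p₂) = outof p ; (q₁ , q₂) = outof q in Fr.E-sep e (survivor-layer e p₁) (survivor-layer e q₁) p₂ q₂)))
        where
        part : VH → SubH
        part y = set (λ u → (y ∈? survivors e) ×-dec (u ∈? Fr.E e y))
        each : ∀ y → m * ind (survivors e y) ≤ # (part y)
        each y = go (y ∈? survivors e)
          where
          go : Dec (y ∈ survivors e) → m * ind (survivors e y) ≤ # (part y)
          go (yes p) = ≤-trans (≤-reflexive (trans (trans (cong (m *_) (ind-in p)) (*-identityʳ m)) (sym (Fr.E-size e (survivor-layer e p)))))
            (#-mono {A = Fr.E e y} {B = part y} (λ q → into (p , q)))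
          go (no ¬p) = ≤-trans (≤-reflexive (trans (cong (m *_) (ind-out ¬p)) (*-zeroʳ m))) z≤n

      exits-many : ∀ e → x + z ≤ # (exits e)
      exits-many e = *-cancelˡ-≤ 4 (+-cancelʳ-≤ (4 * (m * M)) _ _ (begin
        4 * (x + z) + 4 * (m * M) ≤⟨ roomy ⟩
        m * (2 * (m * h)) ≤⟨ *-monoʳ-≤ m (survivors-many e) ⟩
        m * (4 * # (survivors e) + 4 * M) ≡⟨ c m (# (survivors e)) M ⟩
        4 * (m * # (survivors e)) + 4 * (m * M) ≤⟨ +-monoˡ-≤ (4 * (m * M)) (*-monoʳ-≤ 4 (exits-size e)) ⟩
        4 * # (exits e) + 4 * (m * M) ∎))
        where
        open ≤-Reasoning
        c : ∀ m y M → m * (4 * y + 4 * M) ≡ 4 * (m * y) + 4 * (m * M)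
        c = solve-∀

      wide : ∀ i j e → n H < 2 * # (Ball (obstacle i j) (exits e) T)
      wide i j e = subst (λ r → n H < 2 * # (Ball (obstacle i j) (exits e) r)) T-def (spread 0 x k≤x start
          (≤-trans (*-monoʳ-≤ (2 * w) (obstacle-size i j)) z≤x))
        where
        start : x ≤ # (exits e ∖ obstacle i j)
        start = +-cancelʳ-≤ z _ _ (≤-trans (exits-many e) (≤-trans (#-∖ (exits e) (obstacle i j)) (+-monoʳ-≤ _ (obstacle-size i j))))

      joining : ∀ i j → GeoPath (obstacle i j) (exits j) (exits i) (T + T)
      joining i j = let (u , p , q) = both-ways (wide i j j) (wide i j i) ; (y , y∈ , b) = ball-meet T T p q in geodesic (T + T) b y∈

    upd-other : {A : Set} (f : Fin m → Fin m → A) (i j : Fin m) (y : A) (a b : Fin m) → ¬ (a ≡ i × b ≡ j) → upd f i j y a b ≡ f a b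
    upd-other f i j y a b ne = go (upd-view f i j y a b)
      where
      go : (a ≡ i × b ≡ j × upd f i j y a b ≡ y) ⊎ (upd f i j y a b ≡ f a b) → upd f i j y a b ≡ f a b
      go (inj₁ (p , p' , _)) = ⊥-elim (ne (p , p'))
      go (inj₂ e) = e

    module Join (st : State) (i j : Fin m) (i<j : i F.< j) (undone : done (State.links st) i j ≡ false)
      (P : GeoPath (State.obstacle st i j) (State.exits st j) (State.exits st i) (T + T))
      (y y' : VH) (y∈ : y ∈ State.survivors st i) (y'∈ : y' ∈ State.survivors st j)
      (z∈ : GeoPath.start P ∈ Fr.E i y) (z'∈ : GeoPath.fin P ∈ Fr.E j y') where
      open State st
      module P = GeoPath P

      Z : SubH
      Z = obstacle i j

      i≢j : i ≢ j
      i≢j refl = <-irrefl refl i<j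

      -- A recorded path owns vertices of a unit only along its port there. The arm of a survivor
      -- differs from every port, and arms are disjoint from each other and from the layer.
      clash : ∀ e {y u} → y ∈ survivors e → u ∈ᴸ Fr.arms e (Fr.idx e y) ⊎ u ≡ y → ∀ a b → Own a (port a b) u → ⊥
      clash e {y} {u} p here-u a b o = go same here-u o
        where
        lay : y ∈ Fr.layer e
        lay = survivor-layer e p
        free-port : ¬ (Σ (Fin m) λ b → Fr.idx e y ≡ port e b)
        free-port = proj₂ (proj₂ (outof p))
        in-foot : u ∈ᴸ Fr.arms e (Fr.idx e y) ⊎ u ≡ y → u ∈ Fr.foot e
        in-foot (inj₁ q) = arm-foot e (Fr.idx< e lay) q
        in-foot (inj₂ refl) = layer-foot e lay
        same : a ≡ e
        same = same-foot (own-foot a o) (in-foot here-u)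
        go : a ≡ e → u ∈ᴸ Fr.arms e (Fr.idx e y) ⊎ u ≡ y → Own a (port a b) u → ⊥
        go refl (inj₁ q) (inj₁ (lt , r)) = free-port (b , Fr.arm-sep e _ _ (Fr.idx< e lay) lt q r)
        go refl (inj₁ q) (inj₂ (r , _)) = Fr.layer-arm e r _ (Fr.idx< e lay) q
        go refl (inj₂ refl) (inj₁ (lt , r)) = Fr.layer-arm e lay _ lt r
        go refl (inj₂ refl) (inj₂ (_ , eq)) = free-port (b , eq)

      fresh-unit : ∀ e {y u} → y ∈ survivors e → u ∈ᴸ Fr.arms e (Fr.idx e y) ⊎ u ≡ y → ¬ u ∈ used links
      fresh-unit e {y} {u} p here-u q = let (a , b , r) = outof q in go a b here-u (parts a b (outof r))
        where
        go : ∀ a b → u ∈ᴸ Fr.arms e (Fr.idx e y) ⊎ u ≡ y → u ∈ᴸ mid a b ⊎ (Own a (port a b) u ⊎ Own b (port b a) u) → ⊥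
        go a b (inj₁ r) (inj₁ s) = mid-off a b s e (∪ʳ (Fr.on-arms-in e _ (Fr.idx< e (survivor-layer e p)) r))
        go a b (inj₂ refl) (inj₁ s) = proj₁ (proj₂ (outof p)) (mids-in a b s)
        go a b r (inj₂ (inj₁ o)) = clash e p r a b o
        go a b r (inj₂ (inj₂ o)) = clash e p r b a o

      not-core : ∀ e {y u} → y ∈ Fr.layer e → u ∈ᴸ Fr.arms e (Fr.idx e y) ⊎ u ≡ y → ∀ l → u ≢ v l
      not-core e {y} {u} lay (inj₁ q) l refl = go (same-foot (arm-foot e (Fr.idx< e lay) q) (core-foot l)) (Fr.uniq e _ (Fr.idx< e lay))
        where
        go : e ≡ l → Unique (v e ∷ Fr.arms e (Fr.idx e y)) → ⊥
        go refl (all ∷ _) = All.lookup all q refl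
      not-core e {y} {u} lay (inj₂ refl) l eq =
        Fr.layer-core e lay (trans eq (cong v (sym (same-foot (layer-foot e lay) (subst (_∈ Fr.foot l) (sym eq) (core-foot l))))))

      ends : ∀ e {y u} → y ∈ Fr.layer e → u ∈ᴸ (v e ∷ Fr.arms e (Fr.idx e y) ++ [ y ]) → u ∈ Fr.spine e ⊎ u ≡ y
      ends e lay (here refl) = inj₁ (∪ˡ (into refl))
      ends e {y} {u} lay (there p) = go (∈-++⁻ (Fr.arms e (Fr.idx e y)) p)
        where
        go : u ∈ᴸ Fr.arms e (Fr.idx e y) ⊎ u ∈ᴸ [ y ] → u ∈ Fr.spine e ⊎ u ≡ y
        go (inj₁ q) = inj₁ (∪ʳ (Fr.on-arms-in e _ (Fr.idx< e lay) q))
        go (inj₂ (here e)) = inj₂ e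

      ends-foot : ∀ e {y u} → y ∈ Fr.layer e → u ∈ Fr.spine e ⊎ u ≡ y → u ∈ Fr.foot e
      ends-foot e lay (inj₁ p) = spine-foot e p
      ends-foot e lay (inj₂ refl) = layer-foot e lay

      spine-Z : ∀ e {u} → u ∈ Fr.spine e → u ∈ Z
      spine-Z e p = ∪ˡ (∪ʳ (into (e , p)))

      layer-Z : ∀ e {u} → e ≡ i ⊎ e ≡ j → u ∈ Fr.layer e → u ∈ Z
      layer-Z e (inj₁ refl) p = ∪ʳ (∪ˡ (∪ˡ p))
      layer-Z e (inj₂ refl) p = ∪ʳ (∪ˡ (∪ʳ p))

      ends-Z : ∀ e {y u} → e ≡ i ⊎ e ≡ j → y ∈ Fr.layer e → u ∈ Fr.spine e ⊎ u ≡ y → u ∈ Z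
      ends-Z e ij lay (inj₁ p) = spine-Z e p
      ends-Z e ij lay (inj₂ refl) = layer-Z e ij lay

      lay : y ∈ Fr.layer i
      lay = survivor-layer i y∈
      lay' : y' ∈ Fr.layer j
      lay' = survivor-layer j y'∈

      head-free : ∀ e {y} → y ∈ Fr.layer e → ¬ y ∈ᴸ (v e ∷ Fr.arms e (Fr.idx e y))
      head-free e lay (here eq) = Fr.layer-core e lay eq
      head-free e lay (there p) = Fr.layer-arm e lay _ (Fr.idx< e lay) p

      module C = Concat (v i) (v j) y y' (Fr.arms i (Fr.idx i y)) (Fr.arms j (Fr.idx j y')) P.path P.rest P.init P.start P.fin
        P.from-start P.to-fin (Fr.walk i lay) (Fr.walk j lay') P.walk (holds (Fr.E⊆ i lay z∈)) (holds (Fr.E⊆ j lay' z'∈))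
        (Fr.uniq i _ (Fr.idx< i lay)) (head-free i lay) (Fr.uniq j _ (Fr.idx< j lay')) (head-free j lay') P.unique
        (λ p q → apart i≢j (ends-foot i lay (ends i lay p)) (ends-foot j lay' (ends j lay' q)))
        (λ p q → P.avoid q (ends-Z i (inj₁ refl) lay (ends i lay p)))
        (λ p q → P.avoid q (ends-Z j (inj₂ refl) lay' (ends j lay' p)))

      valid : AdjWalk H (v i ∷ C.inner ++ [ v j ]) × Unique (v i ∷ C.inner ++ [ v j ])
      valid = C.walk-all , C.unique-all

      off : ∀ {u} → u ∈ᴸ C.inner → ∀ l → u ≢ v l
      off p = go (C.inner-parts p)
        where
        go : ∀ {u} → (u ∈ᴸ Fr.arms i (Fr.idx i y) ⊎ u ≡ y) ⊎ (u ∈ᴸ P.path ⊎ (u ∈ᴸ Fr.arms j (Fr.idx j y') ⊎ u ≡ y')) → ∀ l → u ≢ v l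
        go (inj₁ q) = not-core i lay q
        go (inj₂ (inj₁ q)) l refl = P.avoid q (spine-Z l (∪ˡ (into refl)))
        go (inj₂ (inj₂ q)) = not-core j lay' q

      unused : ∀ {u} → u ∈ᴸ C.inner → ¬ u ∈ used links
      unused p = go (C.inner-parts p)
        where
        go : ∀ {u} → (u ∈ᴸ Fr.arms i (Fr.idx i y) ⊎ u ≡ y) ⊎ (u ∈ᴸ P.path ⊎ (u ∈ᴸ Fr.arms j (Fr.idx j y') ⊎ u ≡ y')) → ¬ u ∈ used links
        go (inj₁ q) = fresh-unit i y∈ q
        go (inj₂ (inj₁ q)) r = P.avoid q (∪ˡ (∪ˡ r))
        go (inj₂ (inj₂ q)) = fresh-unit j y'∈ q

      open Link links i j undone C.inner valid off unused

      mid⁺ : Fin m → Fin m → List VH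
      mid⁺ = upd mid i j P.path

      port⁺ : Fin m → Fin m → ℕ
      port⁺ = upd (upd port i j (Fr.idx i y)) j i (Fr.idx j y')

      port-i : port⁺ i j ≡ Fr.idx i y
      port-i = trans (upd-other _ j i _ i j (λ (e , _) → i≢j e)) (upd-same port i j _)

      port-j : port⁺ j i ≡ Fr.idx j y'
      port-j = upd-same _ j i _

      port-other : ∀ a b → ¬ (a ≡ i × b ≡ j) → ¬ (a ≡ j × b ≡ i) → port⁺ a b ≡ port a b
      port-other a b ne ne' = trans (upd-other _ j i _ a b ne') (upd-other port i j _ a b ne)

      mid-view : ∀ a b {u} → u ∈ᴸ mid⁺ a b → u ∈ᴸ P.path ⊎ u ∈ᴸ mid a b
      mid-view a b {u} p = go (upd-view mid i j P.path a b)
        where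
        go : (a ≡ i × b ≡ j × mid⁺ a b ≡ P.path) ⊎ (mid⁺ a b ≡ mid a b) → u ∈ᴸ P.path ⊎ u ∈ᴸ mid a b
        go (inj₁ (_ , _ , e)) = inj₁ (subst (u ∈ᴸ_) e p)
        go (inj₂ e) = inj₂ (subst (u ∈ᴸ_) e p)

      as-own : ∀ e {y u} → y ∈ Fr.layer e → u ∈ᴸ Fr.arms e (Fr.idx e y) ⊎ u ≡ y → Own e (Fr.idx e y) u
      as-own e lay (inj₁ p) = inj₁ (Fr.idx< e lay , p)
      as-own e lay (inj₂ refl) = inj₂ (lay , refl)

      parts-new : ∀ {u} → (u ∈ᴸ Fr.arms i (Fr.idx i y) ⊎ u ≡ y) ⊎ (u ∈ᴸ P.path ⊎ (u ∈ᴸ Fr.arms j (Fr.idx j y') ⊎ u ≡ y')) →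
        u ∈ᴸ mid⁺ i j ⊎ (Own i (port⁺ i j) u ⊎ Own j (port⁺ j i) u)
      parts-new {u} (inj₁ q) = inj₂ (inj₁ (subst (λ a → Own i a u) (sym port-i) (as-own i lay q)))
      parts-new {u} (inj₂ (inj₁ q)) = inj₁ (subst (u ∈ᴸ_) (sym (upd-same mid i j P.path)) q)
      parts-new {u} (inj₂ (inj₂ q)) = inj₂ (inj₂ (subst (λ a → Own j a u) (sym port-j) (as-own j lay' q)))

      -- The ports changed are those at (i, j) and (j, i). An old nonempty path has neither index
      -- pair: the first was still empty by `fresh`, and the second is reversed, against `ordered`.
      parts-old : ∀ a b {u} → u ∈ᴸ inner links a b → u ∈ᴸ mid⁺ a b ⊎ (Own a (port⁺ a b) u ⊎ Own b (port⁺ b a) u)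
      parts-old a b {u} p = go (parts a b p)
        where
        absent : ∀ {u} → u ∈ᴸ [] → ⊥
        absent ()
        a<b : a F.< b
        a<b = ordered a b p
        new-pair : ¬ (a ≡ i × b ≡ j)
        new-pair (refl , refl) = absent (subst (u ∈ᴸ_) (fresh links i j undone) p)
        turned : ∀ {a' b'} → a' F.< b' → ¬ (a' ≡ j × b' ≡ i)
        turned lt (refl , refl) = <-asym lt i<j
        turned' : ∀ {a' b'} → a' F.< b' → ¬ (b' ≡ i × a' ≡ j)
        turned' lt (refl , refl) = <-asym lt i<j
        go : u ∈ᴸ mid a b ⊎ (Own a (port a b) u ⊎ Own b (port b a) u) → u ∈ᴸ mid⁺ a b ⊎ (Own a (port⁺ a b) u ⊎ Own b (port⁺ b a) u)
        go (inj₁ q) = inj₁ (subst (u ∈ᴸ_) (sym (upd-other mid i j P.path a b new-pair)) q)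
        go (inj₂ (inj₁ o)) = inj₂ (inj₁ (subst (λ c → Own a c u) (sym (port-other a b new-pair (turned a<b))) o))
        go (inj₂ (inj₂ o)) = inj₂ (inj₂ (subst (λ c → Own b c u)
          (sym (port-other b a (turned' a<b) (λ (e , e') → new-pair (e' , e)))) o))

      mids⁺ : SubH
      mids⁺ = ⋃ (λ a → ⋃ (λ b → elems (mid⁺ a b)))

      mids⁺⊆ : ∀ {u} → u ∈ mids⁺ → u ∈ᴸ P.path ⊎ u ∈ mids
      mids⁺⊆ p = let (a , q) = outof p ; (b , r) = outof q in [ inj₁ , (λ s → inj₂ (mids-in a b s)) ]′ (mid-view a b (outof r))

      path-len : length P.path ≤ M
      path-len = ≤-trans P.short (≤-reflexive M-def)

      -- A layer is hit anew only while it is no obstacle, so less than a quarter of it was hit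
      -- before, and the new stretch adds at most M. This is the slack `4 * M` in the invariant.
      hits⁺ : ∀ l → 4 * # (mids⁺ ∩ Fr.layer l) ≤ # (Fr.layer l) + 4 * M
      hits⁺ l = go (l ≟F i) (l ≟F j) (overhit? l)
        where
        untouched : (∀ {u} → u ∈ Fr.layer l → u ∈ Z) → 4 * # (mids⁺ ∩ Fr.layer l) ≤ # (Fr.layer l) + 4 * M
        untouched in-Z = ≤-trans (*-monoʳ-≤ 4 (#-mono {A = mids⁺ ∩ Fr.layer l} {B = mids ∩ Fr.layer l} λ p → let (q , r) = outof p in
          [ (λ s → ⊥-elim (P.avoid s (in-Z r))) , (λ s → into (s , r)) ]′ (mids⁺⊆ q))) (hits l)
        go : Dec (l ≡ i) → Dec (l ≡ j) → Dec (# (Fr.layer l) ≤ 4 * # (mids ∩ Fr.layer l)) → 4 * # (mids⁺ ∩ Fr.layer l) ≤ # (Fr.layer l) + 4 * M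
        go (yes e) _ _ = untouched (layer-Z l (inj₁ e))
        go (no _) (yes e) _ = untouched (layer-Z l (inj₂ e))
        go (no _) (no _) (yes o) = untouched (λ p → ∪ʳ (∪ʳ (into (l , o , p))))
        go (no _) (no _) (no ¬o) = begin
          4 * # (mids⁺ ∩ Fr.layer l) ≤⟨ *-monoʳ-≤ 4 (#-cover {A = mids⁺ ∩ Fr.layer l} {B = mids ∩ Fr.layer l} {C = elems P.path} λ p → let (q , r) = outof p in
              [ (λ s → inj₂ (into s)) , (λ s → inj₁ (into (s , r))) ]′ (mids⁺⊆ q)) ⟩
          4 * (# (mids ∩ Fr.layer l) + # (elems P.path)) ≡⟨ *-distribˡ-+ 4 (# (mids ∩ Fr.layer l)) (# (elems P.path)) ⟩
          4 * # (mids ∩ Fr.layer l) + 4 * # (elems P.path) ≤⟨ +-mono-≤ (<⇒≤ (≰⇒> ¬o)) (*-monoʳ-≤ 4 (≤-trans (#-elems P.path) path-len)) ⟩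
          # (Fr.layer l) + 4 * M ∎
          where open ≤-Reasoning

      inner-len : length C.inner ≤ B
      inner-len = ≤-trans (≤-reflexive C.inner-length) (≤-trans (+-mono-≤ (+-monoˡ-≤ 1 (Fr.len i _ (Fr.idx< i lay)))
        (+-mono-≤ path-len (+-monoˡ-≤ 1 (Fr.len j _ (Fr.idx< j lay'))))) B≥)

      upd-bound : ∀ (f : Fin m → Fin m → List VH) xs {c} → length xs ≤ c → (∀ a b → length (f a b) ≤ c) → ∀ a b → length (upd f i j xs a b) ≤ c
      upd-bound f xs {c} le le' a b = go (upd-view f i j xs a b)
        where
        go : (a ≡ i × b ≡ j × upd f i j xs a b ≡ xs) ⊎ (upd f i j xs a b ≡ f a b) → length (upd f i j xs a b) ≤ c
        go (inj₁ (_ , _ , e)) = ≤-trans (≤-reflexive (cong length e)) le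
        go (inj₂ e) = ≤-trans (≤-reflexive (cong length e)) (le' a b)

      state⁺ : State
      state⁺ = record { links = link ; mid = mid⁺ ; port = port⁺
        ; ordered = λ a b p → ordered⁺ a b (inner⁺-view a b p)
        ; len = upd-bound (inner links) C.inner inner-len len
        ; mid-len = upd-bound mid P.path path-len mid-len
        ; mid-off = λ a b p l q → [ (λ r → P.avoid r (spine-Z l q)) , (λ r → mid-off a b r l q) ]′ (mid-view a b p)
        ; parts = λ a b p → parts⁺ a b (inner⁺-view a b p)
        ; hits = hits⁺ }
        where
        ordered⁺ : ∀ a b {u} → (a ≡ i × b ≡ j × u ∈ᴸ C.inner) ⊎ u ∈ᴸ inner links a b → a F.< b
        ordered⁺ a b (inj₁ (refl , refl , _)) = i<j
        ordered⁺ a b (inj₂ p) = ordered a b p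
        parts⁺ : ∀ a b {u} → (a ≡ i × b ≡ j × u ∈ᴸ C.inner) ⊎ u ∈ᴸ inner links a b →
          u ∈ᴸ mid⁺ a b ⊎ (Own a (port⁺ a b) u ⊎ Own b (port⁺ b a) u)
        parts⁺ a b (inj₁ (refl , refl , p)) = parts-new (C.inner-parts p)
        parts⁺ a b (inj₂ p) = parts-old a b p

      joined : Σ State λ st' → done (State.links st') i j ≡ true × (∀ a b → done links a b ≡ true → done (State.links st') a b ≡ true)
      joined = state⁺ , done-new , done⁺

    advance : (st : State) (i j : Fin m) → i F.< j → done (State.links st) i j ≡ false →
      Σ State λ st' → done (State.links st') i j ≡ true × (∀ a b → done (State.links st) a b ≡ true → done (State.links st') a b ≡ true)
    advance st i j i<j undone = go (State.joining st i j)
      where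
      go : GeoPath (State.obstacle st i j) (State.exits st j) (State.exits st i) (T + T) →
        Σ State λ st' → done (State.links st') i j ≡ true × (∀ a b → done (State.links st) a b ≡ true → done (State.links st') a b ≡ true)
      go P = let (y , y∈ , z∈) = outof (GeoPath.start∈ P) ; (y' , y'∈ , z'∈) = outof (GeoPath.fin∈ P)
             in Join.joined st i j i<j undone P y y' y∈ y'∈ z∈ z'∈

    dense-clique : TopClique H m
    dense-clique = let (st , d) = all-pairs (λ st → done (State.links st)) advance start in to-clique (State.links st) d
      where
      start : State
      -- Arms have indices below `2 * m`, so the default port blocks none of them.
      start = record { links = no-links ; mid = λ _ _ → [] ; port = λ _ _ → 2 * m ; ordered = λ _ _ () ; len = λ _ _ → z≤n
        ; mid-len = λ _ _ → z≤n ; mid-off = λ _ _ () ; parts = λ _ _ ()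
        ; hits = λ l → ≤-trans (≤-reflexive (trans (cong (4 *_) (#-empty (λ p → none (proj₁ (outof p))))) (*-zeroʳ 4))) z≤n }
        where
        none : ∀ {u : VH} → ¬ u ∈ ⋃ {μ = m} (λ a → ⋃ {μ = m} (λ b → elems []))
        none p = let (a , q) = outof p ; (b , r) = outof q in absurd (outof r)
          where
          absurd : ∀ {u : VH} → u ∈ᴸ [] → ⊥
          absurd ()

-- Choice of parameters

suc≤2^ : ∀ i → suc i ≤ 2 ^ i
suc≤2^ zero = ≤-refl
suc≤2^ (suc i) = ≤-trans (s≤s (≤-trans (suc≤2^ i) (≤-reflexive (sym (+-identityʳ _)))))
  (+-monoˡ-≤ (2 ^ i + 0) (m^n>0 2 i))

^-distrib-* : ∀ a b e → (a * b) ^ e ≡ a ^ e * b ^ e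
^-distrib-* a b zero = refl
^-distrib-* a b (suc e) = trans (cong (a * b *_) (^-distrib-* a b e)) (c a b (a ^ e) (b ^ e))
  where
  c : ∀ a b x y → a * b * (x * y) ≡ a * x * (b * y)
  c = solve-∀

opaque
  -- With i = eQ + R, (i+1)^e ≤ (e(Q+1))^e ≤ e^e 2^{eQ}.
  poly≤exp : ∀ e → Σ ℕ λ C → ∀ i → suc i ^ e ≤ C * 2 ^ i
  poly≤exp zero = 1 , λ i → ≤-trans (m^n>0 2 i) (≤-reflexive (sym (*-identityˡ _)))
  poly≤exp e@(suc _) = e ^ e , λ i → begin
    suc i ^ e ≤⟨ ^-monoˡ-≤ e (upper i) ⟩
    (e * suc (i / e)) ^ e ≡⟨ ^-distrib-* e (suc (i / e)) e ⟩
    e ^ e * suc (i / e) ^ e ≤⟨ *-monoʳ-≤ (e ^ e) (^-monoˡ-≤ e (suc≤2^ (i / e))) ⟩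
    e ^ e * (2 ^ (i / e)) ^ e ≡⟨ cong (e ^ e *_) (^-*-assoc 2 (i / e) e) ⟩
    e ^ e * 2 ^ (i / e * e) ≤⟨ *-monoʳ-≤ (e ^ e) (^-monoʳ-≤ 2 (≤-trans (m≤n+m (i / e * e) (i % e)) (≤-reflexive (sym (m≡m%n+[m/n]*n i e))))) ⟩
    e ^ e * 2 ^ i ∎
    where
    open ≤-Reasoning
    upper : ∀ i → suc i ≤ e * suc (i / e)
    upper i = begin
      suc i ≡⟨ cong suc (m≡m%n+[m/n]*n i e) ⟩
      suc (i % e) + i / e * e ≤⟨ +-monoˡ-≤ (i / e * e) (m%n<n i e) ⟩
      e + i / e * e ≡⟨ *-comm (suc (i / e)) e ⟩
      e * suc (i / e) ∎

  -- The exponent is raised by one, and the spare factor `suc i` cancels the constant C.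
  eventually : ∀ e → Σ ℕ λ C → ∀ i → C ≤ i → i ^ e ≤ 2 ^ i
  eventually e = let (C , bound) = poly≤exp (suc e) in C + 1 , λ i le → go C i bound le
    where
    go : ∀ C i → (∀ i → suc i ^ suc e ≤ C * 2 ^ i) → C + 1 ≤ i → i ^ e ≤ 2 ^ i
    go zero i bound le = ⊥-elim (<⇒≱ (m^n>0 1 (suc e)) (bound 0))
    go C@(suc _) i bound le = ≤-trans (^-monoˡ-≤ e (n≤1+n i)) (*-cancelˡ-≤ C (≤-trans (*-monoˡ-≤ (suc i ^ e) C≤) (bound i)))
      where
      C≤ : C ≤ suc i
      C≤ = ≤-trans (≤-trans (m≤m+n C 1) le) (n≤1+n i)

-- Calculus of bounds X ≤ y Λ^a for a base Λ that exceeds all numerical constants in use.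
module Magnitude (Λ : ℕ) (big : 100 ≤ Λ) where

  instance
    Λ-nonZero : NonZero Λ
    Λ-nonZero = >-nonZero (≤-trans (s≤s z≤n) big)

  const : ∀ c → c ≤ 100 → c ≤ Λ ^ 1
  const c le = ≤-trans le (≤-trans big (≤-reflexive (sym (*-identityʳ Λ))))

  up : ∀ {a b X} → a ≤ b → X ≤ Λ ^ a → X ≤ Λ ^ b
  up le p = ≤-trans p (^-monoʳ-≤ Λ le)

  plus : ∀ {a X Y} → X ≤ Λ ^ a → Y ≤ Λ ^ a → X + Y ≤ Λ ^ suc a
  plus {a} p q = ≤-trans (+-mono-≤ p q) (≤-trans (≤-reflexive (cong (Λ ^ a +_) (sym (+-identityʳ _))))
    (*-monoˡ-≤ (Λ ^ a) (≤-trans (m≤m+n 2 98) big)))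

  times : ∀ {a b X Y} → X ≤ Λ ^ a → Y ≤ Λ ^ b → X * Y ≤ Λ ^ (a + b)
  times {a} {b} p q = ≤-trans (*-mono-≤ p q) (≤-reflexive (sym (^-distribˡ-+-* Λ a b)))

  pow : ∀ {a X} e → X ≤ Λ ^ a → X ^ e ≤ Λ ^ (a * e)
  pow {a} e p = ≤-trans (^-monoˡ-≤ e p) (≤-reflexive (^-*-assoc Λ a e))

  base : ∀ {y} → y ≤ y * Λ ^ 0
  base {y} = ≤-reflexive (sym (*-identityʳ y))

  upᵇ : ∀ {y a b X} → a ≤ b → X ≤ y * Λ ^ a → X ≤ y * Λ ^ b
  upᵇ {y} le p = ≤-trans p (*-monoʳ-≤ y (^-monoʳ-≤ Λ le))

  plusᵇ : ∀ {y a X Y} → X ≤ y * Λ ^ a → Y ≤ y * Λ ^ a → X + Y ≤ y * Λ ^ suc a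
  plusᵇ {y} {a} p q = ≤-trans (+-mono-≤ p q) (≤-trans (≤-reflexive (sym (*-distribˡ-+ y (Λ ^ a) (Λ ^ a)))) (*-monoʳ-≤ y (plus {a} ≤-refl ≤-refl)))

  timesᵇ : ∀ {y a b X Y} → X ≤ Λ ^ a → Y ≤ y * Λ ^ b → X * Y ≤ y * Λ ^ (a + b)
  timesᵇ {y} {a} {b} {X} {Y} p q = begin
    X * Y ≤⟨ *-mono-≤ p q ⟩
    Λ ^ a * (y * Λ ^ b) ≡⟨ c (Λ ^ a) y (Λ ^ b) ⟩
    y * (Λ ^ a * Λ ^ b) ≡⟨ cong (y *_) (sym (^-distribˡ-+-* Λ a b)) ⟩
    y * Λ ^ (a + b) ∎
    where
    open ≤-Reasoning
    c : ∀ x y z → x * (y * z) ≡ y * (x * z)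
    c = solve-∀

rate≤ : ∀ Λ → 100 ≤ Λ → rate Λ ≤ Λ ^ 3
rate≤ Λ big = begin
  rate Λ ≡⟨ rate-def Λ ⟩
  18 * (suc Λ * suc Λ) ≤⟨ *-monoʳ-≤ 18 (*-mono-≤ twice twice) ⟩
  18 * ((2 * Λ) * (2 * Λ)) ≡⟨ c Λ ⟩
  72 * (Λ * Λ) ≤⟨ *-monoˡ-≤ (Λ * Λ) (≤-trans (m≤m+n 72 28) big) ⟩
  Λ * (Λ * Λ) ≡⟨ c' Λ ⟩
  Λ ^ 3 ∎
  where
  open ≤-Reasoning
  twice : suc Λ ≤ 2 * Λ
  twice = ≤-trans (+-monoˡ-≤ Λ (≤-trans (s≤s z≤n) big)) (≤-reflexive (cong (Λ +_) (sym (+-identityʳ Λ))))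
  c : ∀ x → 18 * ((2 * x) * (2 * x)) ≡ 72 * (x * x)
  c = solve-∀
  c' : ∀ x → x * (x * x) ≡ x * (x * (x * 1))
  c' = solve-∀

rate-mono : ∀ {i j} → i ≤ j → rate i ≤ rate j
rate-mono {i} {j} le = ≤-trans (≤-reflexive (rate-def i)) (≤-trans (*-monoʳ-≤ 18 (*-mono-≤ (s≤s le) (s≤s le))) (≤-reflexive (sym (rate-def j))))

time≤ : ∀ i → time i ≤ 2 + i * (2 * rate i)
time≤ zero = ≤-reflexive time-zero
time≤ (suc i) = begin
  time (suc i) ≡⟨ time-suc i ⟩
  time i + 2 * rate (suc i) ≤⟨ +-monoˡ-≤ _ (≤-trans (time≤ i) (+-monoʳ-≤ 2 (*-monoʳ-≤ i (*-monoʳ-≤ 2 (rate-mono (n≤1+n i)))))) ⟩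
  2 + i * (2 * rate (suc i)) + 2 * rate (suc i) ≡⟨ trans (+-assoc 2 (i * (2 * rate (suc i))) (2 * rate (suc i))) (cong (2 +_) (+-comm (i * (2 * rate (suc i))) (2 * rate (suc i)))) ⟩
  2 + suc i * (2 * rate (suc i)) ∎
  where open ≤-Reasoning

record Scale (X : Setting) (m : ℕ) : Set where
  open Core X
  field
    big : 100 ≤ Λ
    t≤Λ : t ≤ Λ
    s≥2 : 2 ≤ s
    q≤k : q ≤ k
    m²≤k : m * m ≤ k
    k≤4m² : k ≤ 4 * (m * m)
    8m≤q : 8 * m ≤ q
    8k≤k₀ : 8 * k ≤ k₀
    N≥ : k * 2 ^ Λ ≤ 2 * n H
    Λ-exp : Λ ^ (40 * (s * s)) ≤ 2 ^ Λ

-- Parameters of the dense case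

module DenseCase (X : Setting) where
  open Core X

  module _ (m : ℕ) (sc : Scale X m) (dense : Λ ^ (30 * s) ≤ m) where
    open Scale sc
    open Magnitude Λ big

    -- One of the s factors k is kept, and the other s - 1 are exchanged for q^s by `k₀-small`. So
    -- the bad set of a set of size k poly(Λ) again has size k poly(Λ), and the operation can be
    -- iterated.
    bad-magnitude : ∀ e {F} → F ≤ k * Λ ^ e → t * F ^ s ≤ (k * Λ ^ (suc e * s)) * (q ∸ s) ^ s
    bad-magnitude e {F} F≤ = begin
      t * F ^ s ≤⟨ *-monoʳ-≤ t (^-monoˡ-≤ s F≤) ⟩
      t * (k * Λ ^ e) ^ s ≡⟨ cong (t *_) (trans (^-distrib-* k (Λ ^ e) s) (cong (k ^ s *_) (^-*-assoc Λ e s))) ⟩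
      t * (k * k ^ s' * Λ ^ (e * s)) ≡⟨ c₁ t k (k ^ s') (Λ ^ (e * s)) ⟩
      (t * k ^ s') * (k * Λ ^ (e * s)) ≤⟨ *-monoˡ-≤ (k * Λ ^ (e * s)) (≤-trans (*-monoʳ-≤ t (^-monoˡ-≤ s' k≤k₀)) k₀-small) ⟩
      q ^ s * (k * Λ ^ (e * s)) ≤⟨ *-monoˡ-≤ (k * Λ ^ (e * s)) (^-monoˡ-≤ s q≤) ⟩
      (2 * (q ∸ s)) ^ s * (k * Λ ^ (e * s)) ≡⟨ cong (_* (k * Λ ^ (e * s))) (^-distrib-* 2 (q ∸ s) s) ⟩
      (2 ^ s * (q ∸ s) ^ s) * (k * Λ ^ (e * s)) ≤⟨ *-monoˡ-≤ (k * Λ ^ (e * s)) (*-monoˡ-≤ ((q ∸ s) ^ s) (^-monoˡ-≤ s (≤-trans (m≤m+n 2 98) big))) ⟩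
      (Λ ^ s * (q ∸ s) ^ s) * (k * Λ ^ (e * s)) ≡⟨ c₂ (Λ ^ s) ((q ∸ s) ^ s) k (Λ ^ (e * s)) ⟩
      k * (Λ ^ s * Λ ^ (e * s)) * (q ∸ s) ^ s ≡⟨ cong (λ z → k * z * (q ∸ s) ^ s) (sym (^-distribˡ-+-* Λ s (e * s))) ⟩
      (k * Λ ^ (suc e * s)) * (q ∸ s) ^ s ∎
      where
      open ≤-Reasoning
      c₁ : ∀ t k x y → t * (k * x * y) ≡ (t * x) * (k * y)
      c₁ = solve-∀
      c₂ : ∀ a b k y → (a * b) * (k * y) ≡ k * (a * y) * b
      c₂ = solve-∀
      k≤k₀ : k ≤ k₀
      k≤k₀ = ≤-trans (m≤m+n k (7 * k)) 8k≤k₀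
      s≤q-s : s ≤ q ∸ s
      s≤q-s = m+n≤o⇒m≤o∸n s (≤-trans (≤-reflexive (cong (s +_) (sym (+-identityʳ s)))) 2s≤q)
      q≤ : q ≤ 2 * (q ∸ s)
      q≤ = ≤-trans (≤-reflexive (sym (m+[n∸m]≡n (<⇒≤ s<q)))) (≤-trans (+-monoˡ-≤ (q ∸ s) s≤q-s) (≤-reflexive (cong (q ∸ s +_) (sym (+-identityʳ _)))))

    h T ρ ℓ M B z x θ f S b₁ b₂ β : ℕ
    -- The exponents determine one another: spreading against the obstacle needs x up to m² Λ^18,
    -- and the m²h/2 or so free leaves must exceed a constant multiple of that, whence 21. Then θ
    -- bounds the body of one unit, f the feet of all m units, and S exceeds `2 * w * (f + θ)`.
    h = Λ ^ 21
    T = Λ * (2 * w)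
    ρ = 2 + Λ * (4 * w)
    ℓ = ρ + T
    M = suc (T + T)
    B = (ℓ + 1) + (M + (ℓ + 1))
    z = m * m * Λ ^ 12 + m * h * Λ ^ 1
    x = Λ ^ 4 * z + k
    θ = m * Λ ^ 23
    f = k * Λ ^ 24
    S = k * Λ ^ 29
    b₁ = k * Λ ^ (30 * s)
    b₂ = k * Λ ^ (suc (suc (30 * s)) * s)
    β = t * h ^ s

    w≤ : w ≤ Λ ^ 3
    w≤ = rate≤ Λ big

    w*≤ : ∀ c → c ≤ 100 → c * w ≤ Λ ^ 4
    w*≤ c le = times {1} {3} (const c le) w≤

    Λ≤ : Λ ≤ Λ ^ 1
    Λ≤ = ≤-reflexive (sym (*-identityʳ Λ))

    T≤ : T ≤ Λ ^ 5
    T≤ = times {1} {4} Λ≤ (w*≤ 2 (m≤m+n 2 98))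

    ρ≤ : ρ ≤ Λ ^ 6
    ρ≤ = plus {5} (up {1} {5} (s≤s z≤n) (const 2 (m≤m+n 2 98))) (times {1} {4} Λ≤ (w*≤ 4 (m≤m+n 4 96)))

    ℓ≤ : ℓ ≤ Λ ^ 7
    ℓ≤ = plus {6} ρ≤ (up {5} {6} (m≤m+n 5 1) T≤)

    ℓ+1≤ : ℓ + 1 ≤ Λ ^ 8
    ℓ+1≤ = plus {7} ℓ≤ (up {1} {7} (s≤s z≤n) (const 1 (s≤s z≤n)))

    M≤ : M ≤ Λ ^ 7
    M≤ = plus {6} {1} (up {1} {6} (s≤s z≤n) (const 1 (s≤s z≤n))) (plus {5} T≤ T≤)

    big-m : ∀ a → a ≤ 30 * s → Λ ^ a ≤ m
    big-m a le = ≤-trans (^-monoʳ-≤ Λ le) dense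

    60≤30s : 60 ≤ 30 * s
    60≤30s = *-monoʳ-≤ 30 s≥2

    m≥1 : 1 ≤ m
    m≥1 = big-m 0 z≤n

    m≤m² : m ≤ m * m
    m≤m² = m≤m*n m m ⦃ >-nonZero m≥1 ⦄

    m≤k : m ≤ k
    m≤k = ≤-trans m≤m² m²≤k

    -- The density hypothesis at work: m is at least Λ^60, so one factor m saved from m² pays for
    -- these powers of Λ.
    mΛ≤k : ∀ a → a ≤ 60 → m * Λ ^ a ≤ k
    mΛ≤k a le = ≤-trans (*-monoʳ-≤ m (big-m a (≤-trans le 60≤30s))) m²≤k

    m²-in : ∀ {a C} → C ≤ Λ ^ a → m * (m * C) ≤ m * m * Λ ^ a
    m²-in {a} {C} p = ≤-trans (≤-reflexive (sym (*-assoc m m C))) (*-monoʳ-≤ (m * m) p)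

    B≤ : B ≤ Λ ^ 10
    B≤ = plus {9} {ℓ + 1} (up {8} {9} (m≤m+n 8 1) ℓ+1≤) (plus {8} {M} (up {7} {8} (m≤m+n 7 1) M≤) ℓ+1≤)

    scaled : ∀ c → c ≤ 100 → ∀ {y a X} → X ≤ y * Λ ^ a → c * X ≤ y * Λ ^ suc a
    scaled c le {y} {a} {X} p = timesᵇ {y} {1} {a} {c} {X} (const c le) p

    z-bound : (m * (m * B) + m * (1 + 2 * m * ℓ)) + ((2 * m * h + 2 * m * h) + 4 * (m * (m * M))) ≤ z
    z-bound = ≤-trans (≤-reflexive (c (m * (m * B)) (m * (1 + 2 * m * ℓ)) (2 * m * h + 2 * m * h) (4 * (m * (m * M)))))
      (+-mono-≤ (plusᵇ {m * m} {11} (plusᵇ {m * m} {10} (m²-in {10} B≤) A₂) (upᵇ {m * m} {8} {11} (m≤m+n 8 3) A₃))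
        (≤-trans (≤-reflexive (c₃ m h)) (≤-trans (*-monoʳ-≤ (m * h) (const 4 (m≤m+n 4 96))) ≤-refl)))
      where
      c : ∀ a b d e → (a + b) + (d + e) ≡ ((a + b) + e) + d
      c = solve-∀
      c₂ : ∀ m l → m * (1 + 2 * m * l) ≡ m + m * (m * (2 * l))
      c₂ = solve-∀
      c₃ : ∀ m h → 2 * m * h + 2 * m * h ≡ m * h * 4
      c₃ = solve-∀
      c₄ : ∀ m M → 4 * (m * (m * M)) ≡ m * (m * (4 * M))
      c₄ = solve-∀
      A₂ : m * (1 + 2 * m * ℓ) ≤ m * m * Λ ^ 10
      A₂ = ≤-trans (≤-reflexive (c₂ m ℓ)) (plusᵇ {m * m} {9} (≤-trans m≤m² (upᵇ {m * m} {0} {9} z≤n base))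
        (m²-in {9} (up {8} {9} (m≤m+n 8 1) (times {1} {7} (const 2 (m≤m+n 2 98)) ℓ≤))))
      A₃ : 4 * (m * (m * M)) ≤ m * m * Λ ^ 8
      A₃ = ≤-trans (≤-reflexive (c₄ m M)) (m²-in {8} (times {1} {7} (const 4 (m≤m+n 4 96)) M≤))

    z≤ : z ≤ m * m * Λ ^ 13
    z≤ = plusᵇ {m * m} {12} ≤-refl (≤-trans (≤-reflexive (trans (*-assoc m h (Λ ^ 1)) (cong (m *_) (sym (^-distribˡ-+-* Λ 21 1)))))
      (≤-trans (*-monoʳ-≤ m (big-m 22 (≤-trans (m≤m+n 22 38) 60≤30s))) (upᵇ {m * m} {0} {12} z≤n base)))

    x≤ : x ≤ m * m * Λ ^ 18
    x≤ = plusᵇ {m * m} {17} (timesᵇ {m * m} {4} {13} {Λ ^ 4} ≤-refl z≤) (upᵇ {m * m} {1} {17} (s≤s z≤n)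
      (≤-trans k≤4m² (scaled 4 (m≤m+n 4 96) {m * m} {0} {m * m} base)))

    x-big : 2 * w * z ≤ x
    x-big = ≤-trans (*-monoˡ-≤ z (w*≤ 2 (m≤m+n 2 98))) (m≤m+n (Λ ^ 4 * z) k)

    roomy : 4 * (x + z) + 4 * (m * M) ≤ m * (2 * (m * h))
    roomy = ≤-trans (plusᵇ {m * m} {20} (scaled 4 (m≤m+n 4 96) {m * m} {19} {x + z} (plusᵇ {m * m} {18} x≤ (upᵇ {m * m} {13} {18} (m≤m+n 13 5) z≤)))
        (upᵇ {m * m} {8} {20} (m≤m+n 8 12) (scaled 4 (m≤m+n 4 96) {m * m} {7} {m * M}
          (≤-trans (*-monoˡ-≤ M m≤m²) (*-monoʳ-≤ (m * m) M≤)))))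
      (≤-trans (m≤m+n (m * m * h) (m * m * h)) (≤-reflexive (c m h)))
      where
      c : ∀ m h → m * m * h + m * m * h ≡ m * (2 * (m * h))
      c = solve-∀

    feet≤ : 2 * m * ℓ + 2 * m * h ≤ θ
    feet≤ = plusᵇ {m} {22} (part {7} {ℓ} (s≤s (m≤m+n 7 14)) ℓ≤) (part {21} {h} ≤-refl ≤-refl)
      where
      part : ∀ {a X} → suc a ≤ 22 → X ≤ Λ ^ a → 2 * m * X ≤ m * Λ ^ 22
      part {a} {X} le p = upᵇ {m} {suc a} {22} le (≤-trans (≤-reflexive (*-assoc 2 m X)) (scaled 2 (m≤m+n 2 98) {m} {a} {m * X} (*-monoʳ-≤ m p)))

    f-bound : m * (1 + (2 * m * ℓ + 2 * m * h)) ≤ f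
    f-bound = ≤-trans (*-monoʳ-≤ m (plusᵇ {m} {23} (≤-trans m≥1 (upᵇ {m} {0} {23} z≤n base)) feet≤))
      (≤-trans (≤-reflexive (sym (*-assoc m m (Λ ^ 24)))) (*-monoˡ-≤ (Λ ^ 24) m²≤k))

    θ≤k : θ ≤ k * Λ ^ 23
    θ≤k = *-monoˡ-≤ (Λ ^ 23) m≤k

    wf≤ : 2 * w * f ≤ k * Λ ^ 28
    wf≤ = timesᵇ {k} {4} {24} {2 * w} (w*≤ 2 (m≤m+n 2 98)) ≤-refl

    F₁≤ : f + 2 * w * f ≤ k * Λ ^ 29
    F₁≤ = plusᵇ {k} {28} (upᵇ {k} {24} {28} (m≤m+n 24 4) ≤-refl) wf≤

    E : ℕ
    E = suc (suc (30 * s)) * s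

    s²≥4 : 4 ≤ s * s
    s²≥4 = *-mono-≤ s≥2 s≥2

    -- Two nested bad sets raise the exponent 29 first to 30s and then to (30s + 2)s. With three
    -- spare factors this stays within 40s², the exponent demanded in `Λ-exp`.
    E≤ : suc (suc (suc E)) ≤ 40 * (s * s)
    E≤ = begin
      3 + suc (suc (30 * s)) * s ≡⟨ c s ⟩
      3 + (2 * s + 30 * (s * s)) ≤⟨ +-mono-≤ (≤-trans (m≤m+n 3 1) s²≥4) (+-monoˡ-≤ (30 * (s * s)) (*-monoˡ-≤ s s≥2)) ⟩
      s * s + (s * s + 30 * (s * s)) ≤⟨ m≤m+n _ (8 * (s * s)) ⟩
      s * s + (s * s + 30 * (s * s)) + 8 * (s * s) ≡⟨ c' (s * s) ⟩
      40 * (s * s) ∎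
      where
      open ≤-Reasoning
      c : ∀ s → 3 + suc (suc (30 * s)) * s ≡ 3 + (2 * s + 30 * (s * s))
      c = solve-∀
      c' : ∀ y → y + (y + 30 * y) + 8 * y ≡ 40 * y
      c' = solve-∀

    29≤E : 29 ≤ E
    29≤E = ≤-trans (≤-trans (m≤m+n 29 31) 60≤30s) (≤-trans (≤-trans (n≤1+n _) (n≤1+n _)) (m≤m*n (suc (suc (30 * s))) s))

    under-N : ∀ {a X} → a ≤ 40 * (s * s) → X ≤ k * Λ ^ a → X ≤ 2 * n H
    under-N {a} {X} le p = ≤-trans (upᵇ {k} {a} {40 * (s * s)} {X} le p) (≤-trans (*-monoʳ-≤ k Λ-exp) N≥)

    30≤ : 31 ≤ 40 * (s * s)
    30≤ = ≤-trans (m≤m+n 31 129) (*-monoʳ-≤ 40 s²≥4)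

    bad₁ : ∀ {F} → F ≤ k * Λ ^ 29 → t * F ^ s ≤ b₁ * (q ∸ s) ^ s
    bad₁ = bad-magnitude 29

    bad₂ : ∀ {F} → F ≤ k * Λ ^ 29 → t * (F + b₁) ^ s ≤ b₂ * (q ∸ s) ^ s
    bad₂ {F} p = bad-magnitude (suc (30 * s)) (plusᵇ {k} {30 * s} (upᵇ {k} {29} {30 * s} (≤-trans (m≤m+n 29 31) 60≤30s) p) ≤-refl)

    room : (f + 2 * w * f) + b₂ < n H
    room = *-cancelˡ-≤ 2 (under-N {suc (suc (suc E))} E≤ (scaled 2 (m≤m+n 2 98) {k} {suc (suc E)} {suc ((f + 2 * w * f) + b₂)}
      (plusᵇ {k} {suc E} {1} (≤-trans k≥1 (upᵇ {k} {0} {suc E} z≤n base)) (plusᵇ {k} {E} (upᵇ {k} {29} {E} 29≤E F₁≤) ≤-refl))))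

    half-b : 2 * (b₂ + 1) ≤ n H
    half-b = *-cancelˡ-≤ 2 (under-N {suc (suc (suc E))} E≤ (scaled 2 (m≤m+n 2 98) {k} {suc (suc E)} {2 * (b₂ + 1)}
      (scaled 2 (m≤m+n 2 98) {k} {suc E} {b₂ + 1} (plusᵇ {k} {E} ≤-refl (≤-trans k≥1 (upᵇ {k} {0} {E} z≤n base))))))

    half-S : 2 * (2 * w * f + S) ≤ n H
    half-S = *-cancelˡ-≤ 2 (under-N {32} (≤-trans (m≤m+n 32 128) (*-monoʳ-≤ 40 s²≥4)) (scaled 2 (m≤m+n 2 98) {k} {31} {2 * (2 * w * f + S)}
      (scaled 2 (m≤m+n 2 98) {k} {30} {2 * w * f + S} (plusᵇ {k} {29} (upᵇ {k} {28} {29} (m≤m+n 28 1) wf≤) ≤-refl))))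

    S-exp : 2 * S ≤ k * 2 ^ Λ
    S-exp = ≤-trans (scaled 2 (m≤m+n 2 98) {k} {29} {S} ≤-refl) (≤-trans (upᵇ {k} {30} {40 * (s * s)} (≤-trans (m≤m+n 30 1) 30≤) ≤-refl) (*-monoʳ-≤ k Λ-exp))

    S≥1 : 1 ≤ S
    S≥1 = ≤-trans k≥1 (upᵇ {k} {0} {29} z≤n base)

    k≤S : k ≤ S
    k≤S = upᵇ {k} {0} {29} z≤n base

    S≥ : 2 * w * (f + θ) ≤ S
    S≥ = timesᵇ {k} {4} {25} {2 * w} (w*≤ 2 (m≤m+n 2 98)) (plusᵇ {k} {24} ≤-refl (upᵇ {k} {23} {24} (m≤m+n 23 1) θ≤k))

    θ-small : 4 * w * θ ≤ k
    θ-small = ≤-trans (timesᵇ {m} {4} {23} {4 * w} (w*≤ 4 (m≤m+n 4 96)) ≤-refl) (mΛ≤k 27 (m≤m+n 27 33))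

    k+θ≤k₀ : k + θ ≤ k₀
    k+θ≤k₀ = ≤-trans (+-monoʳ-≤ k (≤-trans (mΛ≤k 23 (m≤m+n 23 37)) (m≤m+n k (6 * k)))) 8k≤k₀

    2m≤q : 2 * m ≤ q
    2m≤q = ≤-trans (*-monoˡ-≤ m (m≤m+n 2 6)) 8m≤q

    fH≥ : ((f + θ) + m * (2 * m * h)) + (4 * q + 1) ≤ k * Λ ^ 29
    fH≥ = upᵇ {k} {27} {29} (m≤m+n 27 2) (plusᵇ {k} {26} (plusᵇ {k} {25} (plusᵇ {k} {24} ≤-refl (upᵇ {k} {23} {24} (m≤m+n 23 1) θ≤k))
        (upᵇ {k} {22} {25} (m≤m+n 22 3) (≤-trans (≤-reflexive (c m h)) (scaled 2 (m≤m+n 2 98) {k} {21} {m * m * h} (*-monoˡ-≤ h m²≤k)))))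
      (upᵇ {k} {2} {26} (s≤s (s≤s z≤n)) (plusᵇ {k} {1} (scaled 4 (m≤m+n 4 96) {k} {0} {q} (≤-trans q≤k base)) (≤-trans k≥1 (upᵇ {k} {0} {1} z≤n base)))))
      where
      c : ∀ m h → m * (2 * m * h) ≡ 2 * (m * m * h)
      c = solve-∀

    β≤ : β ≤ Λ ^ suc (21 * s)
    β≤ = times {1} {21 * s} (≤-trans t≤Λ Λ≤) (pow {21} {h} s ≤-refl)

    fits : ℓ + (h + β) ≤ 2 * q
    fits = ≤-trans (≤-trans (plus {suc (suc (21 * s))} (up {7} (≤-trans (≤-trans (m≤m+n 7 14) 21≤) (≤-trans (n≤1+n _) (n≤1+n _))) ℓ≤)
        (plus {suc (21 * s)} (up {21} (≤-trans 21≤ (n≤1+n _)) ≤-refl) β≤)) (big-m _ small)) (≤-trans (≤-trans (m≤m+n m (m + 0)) 2m≤q) (m≤m+n q (q + 0)))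
      where
      21≤ : 21 ≤ 21 * s
      21≤ = *-monoʳ-≤ 21 {1} {s} (≤-trans (s≤s z≤n) s≥2)
      small : 3 + 21 * s ≤ 30 * s
      small = ≤-trans (+-monoˡ-≤ (21 * s) (≤-trans (m≤m+n 3 15) (*-monoʳ-≤ 9 s≥2))) (≤-reflexive (sym (*-distribʳ-+ s 9 21)))

    -- The leaves of a hub number at most hm, and m ≤ q - s, so their bad set has at most t h^s
    -- elements. That is a mere power of Λ, small against q ≥ m ≥ Λ^{30s}, as `fits` needs.
    β≥ : t * (h * m) ^ s ≤ β * (q ∸ s) ^ s
    β≥ = begin
      t * (h * m) ^ s ≡⟨ cong (t *_) (^-distrib-* h m s) ⟩
      t * (h ^ s * m ^ s) ≡⟨ sym (*-assoc t _ _) ⟩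
      β * m ^ s ≤⟨ *-monoʳ-≤ β (^-monoˡ-≤ s (m+n≤o⇒m≤o∸n m {s} {q} (*-cancelˡ-≤ 2 (≤-trans (≤-reflexive (*-distribˡ-+ 2 m s))
          (≤-trans (+-mono-≤ 2m≤q 2s≤q) (≤-reflexive (cong (q +_) (sym (+-identityʳ q))))))))) ⟩
      β * (q ∸ s) ^ s ∎
      where open ≤-Reasoning

    health : ∀ U → # U ≤ f → Health.Healthy X θ S ρ U
    health = Carving.Carve.healthy X f θ S Λ ρ b₁ b₂ refl (bad₁ F₁≤) (bad₂ F₁≤) room k+θ≤k₀ θ-small S≥1 S-exp half-S

    clique : TopClique H m
    clique = go (Units.units X m h ℓ θ S ρ f β (k * Λ ^ 29) b₁ b₂ refl feet≤ 2m≤q fits k≤S S≥ fH≥ (bad₁ ≤-refl) (bad₂ ≤-refl) half-b β≥ health f-bound)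
      where
      open Frames X m h ℓ
      go : (Σ (Fin m → Frame (2 * m)) λ K → ∀ i j → j F.< i → ∀ {u} → u ∈ Frame.foot (K j) → ¬ u ∈ Frame.foot (K i)) → TopClique H m
      go (K , sep) = DenseLinking.dense-clique X m h ℓ T B M x z refl refl ≤-refl z-bound (m≤n+m k _) x-big roomy K apart
        where
        apart : ∀ {i j} → i ≢ j → ∀ {u} → u ∈ Frame.foot (K i) → u ∈ Frame.foot (K j) → ⊥
        apart {i} {j} ne p q with <F-cmp i j
        ... | tri< lt _ _ = sep j i lt p q
        ... | tri≈ _ e _ = ne e
        ... | tri> _ _ gt = sep i j gt q p

dyadic : ∀ k N → 1 ≤ k → k ≤ N → Σ ℕ λ i → N ≤ k * 2 ^ i × k * 2 ^ i ≤ 2 * N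
dyadic k N k≥1 k≤N = go (≤⇒≤′ k≤N)
  where
  swap : ∀ k x → k * (2 * x) ≡ 2 * (k * x)
  swap = solve-∀
  go : ∀ {N} → k ≤′ N → Σ ℕ λ i → N ≤ k * 2 ^ i × k * 2 ^ i ≤ 2 * N
  go ≤′-refl = 0 , ≤-reflexive (sym (*-identityʳ k)) , ≤-trans (≤-reflexive (*-identityʳ k)) (m≤m+n k _)
  go {suc N} (≤′-step le) with go le
  ... | i , lo , hi with suc N ≤? k * 2 ^ i
  ...   | yes p = i , p , ≤-trans hi (*-monoʳ-≤ 2 (n≤1+n N))
  ...   | no ¬p = suc i , ≤-trans (+-mono-≤ N≥1 lo) (≤-trans (≤-reflexive (c (k * 2 ^ i) N full)) (≤-reflexive (sym (swap k (2 ^ i))))) ,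
          ≤-trans (≤-reflexive (swap k (2 ^ i))) (*-monoʳ-≤ 2 (≤-trans (≤-pred (≰⇒> ¬p)) (n≤1+n N)))
    where
    N≥1 : 1 ≤ N
    N≥1 = ≤-trans k≥1 (≤′⇒≤ le)
    full : k * 2 ^ i ≡ N
    full = ≤-antisym (≤-pred (≰⇒> ¬p)) lo
    c : ∀ x N → x ≡ N → N + x ≡ 2 * x
    c x .x refl = cong (x +_) (sym (+-identityʳ x))

-- Parameters of the star case and of the sparse case

module MainCase (X : Setting) (m : ℕ) (sc : Scale X m) where
  open Core X
  open Scale sc
  open Magnitude Λ big

  Δ a : ℕ
  -- In the star case the obstacle has size k Λ^8, the factor 2w raises this to k Λ^12 for the
  -- start, and their sum costs one more Λ. The exponent a is such that Δ ≤ Λ^a whenever k ≤ 4m² and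
  -- m ≤ Λ^{30s}.
  Δ = k * Λ ^ 13
  a = 60 * s + 14

  rich : SubH
  rich = set (λ u → Δ ≤? # (adj H u))

  w*≤ : ∀ c → c ≤ 100 → c * w ≤ Λ ^ 4
  w*≤ c le = times {1} {3} (const c le) (rate≤ Λ big)

  m≤k : m ≤ k
  m≤k = go m refl
    where
    go : ∀ z → z ≡ m → m ≤ k
    go zero refl = z≤n
    go (suc z) refl = ≤-trans (m≤m*n m m) m²≤k

  m²-in : ∀ {e C} → C ≤ Λ ^ e → m * (m * C) ≤ k * Λ ^ e
  m²-in {e} {C} p = ≤-trans (≤-reflexive (sym (*-assoc m m C))) (*-mono-≤ m²≤k p)

  Λ≤ : Λ ≤ Λ ^ 1
  Λ≤ = ≤-reflexive (sym (*-identityʳ Λ))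

  star-case : m ≤ # rich → TopClique H m
  star-case le = let (v , v-inj , v∈) = #-enum rich m le in
    Star.star-clique X m Δ (k * Λ ^ 12) v v-inj (λ l → outof (v∈ l)) (upᵇ {k} {0} {12} z≤n base)
      (plusᵇ {k} {12} ≤-refl (upᵇ {k} {8} {12} (m≤m+n 8 4) z≤)) (timesᵇ {k} {4} {8} {2 * w} (w*≤ 2 (m≤m+n 2 98)) z≤)
    where
    T≤ : 2 * (1 + Λ * (2 * w)) ≤ Λ ^ 7
    T≤ = times {1} {6} (const 2 (m≤m+n 2 98)) (plus {5} {1} (up {1} {5} (s≤s z≤n) (const 1 (s≤s z≤n))) (times {1} {4} Λ≤ (w*≤ 2 (m≤m+n 2 98))))
    z≤ : m * (m * (2 * (1 + Λ * (2 * w)))) + m ≤ k * Λ ^ 8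
    z≤ = plusᵇ {k} {7} (m²-in {7} T≤) (upᵇ {k} {0} {7} z≤n (≤-trans m≤k base))

  module SparseCase (few : # rich ≤ m) (sparse : m ≤ Λ ^ (30 * s)) (C : ℕ) (C-bound : ∀ i → suc i ^ 5 ≤ C * 2 ^ i)
    (m-large : 2916 * (32 * C) ≤ m) (g : ℕ) (Λ≤2^ : Λ ≤ 2 ^ g) (2^≤ : 2 ^ g ≤ 2 * Λ) (g-big : 100 ≤ g) (a≤g : a ≤ g)
    (g-exp : g ^ 64 ≤ 2 ^ g) where

    i₁ r i₂ R T : ℕ
    -- 2^g is at least Λ and at most 2Λ. From level i₁ on 2^i is at least Λ^12, which outweighs all
    -- used vertices; from i₂ on it is at least 2 Λ^12 Δ^r, which outweighs the guards too.
    i₁ = 12 * g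
    r = time i₁
    i₂ = suc (12 * g) + g * a * r
    R = time i₂
    T = time Λ

    Δ≤ : Δ ≤ 2 ^ (g * a)
    Δ≤ = begin
      k * Λ ^ 13 ≤⟨ *-monoˡ-≤ (Λ ^ 13) (≤-trans k≤4m² (times {1} {30 * s + 30 * s} (const 4 (m≤m+n 4 96)) (times {30 * s} {30 * s} sparse sparse))) ⟩
      Λ ^ (1 + (30 * s + 30 * s)) * Λ ^ 13 ≡⟨ sym (^-distribˡ-+-* Λ (1 + (30 * s + 30 * s)) 13) ⟩
      Λ ^ (1 + (30 * s + 30 * s) + 13) ≡⟨ cong (Λ ^_) (c s) ⟩
      Λ ^ a ≤⟨ ^-monoˡ-≤ a Λ≤2^ ⟩
      (2 ^ g) ^ a ≡⟨ ^-*-assoc 2 g a ⟩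
      2 ^ (g * a) ∎
      where
      open ≤-Reasoning
      c : ∀ s → 1 + (30 * s + 30 * s) + 13 ≡ 60 * s + 14
      c = solve-∀

    Δ^≤ : ∀ p → Δ ^ p ≤ 2 ^ (g * a * p)
    Δ^≤ p = ≤-trans (^-monoˡ-≤ p Δ≤) (≤-reflexive (^-*-assoc 2 (g * a) p))

    module G = Magnitude g g-big

    time-G : ∀ i e → 100 ≤ i → i ≤ g ^ e → time i ≤ g ^ (2 + (e + suc (e * 3)))
    time-G i e le i≤ = ≤-trans (time≤ i) (G.plus {suc (e + suc (e * 3))} {2} (G.up {1} {suc (e + suc (e * 3))} (s≤s z≤n) (G.const 2 (m≤m+n 2 98)))
      (G.up {e + suc (e * 3)} {suc (e + suc (e * 3))} (n≤1+n _) (G.times {e} {suc (e * 3)} i≤ (G.times {1} {e * 3} (G.const 2 (m≤m+n 2 98))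
        (≤-trans (rate≤ i le) (G.pow {e} 3 i≤))))))

    g≤ : g ≤ g ^ 1
    g≤ = ≤-reflexive (sym (*-identityʳ g))

    i₁≤ : i₁ ≤ g ^ 2
    i₁≤ = G.times {1} {1} (G.const 12 (m≤m+n 12 88)) g≤

    i₁≥ : 100 ≤ i₁
    i₁≥ = ≤-trans g-big (m≤m+n g _)

    r≤ : r ≤ g ^ 11
    r≤ = time-G i₁ 2 i₁≥ i₁≤

    ga≤ : g * a ≤ g ^ 2
    ga≤ = G.times {1} {1} g≤ (≤-trans a≤g g≤)

    i₂≤ : i₂ ≤ g ^ 14
    i₂≤ = G.plus {13} {suc (12 * g)} (G.up {3} {13} (m≤m+n 3 10) (G.plus {2} {1} (G.up {1} {2} (s≤s z≤n) (G.const 1 (s≤s z≤n))) i₁≤)) (G.times {2} {11} ga≤ r≤)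

    i₁≤i₂ : i₁ ≤ i₂
    i₁≤i₂ = ≤-trans (n≤1+n i₁) (m≤m+n (suc i₁) _)

    R≤ : R ≤ g ^ 59
    R≤ = time-G i₂ 14 (≤-trans i₁≥ i₁≤i₂) i₂≤

    reach≤ : 3 + g * a * (R + r) ≤ g ^ 63
    reach≤ = G.plus {62} {3} (G.up {1} {62} (s≤s z≤n) (G.const 3 (m≤m+n 3 97)))
      (G.times {2} {60} ga≤ (G.plus {59} R≤ (G.up {11} {59} (m≤m+n 11 48) r≤)))

    -- The radii are powers of g, so `Δ ^ (R + r)` is 2 to an exponent of at most g^63, whereas Λ is
    -- about 2^g. Balls of radius R + r around the cores therefore do not exhaust the graph.
    reach≤Λ : 3 + g * a * (R + r) ≤ Λ
    reach≤Λ = *-cancelˡ-≤ 2 (≤-trans (G.times {1} {63} (G.const 2 (m≤m+n 2 98)) reach≤) (≤-trans g-exp 2^≤))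

    room : m * Δ ^ (R + r) + m < n H
    room = *-cancelˡ-≤ 2 (begin
      2 * suc (m * Δ ^ (R + r) + m) ≤⟨ *-monoʳ-≤ 2 (+-mono-≤ k≥1 (+-mono-≤ (*-mono-≤ m≤k (Δ^≤ (R + r))) m≤k)) ⟩
      2 * (k + (k * Y + k)) ≤⟨ *-monoʳ-≤ 2 (+-mono-≤ kY (+-monoʳ-≤ (k * Y) kY)) ⟩
      2 * (k * Y + (k * Y + k * Y)) ≤⟨ m≤m+n _ (2 * (k * Y)) ⟩
      2 * (k * Y + (k * Y + k * Y)) + 2 * (k * Y) ≡⟨ c k Y ⟩
      k * 2 ^ (3 + g * a * (R + r)) ≤⟨ *-monoʳ-≤ k (^-monoʳ-≤ 2 reach≤Λ) ⟩
      k * 2 ^ Λ ≤⟨ N≥ ⟩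
      2 * n H ∎)
      where
      open ≤-Reasoning
      Y : ℕ
      Y = 2 ^ (g * a * (R + r))
      kY : k ≤ k * Y
      kY = m≤m*n k Y ⦃ m^n≢0 2 (g * a * (R + r)) ⦄
      c : ∀ k y → 2 * (k * y + (k * y + k * y)) + 2 * (k * y) ≡ k * (2 * (2 * (2 * y)))
      c = solve-∀

    -- With y = i + 2 the left side is at most 2916 m y^5, where 2916 = 36·9 + 36·72. The factor 2^i
    -- absorbs the polynomial up to C, and a second factor m absorbs the constants: m has to exceed
    -- a constant only, not a power of Λ.
    early : ∀ i → i < i₁ → 2 * rate (suc i) * (m + 2 * (m * (2 + time (suc i)))) ≤ k * 2 ^ i
    early i _ = begin
      2 * rate (suc i) * (m + 2 * (m * (2 + time (suc i)))) ≤⟨ *-mono-≤ (≤-reflexive (cong (2 *_) (rate-def (suc i))))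
          (+-monoʳ-≤ m (*-monoʳ-≤ 2 (*-monoʳ-≤ m (+-monoʳ-≤ 2 time-y)))) ⟩
      2 * (18 * (y * y)) * (m + 2 * (m * (2 + (2 + y * (2 * (18 * (y * y))))))) ≡⟨ c₁ m y ⟩
      m * (36 * (y * y) * 9 + 2592 * (y * (y * (y * (y * (y * 1)))))) ≤⟨ *-monoʳ-≤ m (+-monoˡ-≤ _ (≤-trans (m≤m*n (36 * (y * y) * 9) (y * (y * y))) (≤-reflexive (c₂ y)))) ⟩
      m * (324 * y ^ 5 + 2592 * y ^ 5) ≡⟨ cong (m *_) (sym (*-distribʳ-+ (y ^ 5) 324 2592)) ⟩
      m * (2916 * y ^ 5) ≤⟨ *-monoʳ-≤ m (*-monoʳ-≤ 2916 (≤-trans (^-monoˡ-≤ 5 y≤) (≤-reflexive (^-distrib-* 2 (suc i) 5)))) ⟩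
      m * (2916 * (32 * suc i ^ 5)) ≤⟨ *-monoʳ-≤ m (*-monoʳ-≤ 2916 (*-monoʳ-≤ 32 (C-bound i))) ⟩
      m * (2916 * (32 * (C * 2 ^ i))) ≡⟨ c₃ 2916 32 m C (2 ^ i) ⟩
      m * (2916 * (32 * C)) * 2 ^ i ≤⟨ *-monoˡ-≤ (2 ^ i) (≤-trans (*-monoʳ-≤ m m-large) m²≤k) ⟩
      k * 2 ^ i ∎
      where
      open ≤-Reasoning
      y : ℕ
      y = suc (suc i)
      time-y : time (suc i) ≤ 2 + y * (2 * (18 * (y * y)))
      time-y = ≤-trans (time≤ (suc i)) (+-monoʳ-≤ 2 (*-mono-≤ (n≤1+n (suc i)) (≤-reflexive (cong (2 *_) (rate-def (suc i))))))
      y≤ : y ≤ 2 * suc i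
      y≤ = ≤-trans (s≤s (≤-trans (≤-reflexive (+-comm 1 i)) (+-monoʳ-≤ i (s≤s z≤n)))) (≤-reflexive (cong (suc i +_) (sym (+-identityʳ (suc i)))))
      c₁ : ∀ m y → 2 * (18 * (y * y)) * (m + 2 * (m * (2 + (2 + y * (2 * (18 * (y * y))))))) ≡ m * (36 * (y * y) * 9 + 2592 * (y * (y * (y * (y * (y * 1))))))
      c₁ = solve-∀
      c₂ : ∀ y → 36 * (y * y) * 9 * (y * (y * y)) ≡ 324 * (y * (y * (y * (y * (y * 1)))))
      c₂ = solve-∀
      c₃ : ∀ p q m C x → m * (p * (q * (C * x))) ≡ m * (p * (q * C)) * x
      c₃ = solve-∀

    rate-Λ : ∀ i → i < Λ → 2 * rate (suc i) ≤ Λ ^ 4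
    rate-Λ i lt = ≤-trans (*-monoʳ-≤ 2 (rate-mono lt)) (w*≤ 2 (m≤m+n 2 98))

    T≤ : 2 * T ≤ Λ ^ 7
    T≤ = times {1} {6} (const 2 (m≤m+n 2 98)) (≤-trans (time≤ Λ) (plus {5} {2} (up {1} {5} (s≤s z≤n) (const 2 (m≤m+n 2 98))) (times {1} {4} Λ≤ (w*≤ 2 (m≤m+n 2 98)))))

    used≤ : m + m * (m * (2 * T)) ≤ k * Λ ^ 8
    used≤ = plusᵇ {k} {7} (upᵇ {k} {0} {7} z≤n (≤-trans m≤k base)) (m²-in {7} T≤)

    Λ^≤ : ∀ e → Λ ^ e ≤ 2 ^ (e * g)
    Λ^≤ e = ≤-trans (^-monoˡ-≤ e Λ≤2^) (≤-reflexive (trans (^-*-assoc 2 g e) (cong (2 ^_) (*-comm g e))))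

    middle : ∀ i → i₁ ≤ i → i < Λ → 2 * rate (suc i) * (m + m * (m * (2 * T))) ≤ k * 2 ^ i
    middle i i₁≤i i<Λ = ≤-trans (timesᵇ {k} {4} {8} {2 * rate (suc i)} (rate-Λ i i<Λ) used≤)
      (*-monoʳ-≤ k (≤-trans (Λ^≤ 12) (^-monoʳ-≤ 2 i₁≤i)))

    late : ∀ i → i₂ ≤ i → i < Λ → 2 * rate (suc i) * ((m + m * (m * (2 * T))) + m * Δ ^ r) ≤ k * 2 ^ i
    late i i₂≤i i<Λ = begin
      2 * rate (suc i) * ((m + m * (m * (2 * T))) + m * Δ ^ r) ≤⟨ *-mono-≤ (≤-trans (rate-Λ i i<Λ) (Λ^≤ 4))
          (+-mono-≤ (≤-trans used≤ (*-monoʳ-≤ k (Λ^≤ 8))) (*-mono-≤ m≤k (Δ^≤ r))) ⟩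
      2 ^ (4 * g) * (k * x + k * y) ≤⟨ *-monoʳ-≤ (2 ^ (4 * g)) (+-mono-≤ (*-monoʳ-≤ k (m≤m*n x y ⦃ m^n≢0 2 (g * a * r) ⦄)) (*-monoʳ-≤ k (m≤n*m y x ⦃ m^n≢0 2 (8 * g) ⦄))) ⟩
      2 ^ (4 * g) * (k * (x * y) + k * (x * y)) ≡⟨ c (2 ^ (4 * g)) k x y ⟩
      k * (2 * ((2 ^ (4 * g) * x) * y)) ≡⟨ cong (λ z → k * (2 * (z * y))) (trans (sym (^-distribˡ-+-* 2 (4 * g) (8 * g))) (cong (2 ^_) (sym (*-distribʳ-+ g 4 8)))) ⟩
      k * (2 * (2 ^ (12 * g) * y)) ≡⟨ cong (k *_) (trans (sym (*-assoc 2 (2 ^ (12 * g)) y)) (sym (^-distribˡ-+-* 2 (suc (12 * g)) (g * a * r)))) ⟩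
      k * 2 ^ i₂ ≤⟨ *-monoʳ-≤ k (^-monoʳ-≤ 2 i₂≤i) ⟩
      k * 2 ^ i ∎
      where
      open ≤-Reasoning
      x y : ℕ
      x = 2 ^ (8 * g)
      y = 2 ^ (g * a * r)
      c : ∀ u k x y → u * (k * (x * y) + k * (x * y)) ≡ k * (2 * ((u * x) * y))
      c = solve-∀

    sparse-case : TopClique H m
    sparse-case = Sparse.far-cores-clique X m Δ i₁ i₂ rich (λ u∉ → ≰⇒> λ le → u∉ (into le)) few i₁≤i₂ room
      (≤-trans (*-monoˡ-≤ m (m≤m+n 5 3)) (≤-trans 8m≤q (m≤m+n q (q + 0))))
      (≤-trans (+-monoʳ-≤ k (*-monoʳ-≤ 7 m≤k)) 8k≤k₀) early middle late

-- Assembly of the theorem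

greatest : (P : ℕ → Set) → (∀ x → Dec (P x)) → P 0 → ∀ b → ¬ P b → Σ ℕ λ x → P x × ¬ P (suc x)
greatest P P? p₀ zero ¬p = ⊥-elim (¬p p₀)
greatest P P? p₀ (suc b) ¬p with P? b
... | yes p = b , p , ¬p
... | no ¬p' = greatest P P? p₀ b ¬p'

-- `two-step` from any vertex, with all other vertices as its second layer.
vertex-count : (X : Setting) → Setting.k₀ X ≤ n (Setting.H X)
vertex-count X = go (#-pick {A = ∁ ∅} (≤-trans N≥1 (≤-reflexive (sym (#-all λ u → into λ { ⟨ () ⟩ })))))
  where
  open Core X
  open ≤-Reasoning
  four : ∀ q → 2 * q + 2 * q ≡ 4 * q
  four = solve-∀
  q≥1 : 1 ≤ 2 * q
  q≥1 = ≤-trans (≤-trans (s≤s z≤n) s<q) (m≤m+n q (q + 0))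
  go : (Σ VH λ v → v ∈ ∁ ∅) → k₀ ≤ n H
  go (v , _) = ≤-trans (two-step v (adj H v) (∁ ｛ v ｝) id (λ p → outof p (into refl))
      (≤-trans (m≤m+n (2 * q) (2 * q)) (≤-trans (≤-reflexive (four q)) (degree≥ v))) rich) (#≤N _)
    where
    rich : ∀ {y} → y ∈ adj H v → 2 * q ≤ # (adj H y ∩ ∁ ｛ v ｝)
    rich {y} _ = +-cancelʳ-≤ (2 * q) _ _ (begin
      2 * q + 2 * q ≡⟨ four q ⟩
      4 * q ≤⟨ degree≥ y ⟩
      # (adj H y) ≤⟨ #-cover {B = adj H y ∩ ∁ ｛ v ｝} {C = ｛ v ｝} (λ {x} a → split a (x ≟F v)) ⟩
      # (adj H y ∩ ∁ ｛ v ｝) + # ｛ v ｝ ≤⟨ +-monoʳ-≤ _ (≤-trans (#-｛｝ v) q≥1) ⟩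
      # (adj H y ∩ ∁ ｛ v ｝) + 2 * q ∎)
      where
      split : ∀ {x} → x ∈ adj H y → Dec (x ≡ v) → x ∈ (adj H y ∩ ∁ ｛ v ｝) ⊎ x ∈ ｛ v ｝
      split a (yes e) = inj₂ (into e)
      split a (no ne) = inj₁ (into (a , into λ p → ne (outof p)))

module Constants (s' t : ℕ) where
  opaque
    -- Λ ≥ c₀ provides the numerical slack, t ≤ Λ, the bound Λ^{40s²} ≤ 2^Λ and, through 2^G₀, a
    -- large g. m ≥ m₀ pays for the early levels and gives m ≥ s. k ≥ K₀ gives m ≥ m₀ and, by the
    -- last summand, q ≤ k.
    C G₀ E₀ c₀ m₀ K₀ : ℕ
    C = proj₁ (poly≤exp 5)
    G₀ = 100 + ((60 * suc s' + 14) + proj₁ (eventually 64))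
    E₀ = proj₁ (eventually (40 * (suc s' * suc s')))
    c₀ = 100 + (t + (2 ^ G₀ + E₀))
    m₀ = 1 + (suc s' + 2916 * (32 * C))
    K₀ = 1 + (m₀ * m₀ + t * (2 ^ suc c₀) ^ s')

    C-bound : ∀ i → suc i ^ 5 ≤ C * 2 ^ i
    C-bound = proj₂ (poly≤exp 5)

    100≤G₀ : 100 ≤ G₀
    100≤G₀ = m≤m+n 100 _

    a≤G₀ : 60 * suc s' + 14 ≤ G₀
    a≤G₀ = ≤-trans (m≤m+n _ (proj₁ (eventually 64))) (m≤n+m _ 100)

    G₀-exp : ∀ g → G₀ ≤ g → g ^ 64 ≤ 2 ^ g
    G₀-exp g le = proj₂ (eventually 64) g (≤-trans (≤-trans (m≤n+m _ (60 * suc s' + 14)) (m≤n+m _ 100)) le)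

    100≤c₀ : 100 ≤ c₀
    100≤c₀ = m≤m+n 100 _

    t≤c₀ : t ≤ c₀
    t≤c₀ = ≤-trans (m≤m+n t _) (m≤n+m _ 100)

    2^G₀≤c₀ : 2 ^ G₀ ≤ c₀
    2^G₀≤c₀ = ≤-trans (≤-trans (m≤m+n (2 ^ G₀) E₀) (m≤n+m _ t)) (m≤n+m _ 100)

    c₀-exp : ∀ Λ → c₀ ≤ Λ → Λ ^ (40 * (suc s' * suc s')) ≤ 2 ^ Λ
    c₀-exp Λ le = proj₂ (eventually (40 * (suc s' * suc s'))) Λ (≤-trans (≤-trans (≤-trans (m≤n+m E₀ (2 ^ G₀)) (m≤n+m _ t)) (m≤n+m _ 100)) le)

    m₀≥1 : 1 ≤ m₀
    m₀≥1 = s≤s z≤n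

    s≤m₀ : suc s' ≤ m₀
    s≤m₀ = ≤-trans (m≤m+n (suc s') _) (n≤1+n _)

    C≤m₀ : 2916 * (32 * C) ≤ m₀
    C≤m₀ = ≤-trans (m≤n+m _ (suc s')) (n≤1+n _)

    K₀≥1 : 1 ≤ K₀
    K₀≥1 = s≤s z≤n

    m₀²≤K₀ : m₀ * m₀ ≤ K₀
    m₀²≤K₀ = ≤-trans (m≤m+n _ _) (n≤1+n _)

    t-K₀ : t * (2 ^ suc c₀) ^ s' ≤ K₀
    t-K₀ = ≤-trans (m≤n+m _ (m₀ * m₀)) (n≤1+n _)

large-clique : (X : Setting) (m : ℕ) → Scale X m → Constants.m₀ (Setting.s' X) (Setting.t X) ≤ m →
  Constants.c₀ (Setting.s' X) (Setting.t X) ≤ Setting.Λ X → TopClique (Setting.H X) m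
large-clique X m sc m₀≤m c₀≤Λ = star? (m ≤? # M.rich)
  where
  open Core X
  open Constants s' t
  open Scale sc
  module M = MainCase X m sc
  star? : Dec (m ≤ # M.rich) → TopClique H m
  star? (yes p) = M.star-case p
  star? (no ¬p) = dense? (Λ ^ (30 * s) ≤? m)
    where
    dense? : Dec (Λ ^ (30 * s) ≤ m) → TopClique H m
    dense? (yes d) = DenseCase.clique X m sc d
    dense? (no ¬d) = sparse (dyadic 1 Λ ≤-refl (≤-trans (s≤s z≤n) big))
      where
      sparse : (Σ ℕ λ g → Λ ≤ 1 * 2 ^ g × 1 * 2 ^ g ≤ 2 * Λ) → TopClique H m
      sparse (g , lo , hi) = M.SparseCase.sparse-case (<⇒≤ (≰⇒> ¬p)) (<⇒≤ (≰⇒> ¬d)) C C-bound (≤-trans C≤m₀ m₀≤m) g lo′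
          (≤-trans (≤-reflexive (sym (*-identityˡ _))) hi) (≤-trans 100≤G₀ G₀≤g) (≤-trans a≤G₀ G₀≤g) (G₀-exp g G₀≤g)
        where
        lo′ : Λ ≤ 2 ^ g
        lo′ = ≤-trans lo (≤-reflexive (*-identityˡ _))
        G₀≤g : G₀ ≤ g
        G₀≤g = ≮⇒≥ λ lt → <⇒≱ (^-monoʳ-< 2 (s≤s (s≤s z≤n)) lt) (≤-trans 2^G₀≤c₀ (≤-trans c₀≤Λ lo′))

-- Undoes the roundings from d to q, from q to k₀ and from k₀ to m². The 32 is 16 times the 2 in
-- `suc q ≤ 2 * q`, with q = 0 treated apart; the exponent s - 1 of the collected constant is
-- relaxed to 2(s - 1).
order-bound : ∀ s' t b D q k₀ W m → 1 ≤ s' → 1 ≤ t → 1 ≤ W → D ≤ 16 * b * suc q → q * q ^ s' < t * suc k₀ ^ s' → suc k₀ ≤ W * (m * m) →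
  1 ^ (2 * s') * D ^ suc s' ≤ ((32 * t) * (32 * W)) ^ (2 * s') * m ^ (2 * s') * b ^ suc s'
order-bound s' t b D q k₀ W m s'≥1 t≥1 W≥1 D≤ q< k₀≤ = begin
  1 ^ (2 * s') * D ^ suc s' ≡⟨ trans (cong (_* D ^ suc s') (^-zeroˡ (2 * s'))) (*-identityˡ _) ⟩
  D ^ suc s' ≤⟨ ^-monoˡ-≤ (suc s') D≤ ⟩
  (16 * b * suc q) ^ suc s' ≡⟨ trans (^-distrib-* (16 * b) (suc q) (suc s')) (cong (_* suc q ^ suc s') (^-distrib-* 16 b (suc s'))) ⟩
  (16 ^ suc s' * b ^ suc s') * suc q ^ suc s' ≤⟨ *-monoʳ-≤ (16 ^ suc s' * b ^ suc s') (≤-trans q⁺ (*-monoʳ-≤ (2 ^ suc s') (*-monoʳ-≤ t (^-monoˡ-≤ s' k₀≤)))) ⟩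
  (16 ^ suc s' * b ^ suc s') * (2 ^ suc s' * (t * (W * (m * m)) ^ s')) ≡⟨ cong (λ z → (16 ^ suc s' * b ^ suc s') * (2 ^ suc s' * (t * z))) (trans (^-distrib-* W (m * m) s') (cong (W ^ s' *_) square)) ⟩
  (16 ^ suc s' * b ^ suc s') * (2 ^ suc s' * (t * (W ^ s' * m ^ (2 * s')))) ≡⟨ c₁ (16 ^ suc s') (b ^ suc s') (2 ^ suc s') t (W ^ s') (m ^ (2 * s')) ⟩
  (16 ^ suc s' * 2 ^ suc s') * (t * W ^ s') * (m ^ (2 * s') * b ^ suc s') ≡⟨ cong (λ z → z * (t * W ^ s') * (m ^ (2 * s') * b ^ suc s')) (sym (^-distrib-* 16 2 (suc s'))) ⟩
  (32 * 32 ^ s') * (t * W ^ s') * (m ^ (2 * s') * b ^ suc s') ≡⟨ cong (_* (m ^ (2 * s') * b ^ suc s')) (trans (c₂ 32 (32 ^ s') t (W ^ s')) (cong (32 * t *_) (sym (^-distrib-* 32 W s')))) ⟩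
  (32 * t * (32 * W) ^ s') * (m ^ (2 * s') * b ^ suc s') ≤⟨ *-monoˡ-≤ (m ^ (2 * s') * b ^ suc s') (≤-trans (*-monoˡ-≤ ((32 * W) ^ s') (self-power (32 * t) T≥1)) (≤-trans (≤-reflexive (sym (^-distrib-* (32 * t) (32 * W) s')))
      (^-monoʳ-≤ Q ⦃ >-nonZero (*-mono-≤ T≥1 (*-mono-≤ (s≤s (z≤n {31})) W≥1)) ⦄ (m≤m+n s' (s' + 0))))) ⟩
  Q ^ (2 * s') * (m ^ (2 * s') * b ^ suc s') ≡⟨ sym (*-assoc (Q ^ (2 * s')) _ _) ⟩
  Q ^ (2 * s') * m ^ (2 * s') * b ^ suc s' ∎
  where
  open ≤-Reasoning
  Q : ℕ
  Q = (32 * t) * (32 * W)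
  T≥1 : 1 ≤ 32 * t
  T≥1 = *-mono-≤ (s≤s (z≤n {31})) t≥1
  c₁ : ∀ a b c t w m → (a * b) * (c * (t * (w * m))) ≡ (a * c) * (t * w) * (m * b)
  c₁ = solve-∀
  c₂ : ∀ a b t w → (a * b) * (t * w) ≡ a * t * (b * w)
  c₂ = solve-∀
  square : (m * m) ^ s' ≡ m ^ (2 * s')
  square = trans (^-distrib-* m m s') (trans (sym (^-distribˡ-+-* m s' s')) (cong (λ z → m ^ (s' + z)) (sym (+-identityʳ s'))))
  self-power : ∀ y → 1 ≤ y → y ≤ y ^ s'
  self-power y y≥1 = ≤-trans (≤-reflexive (sym (*-identityʳ y))) (^-monoʳ-≤ y ⦃ >-nonZero y≥1 ⦄ s'≥1)
  q⁺ : suc q ^ suc s' ≤ 2 ^ suc s' * (t * suc k₀ ^ s')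
  q⁺ = go q q<
    where
    go : ∀ q → q * q ^ s' < t * suc k₀ ^ s' → suc q ^ suc s' ≤ 2 ^ suc s' * (t * suc k₀ ^ s')
    go zero _ = ≤-trans (≤-reflexive (^-zeroˡ (suc s'))) (*-mono-≤ (m^n>0 2 (suc s')) (*-mono-≤ t≥1 (m^n>0 (suc k₀) s')))
    go q@(suc q') lt = ≤-trans (^-monoˡ-≤ (suc s') (≤-trans (+-monoˡ-≤ q (s≤s z≤n)) (≤-reflexive (cong (q +_) (sym (+-identityʳ q))))))
      (≤-trans (≤-reflexive (^-distrib-* 2 q (suc s'))) (*-monoʳ-≤ (2 ^ suc s') (<⇒≤ lt)))

single-vertex : (G : Graph) → V G → TopClique G 1
single-vertex G v = record { branch = λ _ → v ; branch-inj = λ { {zero} {zero} _ → refl } ; inner = λ _ _ → []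
  ; isPath = λ { zero zero () } ; avoidBranch = λ { zero zero () } ; disjoint = λ { zero zero _ _ () } }

module Conclusion (s' t : ℕ) (s'≥1 : 1 ≤ s') (t≥1 : 1 ≤ t) (G : Graph) (free : KstFree (suc s') t G) (pos : 0 < degSum G) where
  open Constants s' t

  module Large (q k₀ k m : ℕ) (q-def : 16 * n G * q ≤ degSum G) (k₀-small : t * k₀ ^ s' ≤ q * q ^ s') (k₀-max : ¬ t * suc k₀ ^ s' ≤ q * q ^ s')
    (k-small : k * 2 ^ c₀ ≤ k₀) (k-max : ¬ suc k * 2 ^ c₀ ≤ k₀) (K₀≤k : K₀ ≤ k) (m²≤k : m * m ≤ k) (m-max : ¬ suc m * suc m ≤ k)
    (n≥1 : 1 ≤ n G) where

    k≥1 : 1 ≤ k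
    k≥1 = ≤-trans K₀≥1 K₀≤k

    m₀≤m : m₀ ≤ m
    m₀≤m = ≮⇒≥ λ lt → m-max (≤-trans (*-mono-≤ lt lt) (≤-trans m₀²≤K₀ K₀≤k))

    m≥1 : 1 ≤ m
    m≥1 = ≤-trans m₀≥1 m₀≤m

    double : ∀ {x} → 1 ≤ x → suc x ≤ 2 * x
    double {x} x≥1 = ≤-trans (+-monoˡ-≤ x x≥1) (≤-reflexive (cong (x +_) (sym (+-identityʳ x))))

    k≤4m² : k ≤ 4 * (m * m)
    k≤4m² = ≤-trans (<⇒≤ (≰⇒> m-max)) (≤-trans (*-mono-≤ (double m≥1) (double m≥1)) (≤-reflexive (c m)))
      where
      c : ∀ m → (2 * m) * (2 * m) ≡ 4 * (m * m)
      c = solve-∀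

    64k≤k₀ : 64 * k ≤ k₀
    64k≤k₀ = ≤-trans (*-monoˡ-≤ k (^-monoʳ-≤ 2 {6} (≤-trans (m≤m+n 6 94) 100≤c₀))) (≤-trans (≤-reflexive (*-comm (2 ^ c₀) k)) k-small)

    -- If q < 8m then q^s < (8m)^s ≤ (8m)^{2(s-1)}, where s ≥ 2 enters. Since (8m)² ≤ 64k ≤ k₀, this
    -- contradicts `k₀-small`.
    8m≤q : 8 * m ≤ q
    8m≤q = ≮⇒≥ λ lt → <⇒≱ (absurd lt) k₀-small
      where
      open ≤-Reasoning
      A : ℕ
      A = 8 * m
      A≥1 : 1 ≤ A
      A≥1 = ≤-trans m≥1 (m≤m+n m _)
      c : ∀ m → (8 * m) * (8 * m) ≡ 64 * (m * m)
      c = solve-∀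
      absurd : q < A → q * q ^ s' < t * k₀ ^ s'
      absurd lt = begin-strict
        q * q ^ s' ≤⟨ *-monoʳ-≤ q (^-monoˡ-≤ s' (<⇒≤ lt)) ⟩
        q * A ^ s' <⟨ *-monoˡ-< (A ^ s') ⦃ >-nonZero (m^n>0 A ⦃ >-nonZero A≥1 ⦄ s') ⦄ lt ⟩
        A * A ^ s' ≤⟨ *-monoˡ-≤ (A ^ s') (≤-trans (≤-reflexive (sym (*-identityʳ A))) (^-monoʳ-≤ A ⦃ >-nonZero A≥1 ⦄ s'≥1)) ⟩
        A ^ s' * A ^ s' ≡⟨ sym (^-distrib-* A A s') ⟩
        (A * A) ^ s' ≤⟨ ^-monoˡ-≤ s' (≤-trans (≤-reflexive (c m)) (≤-trans (*-monoʳ-≤ 64 m²≤k) 64k≤k₀)) ⟩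
        k₀ ^ s' ≤⟨ m≤n*m (k₀ ^ s') t ⦃ >-nonZero t≥1 ⦄ ⟩
        t * k₀ ^ s' ∎

    -- If k < q, the constant in k₀ < 2^{c₀+1} k, which K₀ ≤ q already includes, would make k₀ + 1
    -- admissible, against `k₀-max`.
    q≤k : q ≤ k
    q≤k = ≮⇒≥ λ lt → k₀-max (begin
      t * suc k₀ ^ s' ≤⟨ *-monoʳ-≤ t (^-monoˡ-≤ s' (≤-trans (≰⇒> k-max) (≤-trans (*-monoˡ-≤ (2 ^ c₀) (double k≥1)) (≤-reflexive (c k (2 ^ c₀)))))) ⟩
      t * (2 ^ suc c₀ * k) ^ s' ≡⟨ trans (cong (t *_) (^-distrib-* (2 ^ suc c₀) k s')) (sym (*-assoc t _ _)) ⟩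
      t * (2 ^ suc c₀) ^ s' * k ^ s' ≤⟨ *-mono-≤ (≤-trans (≤-trans t-K₀ K₀≤k) (<⇒≤ lt)) (^-monoˡ-≤ s' (<⇒≤ lt)) ⟩
      q * q ^ s' ∎)
      where
      open ≤-Reasoning
      c : ∀ k x → 2 * k * x ≡ 2 * x * k
      c = solve-∀

    module KS = KomlosSzemeredi k (degSum G) (n G) k≥1 pos

    -- G itself qualifies because ρ never exceeds 2.
    dense : KS.DensePair (n G) (degSum G)
    dense = n≥1 , ≤-trans (*-monoʳ-≤ D (*-monoˡ-≤ b (≤-trans (n≤1+n (suc (2 * l))) (≤-reflexive (cong suc (sym (+-suc l (l + 0)))))))) (≤-reflexive (c D b l))
      where
      D b l : ℕ
      D = degSum G
      b = n G
      l = lev k b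
      c : ∀ D b l → D * (2 * suc l * b) ≡ 2 * b * (suc l * D)
      c = solve-∀

    in-expander : (H : Graph) → Embedding H G → KS.DensePair (n H) (degSum H) → KS.Minimal H → TopClique G m
    in-expander H e dH min = go (dyadic k (n H) k≥1 k≤N)
      where
      setting : ∀ Λ → n H ≤ k * 2 ^ Λ → Setting
      setting Λ N≤ = record { H = H ; s' = s' ; t = t ; q = q ; k = k ; k₀ = k₀ ; Λ = Λ ; free = KstFree-emb {s = suc s'} {t} e free
        -- The 16 in `q-def` is the 4 lost in `min-degree` times the 4 wanted here.
        ; degree≥ = λ v → *-cancelˡ-≤ (4 * n G) ⦃ >-nonZero (*-mono-≤ (s≤s (z≤n {3})) n≥1) ⦄
            (≤-trans (≤-reflexive (c (n G) q)) (≤-trans q-def (KS.min-degree H dH min v)))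
        ; 2s≤q = ≤-trans (*-monoʳ-≤ 2 (≤-trans s≤m₀ m₀≤m)) (≤-trans (*-monoˡ-≤ m (m≤m+n 2 6)) 8m≤q)
        ; k≥1 = k≥1 ; k₀-small = k₀-small ; exp = KS.expander H dH min ; N≤ = N≤ ; N≥1 = proj₁ dH }
        where
        c : ∀ b q → 4 * b * (4 * q) ≡ 16 * b * q
        c = solve-∀
      -- A crude Λ, the order of H, already makes a setting in which vertices can be counted. The
      -- sharp Λ of `dyadic` presupposes k ≤ n H, which follows from this count.
      k₀≤N : k₀ ≤ n H
      k₀≤N = vertex-count (setting (n H) (≤-trans (n≤1+n (n H)) (≤-trans (suc≤2^ (n H)) (m≤n*m (2 ^ n H) k ⦃ >-nonZero k≥1 ⦄))))
      k≤N : k ≤ n H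
      k≤N = ≤-trans (≤-trans (m≤m+n k _) 64k≤k₀) k₀≤N
      go : (Σ ℕ λ Λ → n H ≤ k * 2 ^ Λ × k * 2 ^ Λ ≤ 2 * n H) → TopClique G m
      go (Λ , lo , hi) = TopClique-emb e (large-clique (setting Λ lo) m scale m₀≤m c₀≤Λ)
        where
        -- This is why k is k₀ divided by 2^c₀: H has at least k₀ ≥ k 2^c₀ and at most k 2^Λ
        -- vertices.
        c₀≤Λ : c₀ ≤ Λ
        c₀≤Λ = ≮⇒≥ λ lt → <⇒≱ (^-monoʳ-< 2 (s≤s (s≤s z≤n)) lt) (*-cancelˡ-≤ k ⦃ >-nonZero k≥1 ⦄ (≤-trans k-small (≤-trans k₀≤N lo)))
        scale : Scale (setting Λ lo) m
        scale = record { big = ≤-trans 100≤c₀ c₀≤Λ ; t≤Λ = ≤-trans t≤c₀ c₀≤Λ ; s≥2 = s≤s s'≥1 ; q≤k = q≤k ; m²≤k = m²≤k ; k≤4m² = k≤4m²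
          ; 8m≤q = 8m≤q ; 8k≤k₀ = ≤-trans (*-monoˡ-≤ k (m≤m+n 8 56)) 64k≤k₀ ; N≥ = hi ; Λ-exp = c₀-exp Λ c₀≤Λ }

    clique : TopClique G m
    clique = let (H , e , dH , min) = KS.minimal-dense (n G) G ≤-refl dense in in-expander H e dH min

  -- K₀ covers the case k < K₀, and 4 is the loss in k ≤ 4m².
  W : ℕ
  W = 2 ^ c₀ * (K₀ + 4)

  W≥1 : 1 ≤ W
  W≥1 = *-mono-≤ (m^n>0 2 c₀) (≤-trans K₀≥1 (m≤m+n K₀ 4))

  Outcome : Set
  Outcome = Σ ℕ λ m → TopClique G m ×
    1 ^ (2 * s') * degSum G ^ suc s' ≤ ((32 * t) * (32 * W)) ^ (2 * s') * m ^ (2 * s') * n G ^ suc s'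

  vertex : V G
  vertex = proj₁ (#-pick {A = ∁ ∅} (≤-trans (positive (n G) refl) (≤-reflexive (sym (#-all {A = ∁ ∅} λ u → into λ { ⟨ () ⟩ })))))
    where
    positive : ∀ z → z ≡ n G → 1 ≤ n G
    positive (suc z) e = ≤-trans (s≤s z≤n) (≤-reflexive e)
    positive zero e = ⊥-elim (<⇒≱ pos (≤-trans (≤-reflexive (degSum-∑ G)) (≤-trans (∑-mono (λ u → #≤N (adj G u)))
      (≤-reflexive (trans (∑-const (n G) (n G)) (cong (λ z → z * n G) (sym e)))))))

  n≥1 : 1 ≤ n G
  n≥1 = ≤-trans (s≤s z≤n) (toℕ<n vertex)

  outcome : Outcome
  outcome = choose-q (greatest (λ x → 16 * n G * x ≤ degSum G) (λ x → _ ≤? _) (≤-trans (≤-reflexive (*-zeroʳ (16 * n G))) z≤n) (suc (degSum G))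
      λ le → <⇒≱ (n<1+n (degSum G)) (≤-trans (m≤n*m (suc (degSum G)) (16 * n G) ⦃ >-nonZero (*-mono-≤ (s≤s (z≤n {15})) n≥1) ⦄) le))
    where
    choose-q : (Σ ℕ λ q → 16 * n G * q ≤ degSum G × ¬ 16 * n G * suc q ≤ degSum G) → Outcome
    choose-q (q , q-def , q-max) = choose-k₀ (greatest (λ x → t * x ^ s' ≤ q * q ^ s') (λ x → _ ≤? _) at-zero (suc (q * q ^ s')) too-big)
      where
      at-zero : t * 0 ^ s' ≤ q * q ^ s'
      at-zero = go s' s'≥1
        where
        go : ∀ e → 1 ≤ e → t * 0 ^ e ≤ q * q ^ s'
        go (suc e) _ = ≤-trans (≤-reflexive (*-zeroʳ t)) z≤n
      too-big : ¬ t * suc (q * q ^ s') ^ s' ≤ q * q ^ s'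
      too-big le = <⇒≱ (n<1+n (q * q ^ s')) (≤-trans (≤-trans (≤-trans (≤-reflexive (sym (*-identityʳ _))) (^-monoʳ-≤ (suc (q * q ^ s')) s'≥1))
        (m≤n*m (suc (q * q ^ s') ^ s') t ⦃ >-nonZero t≥1 ⦄)) le)
      choose-k₀ : (Σ ℕ λ k₀ → t * k₀ ^ s' ≤ q * q ^ s' × ¬ t * suc k₀ ^ s' ≤ q * q ^ s') → Outcome
      choose-k₀ (k₀ , k₀-small , k₀-max) = choose-k (greatest (λ x → x * 2 ^ c₀ ≤ k₀) (λ x → _ ≤? _) z≤n (suc k₀)
          λ le → <⇒≱ (n<1+n k₀) (≤-trans (m≤m*n (suc k₀) (2 ^ c₀) ⦃ m^n≢0 2 c₀ ⦄) le))
        where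
        finish : ∀ m → TopClique G m → suc k₀ ≤ W * (m * m) → Outcome
        finish m K le = m , K , order-bound s' t (n G) (degSum G) q k₀ W m s'≥1 t≥1 W≥1 (<⇒≤ (≰⇒> q-max)) (≰⇒> k₀-max) le
        choose-k : (Σ ℕ λ k → k * 2 ^ c₀ ≤ k₀ × ¬ suc k * 2 ^ c₀ ≤ k₀) → Outcome
        choose-k (k , k-small , k-max) = split (K₀ ≤? k)
          where
          k₀< : suc k₀ ≤ 2 ^ c₀ * suc k
          k₀< = ≤-trans (≰⇒> k-max) (≤-reflexive (*-comm (suc k) (2 ^ c₀)))
          split : Dec (K₀ ≤ k) → Outcome
          -- The average degree is bounded by a constant here, and a single vertex, a subdivision of
          -- K_1, is enough.
          split (no ¬p) = finish 1 (single-vertex G vertex) (≤-trans k₀< (≤-trans (*-monoʳ-≤ (2 ^ c₀) (≤-trans (≰⇒> ¬p) (m≤m+n K₀ 4))) (≤-reflexive (sym (*-identityʳ W)))))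
          split (yes p) = choose-m (greatest (λ x → x * x ≤ k) (λ x → _ ≤? _) z≤n (suc k) λ le → <⇒≱ (n<1+n k) (≤-trans (m≤m*n (suc k) (suc k)) le))
            where
            choose-m : (Σ ℕ λ m → m * m ≤ k × ¬ suc m * suc m ≤ k) → Outcome
            choose-m (m , m²≤k , m-max) = finish m L.clique (≤-trans k₀< (≤-trans (*-monoʳ-≤ (2 ^ c₀) bound) (≤-reflexive (sym (*-assoc (2 ^ c₀) (K₀ + 4) (m * m))))))
              where
              module L = Large q k₀ k m q-def k₀-small k₀-max k-small k-max p m²≤k m-max n≥1
              bound : suc k ≤ (K₀ + 4) * (m * m)
              bound = ≤-trans (+-mono-≤ (*-mono-≤ K₀≥1 (*-mono-≤ L.m≥1 L.m≥1)) L.k≤4m²) (≤-reflexive (sym (*-distribʳ-+ (m * m) K₀ 4)))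

-- The inequality is m ≥ (p/q) d^{s/(2(s-1))} for d = `degSum G` / `n G`, raised to the power 2(s-1)
-- and cleared of denominators; the constant c is the rational p/q.
theorem1p1 : (s t : ℕ) → 2 ≤ s → s ≤ t →
    Σ ℕ λ p → Σ ℕ λ q → 1 ≤ p × 1 ≤ q ×
    ((G : Graph) → KstFree s t G → 0 < degSum G →
    Σ ℕ λ m → TopClique G m ×
    (p ^ (2 * (s ∸ 1))) * (degSum G ^ s) ≤ (q ^ (2 * (s ∸ 1))) * (m ^ (2 * (s ∸ 1))) * (n G ^ s))
theorem1p1 (suc s') t (s≤s s'≥1) s≤t = 1 , (32 * t) * (32 * (2 ^ c₀ * (K₀ + 4))) , ≤-refl ,
    *-mono-≤ (*-mono-≤ (s≤s (z≤n {31})) t≥1) (*-mono-≤ (s≤s (z≤n {31})) (*-mono-≤ (m^n>0 2 c₀) (≤-trans K₀≥1 (m≤m+n K₀ 4)))) ,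
    λ G free pos → Conclusion.outcome s' t s'≥1 t≥1 G free pos
  where
  open Constants s' t
  t≥1 : 1 ≤ t
  t≥1 = ≤-trans (s≤s z≤n) s≤t
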